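{- If $\sigma(x)/x\in\mathbb{Z}[\zeta_p]$, then $I=x\mathcal{O}_\mathbb{K}$, i.e. $I$ is the principal ideal of $\mathcal{O}_\mathbb{K}$ generated by $x$.
   Context: Let $n>1$ be an odd integer and $p$ a prime with $p\equiv 1 \pmod n$. Let $\zeta_p=e^{2\pi i/p}$, let $r$ be a primitive root modulo $p$, and let $\sigma$ be the automorphism of $\mathbb{Q}(\zeta_p)$ with $\sigma(\zeta_p)=\zeta_p^r$. Let $\mathbb{K}=\{y\in\mathbb{Q}(\zeta_p):\sigma^n(y)=y\}$. Let $\alpha=\prod_{j=0}^{(p-3)/2}(1-\zeta_p^{r^j})$, let $\lambda$ be an integer with $\lambda(r-1)\equiv1\pmod p$, $z=\zeta_p^{\lambda}\alpha(1-\zeta_p)$, and $x=\mathrm{Tr}_{\mathbb{Q}(\zeta_p)/\mathbb{K}}(z)=\sum_{j=1}^{(p-1)/n}\sigma^{jn}(z)$. Let $I$ be the $\mathbb{Z}$-module generated by $x,\sigma(x),\dots,\sigma^{n-1}(x)$ (it is an ideal of $\mathcal{O}_\mathbb{K}$). -}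

module Defs where

open import Algebra.Bundles.Raw using (RawRing)
import Algebra.Definitions.RawMonoid as RawMonoidDefs
import Algebra.Definitions.RawSemiring as RawSemiringDefs
open import Algebra.Morphism.Structures using (module RingMorphisms)
open import Data.Bool.Base using (if_then_else_)
open import Data.Fin.Base using (Fin; toℕ)
open import Data.Integer.Base as ℤ using (ℤ; +_; 1ℤ; ∣_∣)
open import Data.Integer.Divisibility using () renaming (_∣_ to _∣ℤ_)
open import Data.Nat.Base as ℕ using (ℕ; suc; _∸_)
open import Data.Nat.Divisibility using (_∣?_)
open import Data.Product.Base using (_×_; ∃; ∃-syntax)
open import Data.Rational.Base as ℚ using (ℚ; 0ℚ; 1ℚ)
open import Data.Vec.Functional using (Vector)
import Function.Endo.Propositional as Endo
open import Level using (0ℓ)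
open import Relation.Binary.PropositionalEquality.Core using (_≡_)
open import Relation.Nullary using (¬_; does)
open import Relation.Unary using (Pred; _∈_)

infix 4 _≡_[mod_]

_≡_[mod_] : ℤ → ℤ → ℕ → Set
a ≡ b [mod m ] = + m ∣ℤ a ℤ.- b

IsPrimitiveRoot : ℕ → ℤ → Set
IsPrimitiveRoot p r =
  ¬ (+ p ∣ℤ r) × (∀ a → ¬ (+ p ∣ℤ a) → ∃[ k ] a ≡ r ℤ.^ k [mod p ])

-- The field ℚ(ζₚ) for p prime, as ℚ[X]/(1 + X + … + Xᵖ⁻¹).

module Cyclotomic (p : ℕ) where

  -- f : ℚ⟨ζ⟩ stands for Σᵢ f(i) ζⁱ, summed over 0 ≤ i < p.

  ℚ⟨ζ⟩ : Set
  ℚ⟨ζ⟩ = Vector ℚ p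

  open RawMonoidDefs ℚ.+-0-rawMonoid using () renaming (sum to sumℚ)

  infix  8 -_
  infixl 7 _*_
  infixr 7 _•_
  infixl 6 _+_ _-_
  infix  4 _≈_

  -- These p powers of ζ span ℚ(ζ), and the ℚ-linear relations among them are
  -- exactly the multiples of 1 + ζ + … + ζᵖ⁻¹ = 0.

  _≈_ : ℚ⟨ζ⟩ → ℚ⟨ζ⟩ → Set
  f ≈ g = ∃[ c ] ∀ i → f i ≡ g i ℚ.+ c

  -- ζᵏ, which depends only on k modulo p since ζᵖ = 1.

  ζ^_ : ℤ → ℚ⟨ζ⟩
  (ζ^ k) i = if does (p ∣? ∣ + toℕ i ℤ.- k ∣) then 1ℚ else 0ℚ

  ζ : ℚ⟨ζ⟩
  ζ = ζ^ 1ℤ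

  0# 1# : ℚ⟨ζ⟩
  0# _ = 0ℚ
  1# = ζ^ (+ 0)

  _+_ : ℚ⟨ζ⟩ → ℚ⟨ζ⟩ → ℚ⟨ζ⟩
  (f + g) i = f i ℚ.+ g i

  -_ : ℚ⟨ζ⟩ → ℚ⟨ζ⟩
  (- f) i = ℚ.- f i

  _-_ : ℚ⟨ζ⟩ → ℚ⟨ζ⟩ → ℚ⟨ζ⟩
  f - g = f + (- g)

  -- The ℚ-bilinear extension of ζⁱ ζʲ = ζⁱ⁺ʲ.

  _*_ : ℚ⟨ζ⟩ → ℚ⟨ζ⟩ → ℚ⟨ζ⟩
  (f * g) k =
    sumℚ λ i → sumℚ λ j → (f i ℚ.* g j) ℚ.* (ζ^ (+ (toℕ i ℕ.+ toℕ j))) k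

  _•_ : ℤ → ℚ⟨ζ⟩ → ℚ⟨ζ⟩
  (a • f) i = (a ℚ./ 1) ℚ.* f i

  rawRing : RawRing 0ℓ 0ℓ
  rawRing = record
    { Carrier = ℚ⟨ζ⟩ ; _≈_ = _≈_ ; _+_ = _+_ ; _*_ = _*_ ; -_ = -_
    ; 0# = 0# ; 1# = 1# }

  open RawSemiringDefs (RawRing.rawSemiring rawRing) public
    using (sum; product; _^_)

  -- Σᵢ aᵢ yⁱ over 0 ≤ i < d.

  ⟦_⟧ : ∀ {d} → Vector ℤ d → ℚ⟨ζ⟩ → ℚ⟨ζ⟩
  ⟦ a ⟧ y = sum λ i → a i • y ^ toℕ i

  ℤ[ζ] : Pred ℚ⟨ζ⟩ 0ℓ
  ℤ[ζ] y = ∃[ d ] ∃ λ (a : Vector ℤ d) → y ≈ ⟦ a ⟧ ζ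

  -- y is a root of the monic polynomial Xᵈ + Σᵢ aᵢ Xⁱ.

  Integral : Pred ℚ⟨ζ⟩ 0ℓ
  Integral y = ∃[ d ] ∃ λ (a : Vector ℤ d) → y ^ d + ⟦ a ⟧ y ≈ 0#

  IsAutomorphism : Pred (ℚ⟨ζ⟩ → ℚ⟨ζ⟩) 0ℓ
  IsAutomorphism = RingMorphisms.IsRingIsomorphism rawRing rawRing

  -- y/x ∈ S, stated without inverses; it also holds when x and y are both 0
  -- and S is inhabited.

  infix 4 _/_∈_

  _/_∈_ : ℚ⟨ζ⟩ → ℚ⟨ζ⟩ → Pred ℚ⟨ζ⟩ 0ℓ → Set
  y / x ∈ S = ∃[ u ] u ∈ S × u * x ≈ y

  open Endo ℚ⟨ζ⟩ public using () renaming (_^_ to _^∘_)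

  module FixedField (n : ℕ) .{{_ : ℕ.NonZero n}} (σ : ℚ⟨ζ⟩ → ℚ⟨ζ⟩) where

    𝕂 : Pred ℚ⟨ζ⟩ 0ℓ
    𝕂 y = (σ ^∘ n) y ≈ y

    𝓞 : Pred ℚ⟨ζ⟩ 0ℓ
    𝓞 y = y ∈ 𝕂 × y ∈ Integral

    -- Σⱼ σʲⁿ(y) over 1 ≤ j ≤ (p-1)/n.

    Tr : ℚ⟨ζ⟩ → ℚ⟨ζ⟩
    Tr y = sum {(p ∸ 1) ℕ./ n} λ j → (σ ^∘ (suc (toℕ j) ℕ.* n)) y

    conjugateSpan : ℚ⟨ζ⟩ → Pred ℚ⟨ζ⟩ 0ℓ
    conjugateSpan x y =
      ∃ λ (c : Vector ℤ n) → y ≈ sum λ i → c i • (σ ^∘ toℕ i) x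

    principalIdeal : ℚ⟨ζ⟩ → Pred ℚ⟨ζ⟩ 0ℓ
    principalIdeal x y = ∃[ a ] a ∈ 𝓞 × y ≈ x * a

  -- The product has (p-3)/2 + 1 factors, 0 ≤ j ≤ (p-3)/2.

  α : ℤ → ℚ⟨ζ⟩
  α r = product {suc ((p ∸ 3) ℕ./ 2)} λ j → 1# - ζ^ (r ℤ.^ toℕ j)

{-# OPTIONS --safe #-}

-- Put w = ζˡ α, so that z = w (1 − ζ). Moving the factors of α by σ gives σ(w) = −w, hence
-- the elements w (1 − ζᵏ) with p ∤ k are, up to sign, the conjugates of z, and their traces
-- are, up to sign, the conjugates of x. For b = Σ bᵢ ζⁱ the product z b telescopes into a
-- combination of these elements with coefficients ±bᵢ.
--
-- If a ∈ 𝓞, then a ∈ ℤ[ζ], because ℤ[ζ] is integrally closed: p times the differences of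
-- the coordinates of a are traces of multiples of ζ − 1 by integral elements, and p divides
-- the norm of ζ − 1. Hence x a = Tr(z a) lies in the span of the conjugates of x.
--
-- Conversely σ(x) = u x with u ∈ ℤ[ζ] makes every Tr(z b) a multiple of x. Since z is
-- invertible, so is x; thus u is fixed by σⁿ, and the conjugates of x are x times products
-- of conjugates of u. These are integral, being roots of ∏ₖ (X − σᵏ(u)) ∈ ℤ[X].

module Submission where

open import Defs
open import Data.Integer.Base using (ℤ; 1ℤ) renaming (_*_ to _*ℤ_; _-_ to _-ℤ_)
open import Data.Nat.Base using (ℕ; NonZero; _<_; _∸_)
open import Data.Nat.Divisibility using (_∣_)
open import Data.Nat.Primality using (Prime)
open import Relation.Nullary using (¬_)
open import Relation.Unary using (_≐_)

open import Algebra.Bundles using (CommutativeRing; CommutativeMonoid; Monoid)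
import Algebra.Definitions.RawMonoid as RawMonoidDefs
import Algebra.Morphism.Construct.Composition as Composition
import Algebra.Morphism.Construct.Identity as Identity
open import Algebra.Morphism.Structures using (module RingMorphisms; module MonoidMorphisms)
import Algebra.Properties.CommutativeMonoid.Sum as CommutativeMonoidSum
import Algebra.Properties.CommutativeSemiring.Exp as CommutativeSemiringExp
import Algebra.Properties.Ring as RingProperties
import Algebra.Properties.Semiring.Sum as SemiringSum
import Algebra.Solver.Ring as RingSolver
open import Algebra.Solver.Ring.AlmostCommutativeRing using (fromCommutativeRing; _-Raw-AlmostCommutative⟶_)
open import Data.Bool.Base using (if_then_else_)
open import Data.Fin.Base as Fin using (Fin; toℕ; fromℕ<)
import Data.Fin.Properties as Fin
open import Data.Integer.Base as ℤ using (+_; -[1+_]; ∣_∣; 0ℤ)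
open import Data.Integer.Divisibility using () renaming (_∣_ to _∣ℤ_)
open import Data.Integer.Divisibility.Signed as ℤ∣ using (divides; ∣ᵤ⇒∣; ∣⇒∣ᵤ)
open import Data.Integer.DivMod as ℤ using (_%ℕ_; _/ℕ_)
import Data.Integer.Properties as ℤ
open import Data.Integer.Tactic.RingSolver using () renaming (solve-∀ to ℤ-solve-∀)
open import Data.Maybe.Base using (Maybe; nothing; just)
open import Data.Nat.Base as ℕ using (zero; suc; s≤s; z≤n)
open import Data.Nat.Coprimality as Coprime using (Coprime)
import Data.Nat.Divisibility as ℕ
import Data.Nat.DivMod as ℕ
open import Data.Nat.Induction using (<-rec)
open import Data.Nat.Primality using (euclidsLemma; prime⇒irreducible; prime⇒nonTrivial)
import Data.Nat.Properties as ℕ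
open import Data.Product.Base using (_×_; _,_; ∃; ∃-syntax; proj₁; proj₂)
open import Data.Rational.Base as ℚ using (ℚ; mkℚ; 0ℚ; 1ℚ; _/_)
import Data.Rational.Properties as ℚ
import Data.Rational.Unnormalised.Base as ℚᵘ
open import Data.Sum.Base as Sum using (_⊎_; inj₁; inj₂; [_,_]′)
open import Data.Unit.Base using (⊤; tt)
open import Data.Vec.Functional using (Vector)
import Function.Endo.Propositional as Endo
open import Function.Base using (_∘_)
open import Level using (0ℓ)
open import Relation.Binary.PropositionalEquality as ≡ using (_≡_; _≢_; module ≡-Reasoning)
open import Relation.Nullary using (contradiction; yes; no; does)
open import Relation.Nullary.Decidable using (dec-true; dec-false)

-- Integral closedness rests on almost integrality: one nonzero integer `D` clears the denominators
-- of all powers of `y`. A monic equation yields such a `D`, sums and products only multiply the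
-- constants, and a rational number with this property is an integer. Monic equations themselves
-- would call for elimination at every sum and product.
--
-- Since 1 + ζ + ... + ζᵖ⁻¹ = 0, the p coordinates of an element are determined only up to a common
-- constant, so integrality can be claimed only for their differences; subtracting f(0) times this
-- relation then makes every coordinate an integer.
--
-- Invertibility is explicit: 1 - ζ has a written inverse, its conjugates follow by applying σ,
-- hence so does z, and then x is seen to divide the nonzero integer Tr(1) = (p - 1)/n.
--
-- Both inclusions use one membership statement about Tr(z b), proved for any σ-stable submodule
-- that contains x: with integral b for the span of the conjugates, and with rational b for the
-- multiples of x.

-- Integers among the rationals, and denominators.

module IntegersInℚ where

  open ≡ using (refl; sym; trans; cong; cong₂; subst)
  open import Data.Fin.Base using (zero; suc)
  open CommutativeRing ℚ.+-*-commutativeRing using (commutativeSemiring)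
  open CommutativeSemiringExp commutativeSemiring public using () renaming (_^_ to _^ℚ_)
  open CommutativeSemiringExp commutativeSemiring using (^-distrib-*)

  private
    -- Unlike i / 1, this form lets the arithmetic of ℚ compute.

    int : ℤ → ℚ
    int i = mkℚ i 0 (Coprime.sym (Coprime.1-coprimeTo _))

    /1≡int : ∀ i → i / 1 ≡ int i
    /1≡int i = ℚ.↥p/↧p≡p (int i)

  /1-homo-+ : ∀ i j → (i ℤ.+ j) / 1 ≡ (i / 1) ℚ.+ (j / 1)
  /1-homo-+ i j = sym (trans (cong₂ ℚ._+_ (/1≡int i) (/1≡int j))
    (cong (_/ 1) (cong₂ ℤ._+_ (ℤ.*-identityʳ i) (ℤ.*-identityʳ j))))

  /1-homo-* : ∀ i j → (i ℤ.* j) / 1 ≡ (i / 1) ℚ.* (j / 1)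
  /1-homo-* i j = sym (cong₂ ℚ._*_ (/1≡int i) (/1≡int j))

  /1-homo‿- : ∀ i → (ℤ.- i) / 1 ≡ ℚ.- (i / 1)
  /1-homo‿- i = trans (/1≡int (ℤ.- i)) (trans (neg i) (cong ℚ.-_ (sym (/1≡int i))))
    where
    neg : ∀ i → int (ℤ.- i) ≡ ℚ.- int i
    neg (+ zero)  = refl
    neg (+ suc n) = refl
    neg -[1+ n ]  = refl

  /1-homo-^ : ∀ i k → (i ℤ.^ k) / 1 ≡ (i / 1) ^ℚ k
  /1-homo-^ i zero    = refl
  /1-homo-^ i (suc k) = trans (/1-homo-* i (i ℤ.^ k)) (cong ((i / 1) ℚ.*_) (/1-homo-^ i k))

  /1-injective : ∀ i j → i / 1 ≡ j / 1 → i ≡ j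
  /1-injective i j eq = cong ℚ.↥_ (trans (sym (/1≡int i)) (trans eq (/1≡int j)))

  ↥≡↧* : ∀ a → (ℚ.↥ a) / 1 ≡ ((ℚ.↧ a) / 1) ℚ.* a
  ↥≡↧* a@(mkℚ n d _) = sym (trans (cong (ℚ._* a) (/1≡int (+ suc d)))
    (ℚ.fromℚᵘ-cong {ℚᵘ.mkℚᵘ (+ suc d ℤ.* n) (d ℕ.+ 0)} {ℚᵘ.mkℚᵘ n 0} (ℚᵘ.*≡* (begin
      + suc d ℤ.* n ℤ.* + 1   ≡⟨ ℤ.*-identityʳ _ ⟩
      + suc d ℤ.* n           ≡⟨ ℤ.*-comm (+ suc d) n ⟩
      n ℤ.* + suc d           ≡⟨ cong (λ e → n ℤ.* + suc e) (ℕ.+-identityʳ d) ⟨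
      n ℤ.* + suc (d ℕ.+ 0)   ∎))))
    where open ≡-Reasoning

  IsInteger : ℚ → Set
  IsInteger a = ∃[ i ] a ≡ i / 1

  -- The `j` factors `m` are removed one at a time by `strip`, which peels off one `d` per step:
  -- coprimality gives d ∣ e, and the common factor `d` cancels.
  coprime-^-divisor : ∀ {d m} k j e → Coprime d m → d ℕ.^ k ℕ.∣ e ℕ.* m ℕ.^ j → d ℕ.^ k ℕ.∣ e
  coprime-^-divisor {d} {m} k zero e c dᵏ∣ = subst (d ℕ.^ k ℕ.∣_) (ℕ.*-identityʳ e) dᵏ∣
  coprime-^-divisor {d} {m} k (suc j) e c dᵏ∣ = strip k e
    (coprime-^-divisor k j (e ℕ.* m) c (subst (d ℕ.^ k ℕ.∣_) (sym (ℕ.*-assoc e m (m ℕ.^ j))) dᵏ∣))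
    where
    strip : ∀ k e → d ℕ.^ k ℕ.∣ e ℕ.* m → d ℕ.^ k ℕ.∣ e
    strip zero    e _  = ℕ.1∣ e
    strip (suc k) e dᵏ⁺¹∣em
      with Coprime.coprime-divisor c (subst (d ℕ.∣_) (ℕ.*-comm e m) (ℕ.m*n∣⇒m∣ d (d ℕ.^ k) dᵏ⁺¹∣em))
    -- Cancelling `d` needs d ≠ 0; if d = 0, then `e` is f · 0 and both sides of the goal vanish.
    ... | ℕ.divides f refl with d ℕ.≟ 0
    ...   | yes refl = subst (0 ℕ.∣_) (sym (ℕ.*-zeroʳ f)) (ℕ.divides 0 refl)
    ...   | no d≢0   = subst (d ℕ.^ suc k ℕ.∣_) (ℕ.*-comm d f) (ℕ.*-monoʳ-∣ d
      (strip k f (ℕ.*-cancelˡ-∣ d {{ℕ.≢-nonZero d≢0}}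
        (subst (d ℕ.^ suc k ℕ.∣_) (trans (cong (ℕ._* m) (ℕ.*-comm f d)) (ℕ.*-assoc d f m)) dᵏ⁺¹∣em))))

  n<2^n : ∀ n → n ℕ.< 2 ℕ.^ n
  n<2^n zero    = s≤s z≤n
  n<2^n (suc n) = ℕ.≤-trans (s≤s (n<2^n n)) (ℕ.≤-trans (ℕ.+-monoˡ-≤ (2 ℕ.^ n) (ℕ.m^n>0 2 n))
    (ℕ.≤-reflexive (cong (2 ℕ.^ n ℕ.+_) (sym (ℕ.+-identityʳ _)))))

  -- For a = n/d in lowest terms, integrality of D aᵏ says dᵏ ∣ D nᵏ, hence dᵏ ∣ D for every k. A
  -- nonzero `D` is divisible by arbitrarily high powers of `d` only if d = 1.
  almostInteger⇒isInteger : ∀ a D → .{{ℤ.NonZero D}} →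
    (∀ k → IsInteger ((D / 1) ℚ.* (a ^ℚ k))) → IsInteger a
  almostInteger⇒isInteger a@(mkℚ n d-1 c) D bounded = go d-1 refl
    where
    open ≡-Reasoning
    d = suc d-1

    dᵏ∣D : ∀ k → d ℕ.^ k ℕ.∣ ∣ D ∣
    dᵏ∣D k = coprime-^-divisor k k ∣ D ∣ (Coprime.sym (Coprime.recompute c))
      (ℕ.divides ∣ j ∣ (begin
        ∣ D ∣ ℕ.* ∣ n ∣ ℕ.^ k       ≡⟨ cong (∣ D ∣ ℕ.*_) (abs-^ n k) ⟨
        ∣ D ∣ ℕ.* ∣ n ℤ.^ k ∣       ≡⟨ ℤ.abs-* D (n ℤ.^ k) ⟨
        ∣ D ℤ.* n ℤ.^ k ∣           ≡⟨ cong ∣_∣ (/1-injective (D ℤ.* n ℤ.^ k) (j ℤ.* (+ d) ℤ.^ k) Dnᵏ≡jdᵏ) ⟩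
        ∣ j ℤ.* (+ d) ℤ.^ k ∣       ≡⟨ ℤ.abs-* j ((+ d) ℤ.^ k) ⟩
        ∣ j ∣ ℕ.* ∣ (+ d) ℤ.^ k ∣   ≡⟨ cong (∣ j ∣ ℕ.*_) (abs-^ (+ d) k) ⟩
        ∣ j ∣ ℕ.* d ℕ.^ k           ∎))
      where
      j = proj₁ (bounded k)

      abs-^ : ∀ i k → ∣ i ℤ.^ k ∣ ≡ ∣ i ∣ ℕ.^ k
      abs-^ i zero    = refl
      abs-^ i (suc k) = trans (ℤ.abs-* i (i ℤ.^ k)) (cong (∣ i ∣ ℕ.*_) (abs-^ i k))

      Dnᵏ≡jdᵏ : (D ℤ.* n ℤ.^ k) / 1 ≡ (j ℤ.* (+ d) ℤ.^ k) / 1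
      Dnᵏ≡jdᵏ = begin
        (D ℤ.* n ℤ.^ k) / 1                              ≡⟨ /1-homo-* D (n ℤ.^ k) ⟩
        (D / 1) ℚ.* ((n ℤ.^ k) / 1)                      ≡⟨ cong ((D / 1) ℚ.*_) (/1-homo-^ n k) ⟩
        (D / 1) ℚ.* ((n / 1) ^ℚ k)                       ≡⟨ cong (λ b → (D / 1) ℚ.* (b ^ℚ k)) (↥≡↧* a) ⟩
        (D / 1) ℚ.* ((((+ d) / 1) ℚ.* a) ^ℚ k)           ≡⟨ cong ((D / 1) ℚ.*_) (^-distrib-* ((+ d) / 1) a k) ⟩
        (D / 1) ℚ.* ((((+ d) / 1) ^ℚ k) ℚ.* (a ^ℚ k))    ≡⟨ cong ((D / 1) ℚ.*_) (ℚ.*-comm (((+ d) / 1) ^ℚ k) (a ^ℚ k)) ⟩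
        (D / 1) ℚ.* ((a ^ℚ k) ℚ.* (((+ d) / 1) ^ℚ k))    ≡⟨ ℚ.*-assoc (D / 1) _ _ ⟨
        (D / 1) ℚ.* (a ^ℚ k) ℚ.* (((+ d) / 1) ^ℚ k)      ≡⟨ cong₂ ℚ._*_ (proj₂ (bounded k)) (sym (/1-homo-^ (+ d) k)) ⟩
        (j / 1) ℚ.* (((+ d) ℤ.^ k) / 1)                  ≡⟨ /1-homo-* j _ ⟨
        (j ℤ.* (+ d) ℤ.^ k) / 1                          ∎

    go : ∀ e → e ≡ d-1 → IsInteger a
    go zero    refl = n , sym (ℚ.↥p/↧p≡p a)
    go (suc e) refl = contradiction
      -- The exponent k = |D| is already too large: dᵏ ≥ 2ᵏ > k = |D|.
      (ℕ.∣⇒≤ (dᵏ∣D ∣ D ∣))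
      (ℕ.<⇒≱ (ℕ.<-≤-trans (n<2^n ∣ D ∣) (ℕ.^-monoˡ-≤ ∣ D ∣ (s≤s (s≤s z≤n)))))

  ≢0-* : ∀ {c d} → c ≢ 0ℤ → d ≢ 0ℤ → c ℤ.* d ≢ 0ℤ
  ≢0-* {c} c≢0 d≢0 cd≡0 = [ c≢0 , d≢0 ]′ (ℤ.i*j≡0⇒i≡0∨j≡0 c cd≡0)

  commonDenominator : ∀ {n} (f : Fin n → ℚ) → ∃ λ D → D ≢ 0ℤ × (∀ i → IsInteger ((D / 1) ℚ.* f i))
  commonDenominator {zero}  f = 1ℤ , (λ ()) , λ ()
  commonDenominator {suc n} f with commonDenominator (f ∘ suc)
  ... | D , D≢0 , D∈ = d ℤ.* D , ≢0-* {d} (λ ()) D≢0 , λ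
      { zero    → D ℤ.* ℚ.↥ a , (begin
          ((d ℤ.* D) / 1) ℚ.* a            ≡⟨ cong (λ e → (e / 1) ℚ.* a) (ℤ.*-comm d D) ⟩
          ((D ℤ.* d) / 1) ℚ.* a            ≡⟨ cong (ℚ._* a) (/1-homo-* D d) ⟩
          (D / 1) ℚ.* (d / 1) ℚ.* a        ≡⟨ ℚ.*-assoc (D / 1) (d / 1) a ⟩
          (D / 1) ℚ.* ((d / 1) ℚ.* a)      ≡⟨ cong ((D / 1) ℚ.*_) (↥≡↧* a) ⟨
          (D / 1) ℚ.* (ℚ.↥ a / 1)          ≡⟨ /1-homo-* D (ℚ.↥ a) ⟨
          (D ℤ.* ℚ.↥ a) / 1                ∎)
      ; (suc i) → d ℤ.* proj₁ (D∈ i) , (begin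
          ((d ℤ.* D) / 1) ℚ.* f (suc i)          ≡⟨ cong (ℚ._* f (suc i)) (/1-homo-* d D) ⟩
          (d / 1) ℚ.* (D / 1) ℚ.* f (suc i)      ≡⟨ ℚ.*-assoc (d / 1) (D / 1) (f (suc i)) ⟩
          (d / 1) ℚ.* ((D / 1) ℚ.* f (suc i))    ≡⟨ cong ((d / 1) ℚ.*_) (proj₂ (D∈ i)) ⟩
          (d / 1) ℚ.* (proj₁ (D∈ i) / 1)             ≡⟨ /1-homo-* d (proj₁ (D∈ i)) ⟨
          (d ℤ.* proj₁ (D∈ i)) / 1                   ∎) }
    where
    open ≡-Reasoning
    a = f zero
    d = ℚ.↧ a

open IntegersInℚ

-- Congruences and residues modulo m.

module Congruence (m : ℕ) where

  open ≡ using (refl; sym; trans; cong; subst)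

  mod-refl : ∀ a → a ≡ a [mod m ]
  mod-refl a = subst (λ c → m ℕ.∣ ∣ c ∣) (sym (ℤ.+-inverseʳ a)) (m ℕ.∣0)

  mod-sym : ∀ a b → a ≡ b [mod m ] → b ≡ a [mod m ]
  mod-sym a b = subst (m ℕ.∣_) (ℤ.∣i-j∣≡∣j-i∣ a b)

  mod-trans : ∀ a b c → a ≡ b [mod m ] → b ≡ c [mod m ] → a ≡ c [mod m ]
  mod-trans a b c a≡b b≡c = subst (+ m ∣ℤ_) (telescope a b c)
    (∣⇒∣ᵤ (ℤ∣.∣m∣n⇒∣m+n (∣ᵤ⇒∣ {+ m} {a ℤ.- b} a≡b) (∣ᵤ⇒∣ {+ m} {b ℤ.- c} b≡c)))
    where
    telescope : ∀ a b c → (a ℤ.- b) ℤ.+ (b ℤ.- c) ≡ a ℤ.- c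
    telescope = ℤ-solve-∀

  mod-* : ∀ a b c d → a ≡ b [mod m ] → c ≡ d [mod m ] → a ℤ.* c ≡ b ℤ.* d [mod m ]
  mod-* a b c d a≡b c≡d = subst (+ m ∣ℤ_) (split a b c d)
    (∣⇒∣ᵤ (ℤ∣.∣m∣n⇒∣m+n (ℤ∣.∣n⇒∣m*n c (∣ᵤ⇒∣ {+ m} {a ℤ.- b} a≡b))
                        (ℤ∣.∣n⇒∣m*n b (∣ᵤ⇒∣ {+ m} {c ℤ.- d} c≡d))))
    where
    split : ∀ a b c d → c ℤ.* (a ℤ.- b) ℤ.+ b ℤ.* (c ℤ.- d) ≡ a ℤ.* c ℤ.- b ℤ.* d
    split = ℤ-solve-∀

  mod-^ : ∀ a b k → a ≡ b [mod m ] → a ℤ.^ k ≡ b ℤ.^ k [mod m ]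
  mod-^ a b zero    a≡b = mod-refl 1ℤ
  mod-^ a b (suc k) a≡b = mod-* a b (a ℤ.^ k) (b ℤ.^ k) a≡b (mod-^ a b k a≡b)

  mod-∣ : ∀ a b → a ≡ b [mod m ] → + m ∣ℤ b → + m ∣ℤ a
  mod-∣ a b a≡b m∣b = subst (+ m ∣ℤ_) (recombine a b)
    (∣⇒∣ᵤ (ℤ∣.∣m∣n⇒∣m+n (∣ᵤ⇒∣ {+ m} {a ℤ.- b} a≡b) (∣ᵤ⇒∣ {+ m} {b} m∣b)))
    where
    recombine : ∀ a b → (a ℤ.- b) ℤ.+ b ≡ a
    recombine = ℤ-solve-∀

  residue : .{{_ : ℕ.NonZero m}} → ∀ a → ∃ λ (i : Fin m) → a ≡ + toℕ i [mod m ]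
  residue a = fromℕ< (ℤ.n%ℕd<d a m) , ℕ.divides ∣ a /ℕ m ∣ (begin
    ∣ a ℤ.- + toℕ (fromℕ< (ℤ.n%ℕd<d a m)) ∣  ≡⟨ cong (λ i → ∣ a ℤ.- + i ∣) (Fin.toℕ-fromℕ< (ℤ.n%ℕd<d a m)) ⟩
    ∣ a ℤ.- + (a %ℕ m) ∣                     ≡⟨ cong (λ b → ∣ b ℤ.- + (a %ℕ m) ∣) (ℤ.a≡a%ℕn+[a/ℕn]*n a m) ⟩
    ∣ (+ (a %ℕ m) ℤ.+ (a /ℕ m) ℤ.* + m) ℤ.- + (a %ℕ m) ∣
                                             ≡⟨ cong ∣_∣ (cancel (+ (a %ℕ m)) ((a /ℕ m) ℤ.* + m)) ⟩
    ∣ (a /ℕ m) ℤ.* + m ∣                     ≡⟨ ℤ.abs-* (a /ℕ m) (+ m) ⟩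
    ∣ a /ℕ m ∣ ℕ.* m                         ∎)
    where
    open ≡-Reasoning

    cancel : ∀ a b → (a ℤ.+ b) ℤ.- a ≡ b
    cancel = ℤ-solve-∀

  residue-unique : ∀ {i j} → i ℕ.< m → j ℕ.< m → + i ≡ + j [mod m ] → i ≡ j
  residue-unique {i} {j} i<m j<m i≡j = ℤ.+-injective (ℤ.i-j≡0⇒i≡j (+ i) (+ j)
    (ℤ.∣i∣≡0⇒i≡0 (small i≡j (subst (λ k → ∣ k ∣ ℕ.< m) (sym (ℤ.m-n≡m⊖n i j))
      (ℕ.≤-<-trans (ℤ.∣m⊝n∣≤m⊔n i j) (ℕ.⊔-lub i<m j<m))))))
    where
    small : ∀ {k} → m ℕ.∣ k → k ℕ.< m → k ≡ 0
    small {zero}  _   _   = refl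
    small {suc k} m∣k k<m = contradiction (ℕ.∣⇒≤ m∣k) (ℕ.<⇒≱ k<m)

-- Units modulo a prime, and the order of a primitive root.

module PrimeCongruence (q : ℕ) (prime : Prime (suc q)) where

  open ≡ using (refl; sym; trans; cong; subst; subst₂)

  p = suc q

  open Congruence p public

  euclid : ∀ a b → + p ∣ℤ a ℤ.* b → + p ∣ℤ a ⊎ + p ∣ℤ b
  euclid a b p∣ab = euclidsLemma ∣ a ∣ ∣ b ∣ prime (subst (p ℕ.∣_) (ℤ.abs-* a b) p∣ab)

  p∤1 : ¬ (p ℕ.∣ 1)
  p∤1 p∣1 = contradiction (ℕ.∣1⇒≡1 p∣1) (ℕ.nonTrivial⇒≢1 {{prime⇒nonTrivial prime}})

  ∣^⇒∣ : ∀ a k → + p ∣ℤ a ℤ.^ k → + p ∣ℤ a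
  ∣^⇒∣ a zero    p∣1 = contradiction p∣1 p∤1
  ∣^⇒∣ a (suc k) p∣aᵏ⁺¹ = [ (λ p∣a → p∣a) , ∣^⇒∣ a k ]′ (euclid a (a ℤ.^ k) p∣aᵏ⁺¹)

  mod-cancelˡ : ∀ c a b → ¬ (+ p ∣ℤ c) → c ℤ.* a ≡ c ℤ.* b [mod p ] → a ≡ b [mod p ]
  mod-cancelˡ c a b p∤c ca≡cb =
    [ (λ p∣c → contradiction p∣c p∤c) , (λ p∣a-b → p∣a-b) ]′
    (euclid c (a ℤ.- b) (subst (+ p ∣ℤ_) (factor c a b) ca≡cb))
    where
    factor : ∀ c a b → c ℤ.* a ℤ.- c ℤ.* b ≡ c ℤ.* (a ℤ.- b)
    factor = ℤ-solve-∀

  +suc≢0 : ∀ (m : Fin q) → ¬ (+ p ∣ℤ + suc (toℕ m))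
  +suc≢0 m p∣1+m = ℕ.<⇒≱ (s≤s (Fin.toℕ<n m)) (ℕ.∣⇒≤ p∣1+m)

  unitResidue : ∀ a → ¬ (+ p ∣ℤ a) → ∃ λ (i : Fin q) → a ≡ + suc (toℕ i) [mod p ]
  unitResidue a p∤a with residue a
  ... | Fin.zero  , a≡0 = contradiction (subst (+ p ∣ℤ_) (ℤ.+-identityʳ a) a≡0) p∤a
  ... | Fin.suc i , a≡i = i , a≡i

  module PrimitiveRoot (r : ℤ) (root : IsPrimitiveRoot p r) where

    p∤r^ : ∀ k → ¬ (+ p ∣ℤ r ℤ.^ k)
    p∤r^ k = proj₁ root ∘ ∣^⇒∣ r k

    -- The powers of r with exponent at most d already represent all q units.

    order-≥ : ∀ d → r ℤ.^ suc d ≡ 1ℤ [mod p ] → q ℕ.≤ suc d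
    order-≥ d rᵈ⁺¹≡1 = Fin.injective⇒≤ index-injective
      where
      log : Fin q → ℕ
      log m = proj₁ (proj₂ root (+ suc (toℕ m)) (+suc≢0 m))

      index : Fin q → Fin (suc d)
      index m = fromℕ< (ℕ.m%n<n (log m) (suc d))

      reduce : ∀ k → r ℤ.^ k ≡ r ℤ.^ (k ℕ.% suc d) [mod p ]
      reduce k = subst₂ (_≡_[mod p ])
        (sym (trans (cong (r ℤ.^_) (ℕ.m≡m%n+[m/n]*n k (suc d)))
          (trans (ℤ.^-distribˡ-+-* r (k ℕ.% suc d) (k ℕ./ suc d ℕ.* suc d))
            (cong (r ℤ.^ (k ℕ.% suc d) ℤ.*_)
              (trans (cong (r ℤ.^_) (ℕ.*-comm (k ℕ./ suc d) (suc d)))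
                (sym (ℤ.^-*-assoc r (suc d) (k ℕ./ suc d))))))))
        (ℤ.*-identityʳ _)
        (mod-* rᵏ rᵏ ((r ℤ.^ suc d) ℤ.^ (k ℕ./ suc d)) 1ℤ (mod-refl rᵏ)
          (subst ((r ℤ.^ suc d) ℤ.^ (k ℕ./ suc d) ≡_[mod p ]) (ℤ.^-zeroˡ (k ℕ./ suc d))
            (mod-^ (r ℤ.^ suc d) 1ℤ (k ℕ./ suc d) rᵈ⁺¹≡1)))
        where
        rᵏ = r ℤ.^ (k ℕ.% suc d)

      represents : ∀ m → + suc (toℕ m) ≡ r ℤ.^ toℕ (index m) [mod p ]
      represents m = subst (λ k → + suc (toℕ m) ≡ r ℤ.^ k [mod p ])
        (sym (Fin.toℕ-fromℕ< (ℕ.m%n<n (log m) (suc d))))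
        (mod-trans (+ suc (toℕ m)) (r ℤ.^ log m) _
          (proj₂ (proj₂ root (+ suc (toℕ m)) (+suc≢0 m))) (reduce (log m)))

      index-injective : ∀ {m m′} → index m ≡ index m′ → m ≡ m′
      index-injective {m} {m′} eq = Fin.toℕ-injective (ℕ.suc-injective
        (residue-unique (s≤s (Fin.toℕ<n m)) (s≤s (Fin.toℕ<n m′))
          (mod-trans (+ suc (toℕ m)) (r ℤ.^ toℕ (index m)) (+ suc (toℕ m′)) (represents m)
            (mod-sym (+ suc (toℕ m′)) (r ℤ.^ toℕ (index m))
              (subst (λ i → + suc (toℕ m′) ≡ r ℤ.^ toℕ i [mod p ]) (sym eq) (represents m′))))))

    -- Among the q + 1 powers r⁰, ..., r^q two share one of the q unit residues. Cancelling the
    -- smaller power gives rᵉ ≡ 1 with 1 ≤ e ≤ q, and `order-≥` forces e = q. In the code e is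
    -- `suc d`.
    r^q≡1 : r ℤ.^ q ≡ 1ℤ [mod p ]
    r^q≡1 with Fin.pigeonhole (ℕ.n<1+n q) (λ (k : Fin p) → proj₁ (unitResidue (r ℤ.^ toℕ k) (p∤r^ (toℕ k))))
    ... | i , j , i<j , eq = subst (λ k → r ℤ.^ k ≡ 1ℤ [mod p ]) e≡q rᵉ≡1
      where
      d = toℕ j ℕ.∸ suc (toℕ i)

      j≡ : toℕ j ≡ toℕ i ℕ.+ suc d
      j≡ = sym (trans (ℕ.+-suc (toℕ i) d) (ℕ.m+[n∸m]≡n i<j))

      residueOf : ∀ (k : Fin p) → r ℤ.^ toℕ k ≡ + suc (toℕ (proj₁ (unitResidue (r ℤ.^ toℕ k) (p∤r^ (toℕ k))))) [mod p ]
      residueOf k = proj₂ (unitResidue (r ℤ.^ toℕ k) (p∤r^ (toℕ k)))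

      rⁱrᵉ≡rⁱ : r ℤ.^ toℕ i ℤ.* r ℤ.^ suc d ≡ r ℤ.^ toℕ i ℤ.* 1ℤ [mod p ]
      rⁱrᵉ≡rⁱ = subst₂ (_≡_[mod p ])
        (trans (cong (r ℤ.^_) j≡) (ℤ.^-distribˡ-+-* r (toℕ i) (suc d)))
        (sym (ℤ.*-identityʳ _))
        (mod-trans (r ℤ.^ toℕ j) _ (r ℤ.^ toℕ i) (residueOf j)
          (mod-sym (r ℤ.^ toℕ i) _ (subst (λ m → r ℤ.^ toℕ i ≡ + suc (toℕ m) [mod p ]) eq (residueOf i))))

      rᵉ≡1 : r ℤ.^ suc d ≡ 1ℤ [mod p ]
      rᵉ≡1 = mod-cancelˡ (r ℤ.^ toℕ i) (r ℤ.^ suc d) 1ℤ (p∤r^ (toℕ i)) rⁱrᵉ≡rⁱ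

      e≡q : suc d ≡ q
      e≡q = ℕ.≤-antisym
        (ℕ.≤-trans (ℕ.m≤n+m (suc d) (toℕ i)) (ℕ.≤-trans (ℕ.≤-reflexive (sym j≡)) (ℕ.≤-pred (Fin.toℕ<n j))))
        (order-≥ d rᵉ≡1)

    -- The square of s = rʰ⁺¹ is r^q ≡ 1, so p divides (s - 1)(s + 1). The case s ≡ 1 contradicts
    -- `order-≥`, because h + 1 < q.
    r^h≡-1 : ∀ h → q ≡ suc h ℕ.* 2 → r ℤ.^ suc h ≡ ℤ.- 1ℤ [mod p ]
    r^h≡-1 h q≡2h = [ (λ p∣ → contradiction (order-≥ h p∣) (ℕ.<⇒≱ h<q)) , (λ p∣ → p∣) ]′
      (euclid (r ℤ.^ suc h ℤ.- 1ℤ) (r ℤ.^ suc h ℤ.- ℤ.- 1ℤ)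
        (subst (+ p ∣ℤ_) (trans (cong (ℤ._- 1ℤ) square) (factor (r ℤ.^ suc h))) r^q≡1))
      where
      factor : ∀ s → s ℤ.* s ℤ.- 1ℤ ≡ (s ℤ.- 1ℤ) ℤ.* (s ℤ.- ℤ.- 1ℤ)
      factor = ℤ-solve-∀

      square : r ℤ.^ q ≡ r ℤ.^ suc h ℤ.* r ℤ.^ suc h
      square = trans (cong (r ℤ.^_) (trans q≡2h (trans (ℕ.*-comm (suc h) 2)
        (cong (suc h ℕ.+_) (ℕ.+-identityʳ (suc h)))))) (ℤ.^-distribˡ-+-* r (suc h) (suc h))

      h<q : suc h ℕ.< q
      h<q = subst (suc h ℕ.<_) (sym q≡2h) (ℕ.m<m*n (suc h) 2 (s≤s (s≤s z≤n)))

-- Finite sums in a commutative monoid, used for both sums and products.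

module IndexedSum (M : CommutativeMonoid 0ℓ 0ℓ) where

  open CommutativeMonoid M
  open CommutativeMonoidSum M

  sum-snoc : ∀ n (f : ℕ → Carrier) → sum {suc n} (f ∘ toℕ) ≈ sum {n} (f ∘ toℕ) ∙ f n
  sum-snoc zero    f = comm (f 0) ε
  sum-snoc (suc n) f = trans (∙-congˡ (sum-snoc n (f ∘ suc))) (sym (assoc _ _ _))

  -- Applied to f(k) = σᵏ(y) this is the invariance of traces and norms under σ: the term that
  -- leaves at one end returns at the other.
  sum-cycle : ∀ n (f : ℕ → Carrier) → f n ≈ f 0 → sum {n} (f ∘ suc ∘ toℕ) ≈ sum {n} (f ∘ toℕ)
  sum-cycle zero    f _     = refl
  sum-cycle (suc n) f fn≈f0 = trans (sum-snoc n (f ∘ suc)) (trans (∙-congˡ fn≈f0) (comm _ _))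

  sum-closed : (P : Carrier → Set) → P ε → (∀ {x y} → P x → P y → P (x ∙ y)) →
               ∀ {n} (f : Vector Carrier n) → (∀ i → P (f i)) → P (sum f)
  sum-closed P P-ε P-∙ {zero}  f Pf = P-ε
  sum-closed P P-ε P-∙ {suc n} f Pf = P-∙ (Pf Fin.zero) (sum-closed P P-ε P-∙ (f ∘ Fin.suc) (Pf ∘ Fin.suc))

  sum-ε : ∀ {n} (f : Vector Carrier n) → (∀ i → f i ≈ ε) → sum f ≈ ε
  sum-ε {n} f f≈ε = trans (sum-cong-≋ f≈ε) (sum-replicate-zero n)

  sum-single : ∀ {n} (j : Fin n) (f : Vector Carrier n) → (∀ i → i ≢ j → f i ≈ ε) → sum f ≈ f j
  sum-single Fin.zero    f f≈ε =
    trans (∙-congˡ (sum-ε (f ∘ Fin.suc) (λ i → f≈ε (Fin.suc i) λ ()))) (identityʳ _)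
  sum-single (Fin.suc j) f f≈ε =
    trans (∙-cong (f≈ε Fin.zero λ ())
                  (sum-single j (f ∘ Fin.suc) (λ i i≢j → f≈ε (Fin.suc i) (i≢j ∘ Fin.suc-injective))))
          (identityˡ _)

module SumHomomorphism (M N : Monoid 0ℓ 0ℓ)
  (φ : Monoid.Carrier M → Monoid.Carrier N)
  (hom : MonoidMorphisms.IsMonoidHomomorphism (Monoid.rawMonoid M) (Monoid.rawMonoid N) φ) where

  private
    module N = Monoid N
    open MonoidMorphisms.IsMonoidHomomorphism hom

  homo-sum : ∀ {n} (f : Vector (Monoid.Carrier M) n) →
    φ (RawMonoidDefs.sum (Monoid.rawMonoid M) f) N.≈ RawMonoidDefs.sum N.rawMonoid (φ ∘ f)
  homo-sum {zero}  f = ε-homo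
  homo-sum {suc n} f = N.trans (homo _ _) (N.∙-congˡ (homo-sum (f ∘ Fin.suc)))

-- An interface to ℚ(ζ) that keeps its elements from unfolding to coordinate vectors.

record CyclotomicField (p : ℕ) : Set₁ where
  infix 9 ζ^_
  field
    commutativeRing : CommutativeRing 0ℓ 0ℓ

  open CommutativeRing commutativeRing public
  open SemiringSum semiring public
  open CommutativeSemiringExp commutativeSemiring public
  open CommutativeMonoidSum *-commutativeMonoid public using () renaming
    (sum to product; sum-cong-≋ to product-cong; ∑-distrib-+ to product-distrib-*; sum-replicate to product-replicate)

  field
    ι      : ℚ → Carrier
    ι-homo : RingMorphisms.IsRingHomomorphism ℚ.+-*-rawRing rawRing ι
    ι-injective : ∀ {a b} → ι a ≈ ι b → a ≡ b

    ζ^_     : ℤ → Carrier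
    ζ^-cong : ∀ {a b} → a ≡ b [mod p ] → ζ^ a ≈ ζ^ b
    ζ^-+    : ∀ a b → ζ^ (a ℤ.+ b) ≈ ζ^ a * ζ^ b
    ζ^0     : ζ^ 0ℤ ≈ 1#
    ∑ζ      : sum {p} (λ i → ζ^ (+ toℕ i)) ≈ 0#

  combination : Vector ℚ p → Carrier
  combination f = sum λ i → ι (f i) * ζ^ (+ toℕ i)

  field
    coordinates : ∀ y → ∃ λ f → y ≈ combination f
    ι-integral  : ∀ a (g : Vector ℤ p) → ι a ≈ combination (λ i → g i / 1) → IsInteger a

-- The ring ℤ[ζ] inside ℚ(ζ).

module Arithmetic {p : ℕ} .{{_ : ℕ.NonZero p}} (F : CyclotomicField p) where

  open CyclotomicField F public
  open RingProperties ring public using (-0#≈0#; -1*x≈-x; -‿distribˡ-*; -‿involutive)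
  open Congruence p
  module ι = RingMorphisms.IsRingHomomorphism ι-homo
  open import Relation.Binary.Reasoning.Setoid setoid public
  module +Sum = IndexedSum +-commutativeMonoid
  module *Sum = IndexedSum *-commutativeMonoid

  ιℤ : ℤ → Carrier
  ιℤ i = ι (i / 1)

  ιℤ-+ : ∀ i j → ιℤ (i ℤ.+ j) ≈ ιℤ i + ιℤ j
  ιℤ-+ i j = trans (ι.⟦⟧-cong (/1-homo-+ i j)) (ι.+-homo _ _)

  ιℤ-* : ∀ i j → ιℤ (i ℤ.* j) ≈ ιℤ i * ιℤ j
  ιℤ-* i j = trans (ι.⟦⟧-cong (/1-homo-* i j)) (ι.*-homo _ _)

  ιℤ-neg : ∀ i → ιℤ (ℤ.- i) ≈ - ιℤ i
  ιℤ-neg i = trans (ι.⟦⟧-cong (/1-homo‿- i)) (ι.-‿homo _)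

  ιℤ-1* : ∀ y → ιℤ (ℤ.- 1ℤ) * y ≈ - y
  ιℤ-1* y = trans (*-congʳ (trans (ιℤ-neg 1ℤ) (-‿cong ι.1#-homo))) (-1*x≈-x y)

  ιℤ-injective : ∀ i j → ιℤ i ≈ ιℤ j → i ≡ j
  ιℤ-injective i j eq = /1-injective i j (ι-injective eq)

  private
    -- Differs from ιℤ only in sending the constants 0 and 1 of the solver to 0# and 1#
    -- on the nose.

    coefficient : ℤ → Carrier
    coefficient (+ 0) = 0#
    coefficient (+ 1) = 1#
    coefficient i     = ιℤ i

    coefficient≈ιℤ : ∀ i → coefficient i ≈ ιℤ i
    coefficient≈ιℤ (+ 0)           = sym ι.0#-homo
    coefficient≈ιℤ (+ 1)           = sym ι.1#-homo
    coefficient≈ιℤ (+ suc (suc n)) = refl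
    coefficient≈ιℤ -[1+ n ]        = refl

    coefficient-homo : ℤ.+-*-rawRing -Raw-AlmostCommutative⟶ fromCommutativeRing commutativeRing
    coefficient-homo = record
      { ⟦_⟧    = coefficient
      ; +-homo = λ i j → trans (coefficient≈ιℤ (i ℤ.+ j)) (trans (ιℤ-+ i j)
          (sym (+-cong (coefficient≈ιℤ i) (coefficient≈ιℤ j))))
      ; *-homo = λ i j → trans (coefficient≈ιℤ (i ℤ.* j)) (trans (ιℤ-* i j)
          (sym (*-cong (coefficient≈ιℤ i) (coefficient≈ιℤ j))))
      ; -‿homo = λ i → trans (coefficient≈ιℤ (ℤ.- i)) (trans (ιℤ-neg i) (sym (-‿cong (coefficient≈ιℤ i))))
      ; 0-homo = refl
      ; 1-homo = refl
      }

    coefficient-≟ : ∀ i j → Maybe (coefficient i ≈ coefficient j)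
    coefficient-≟ i j with i ℤ.≟ j
    ... | yes i≡j = just (reflexive (≡.cong coefficient i≡j))
    ... | no  _   = nothing

  module Solver = RingSolver ℤ.+-*-rawRing (fromCommutativeRing commutativeRing) coefficient-homo coefficient-≟

  ζ : Carrier
  ζ = ζ^ 1ℤ

  combination-cong : ∀ {f g : Vector ℚ p} → (∀ i → f i ≡ g i) → combination f ≈ combination g
  combination-cong f≗g = sum-cong-≋ λ i → *-congʳ (ι.⟦⟧-cong (f≗g i))

  combination-+ : ∀ f g → combination (λ i → f i ℚ.+ g i) ≈ combination f + combination g
  combination-+ f g = trans
    (sum-cong-≋ λ i → trans (*-congʳ (ι.+-homo (f i) (g i))) (distribʳ _ _ _))
    (∑-distrib-+ (λ i → ι (f i) * ζ^ (+ toℕ i)) (λ i → ι (g i) * ζ^ (+ toℕ i)))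

  combination-* : ∀ a f → combination (λ i → a ℚ.* f i) ≈ ι a * combination f
  combination-* a f = trans
    (sum-cong-≋ λ i → trans (*-congʳ (ι.*-homo a (f i))) (*-assoc _ _ _))
    (sym (*-distribˡ-sum (ι a) (λ i → ι (f i) * ζ^ (+ toℕ i))))

  δ : ∀ {n} → Fin n → Fin n → ℤ
  δ j i = if does (i Fin.≟ j) then 1ℤ else 0ℤ

  sum-δ : ∀ {n} j (f : Vector Carrier n) → sum (λ i → ιℤ (δ j i) * f i) ≈ f j
  sum-δ j f = trans (+Sum.sum-single j _ off-diagonal) diagonal
    where
    off-diagonal : ∀ i → i ≢ j → ιℤ (δ j i) * f i ≈ 0#
    off-diagonal i i≢j with i Fin.≟ j
    ... | yes i≡j = contradiction i≡j i≢j
    ... | no  _   = trans (*-congʳ ι.0#-homo) (zeroˡ _)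

    diagonal : ιℤ (δ j j) * f j ≈ f j
    diagonal with j Fin.≟ j
    ... | yes _  = trans (*-congʳ ι.1#-homo) (*-identityˡ _)
    ... | no j≢j = contradiction ≡.refl j≢j

  -- Coefficients are attached to all p powers of ζ, although these are linearly dependent: the
  -- vectors are then closed under reduction of exponents modulo p, at the price that `g` is not
  -- unique.
  ℤζ : Carrier → Set
  ℤζ y = ∃ λ (g : Vector ℤ p) → y ≈ combination (λ i → g i / 1)

  ℤζ-resp : ∀ {x y} → x ≈ y → ℤζ x → ℤζ y
  ℤζ-resp x≈y (g , x≈g) = g , trans (sym x≈y) x≈g

  ℤζ-+ : ∀ {x y} → ℤζ x → ℤζ y → ℤζ (x + y)
  ℤζ-+ (g , x≈g) (h , y≈h) = (λ i → g i ℤ.+ h i) , trans (+-cong x≈g y≈h)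
    (sym (trans (combination-cong λ i → /1-homo-+ (g i) (h i)) (combination-+ (λ i → g i / 1) (λ i → h i / 1))))

  ℤζ-ιℤ* : ∀ c {y} → ℤζ y → ℤζ (ιℤ c * y)
  ℤζ-ιℤ* c (g , y≈g) = (λ i → c ℤ.* g i) , trans (*-congˡ y≈g)
    (sym (trans (combination-cong λ i → /1-homo-* c (g i)) (combination-* (c / 1) (λ i → g i / 1))))

  ℤζ-ζ^ : ∀ m → ℤζ (ζ^ m)
  ℤζ-ζ^ m = let i , m≡i = residue m in
    δ i , trans (ζ^-cong m≡i) (sym (sum-δ i (λ j → ζ^ (+ toℕ j))))

  ℤζ-1 : ℤζ 1#
  ℤζ-1 = ℤζ-resp ζ^0 (ℤζ-ζ^ 0ℤ)

  ℤζ-ιℤ : ∀ c → ℤζ (ιℤ c)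
  ℤζ-ιℤ c = ℤζ-resp (*-identityʳ _) (ℤζ-ιℤ* c ℤζ-1)

  ℤζ-0 : ℤζ 0#
  ℤζ-0 = ℤζ-resp ι.0#-homo (ℤζ-ιℤ 0ℤ)

  ℤζ-neg : ∀ {y} → ℤζ y → ℤζ (- y)
  ℤζ-neg {y} y∈ = ℤζ-resp (ιℤ-1* y) (ℤζ-ιℤ* (ℤ.- 1ℤ) y∈)

  ℤζ-sum : ∀ {n} (f : Vector Carrier n) → (∀ i → ℤζ (f i)) → ℤζ (sum f)
  ℤζ-sum = +Sum.sum-closed ℤζ ℤζ-0 ℤζ-+

  ℤζ-* : ∀ {x y} → ℤζ x → ℤζ y → ℤζ (x * y)
  ℤζ-* {x} {y} (g , x≈g) (h , y≈h) = ℤζ-resp (sym expand) (ℤζ-sum _ λ i → ℤζ-sum _ λ j →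
      ℤζ-ιℤ* (g i) (ℤζ-ιℤ* (h j) (ℤζ-ζ^ (+ toℕ i ℤ.+ + toℕ j))))
    where
    expand : x * y ≈ sum λ i → sum λ j → ιℤ (g i) * (ιℤ (h j) * ζ^ (+ toℕ i ℤ.+ + toℕ j))
    expand = begin
      x * y ≈⟨ *-cong x≈g y≈h ⟩
      combination (λ i → g i / 1) * combination (λ j → h j / 1)
        ≈⟨ *-distribʳ-sum _ (λ i → ιℤ (g i) * ζ^ (+ toℕ i)) ⟩
      sum (λ i → ιℤ (g i) * ζ^ (+ toℕ i) * combination (λ j → h j / 1))
        ≈⟨ sum-cong-≋ (λ i → trans (*-distribˡ-sum _ (λ j → ιℤ (h j) * ζ^ (+ toℕ j)))
             (sum-cong-≋ {p} λ j → trans (rearrange (ιℤ (g i)) (ζ^ (+ toℕ i)) (ιℤ (h j)) (ζ^ (+ toℕ j)))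
               (*-congˡ (*-congˡ (sym (ζ^-+ (+ toℕ i) (+ toℕ j))))))) ⟩
      (sum λ i → sum λ j → ιℤ (g i) * (ιℤ (h j) * ζ^ (+ toℕ i ℤ.+ + toℕ j))) ∎
      where
      open Solver
      rearrange : ∀ a b c d → a * b * (c * d) ≈ a * (c * (b * d))
      rearrange = solve 4 (λ a b c d → a :* b :* (c :* d) := a :* (c :* (b :* d))) refl

  ℤζ-^ : ∀ {y} k → ℤζ y → ℤζ (y ^ k)
  ℤζ-^ zero    y∈ = ℤζ-1
  ℤζ-^ (suc k) y∈ = ℤζ-* y∈ (ℤζ-^ k y∈)

  ℤζ-product : ∀ {n} (f : Vector Carrier n) → (∀ i → ℤζ (f i)) → ℤζ (product f)
  ℤζ-product = *Sum.sum-closed ℤζ ℤζ-1 ℤζ-*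

  ℤζ-ι⇒isInteger : ∀ a → ℤζ (ι a) → IsInteger a
  ℤζ-ι⇒isInteger a (g , a≈g) = ι-integral a g a≈g

-- Coordinate vectors satisfy the interface.

module Model (k : ℕ) where

  p = suc (suc k)

  open Cyclotomic p
  open Congruence p
  open SemiringSum (CommutativeRing.semiring ℚ.+-*-commutativeRing)
    using (sum-cong-≗; *-distribˡ-sum; *-distribʳ-sum; ∑-comm; ∑-distrib-+) renaming (sum to sumℚ)
  module ΣℚProperties = IndexedSum ℚ.+-0-commutativeMonoid

  δₚ : ℤ → ℚ
  δₚ m = if does (p ℕ.∣? ∣ m ∣) then 1ℚ else 0ℚ

  δₚ-1 : ∀ m → + p ∣ℤ m → δₚ m ≡ 1ℚ
  δₚ-1 m p∣m = ≡.cong (if_then 1ℚ else 0ℚ) (dec-true (p ℕ.∣? ∣ m ∣) p∣m)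

  δₚ-0 : ∀ m → ¬ (+ p ∣ℤ m) → δₚ m ≡ 0ℚ
  δₚ-0 m p∤m = ≡.cong (if_then 1ℚ else 0ℚ) (dec-false (p ℕ.∣? ∣ m ∣) p∤m)

  δₚ-cong : ∀ a b → a ≡ b [mod p ] → δₚ a ≡ δₚ b
  δₚ-cong a b a≡b with p ℕ.∣? ∣ b ∣
  ... | yes p∣b = ≡.trans (δₚ-1 a (mod-∣ a b a≡b p∣b)) (≡.sym (δₚ-1 b p∣b))
  ... | no p∤b  = ≡.trans (δₚ-0 a (p∤b ∘ mod-∣ b a (mod-sym a b a≡b))) (≡.sym (δₚ-0 b p∤b))

  sift : ∀ m (i : Fin p) (φ : Fin p → ℚ) → m ≡ + toℕ i [mod p ] →
         sumℚ (λ a → φ a ℚ.* (ζ^ m) a) ≡ φ i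
  sift m i φ m≡i = ≡.trans
    (ΣℚProperties.sum-single i (λ a → φ a ℚ.* (ζ^ m) a) (λ a a≢i → ≡.trans
      (≡.cong (φ a ℚ.*_) (δₚ-0 (+ toℕ a ℤ.- m) λ a≡m → a≢i (Fin.toℕ-injective
        (residue-unique (Fin.toℕ<n a) (Fin.toℕ<n i) (mod-trans (+ toℕ a) m (+ toℕ i) a≡m m≡i)))))
      (ℚ.*-zeroʳ (φ a))))
    (≡.trans (≡.cong (φ i ℚ.*_) (δₚ-1 (+ toℕ i ℤ.- m) (mod-sym m (+ toℕ i) m≡i))) (ℚ.*-identityʳ (φ i)))

  -- The periodic extension of a vector to all integer indices, so that index arithmetic can be done
  -- in ℤ.
  at : ℚ⟨ζ⟩ → ℤ → ℚ
  at f m = f (proj₁ (residue m))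

  at-mod : ∀ f m i → m ≡ + toℕ i [mod p ] → at f m ≡ f i
  at-mod f m i m≡i = ≡.cong f (Fin.toℕ-injective (residue-unique (Fin.toℕ<n j) (Fin.toℕ<n i)
    (mod-trans (+ toℕ j) m (+ toℕ i) (mod-sym m (+ toℕ j) m≡j) m≡i)))
    where
    j = proj₁ (residue m)
    m≡j = proj₂ (residue m)

  at-ζ^ : ∀ b m → at (ζ^ b) m ≡ δₚ (m ℤ.- b)
  at-ζ^ b m = δₚ-cong (+ toℕ j ℤ.- b) (m ℤ.- b)
    (≡.subst (+ p ∣ℤ_) (shift (+ toℕ j) m b) (mod-sym m (+ toℕ j) (proj₂ (residue m))))
    where
    j = proj₁ (residue m)

    shift : ∀ j m b → j ℤ.- m ≡ (j ℤ.- b) ℤ.- (m ℤ.- b)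
    shift = ℤ-solve-∀

  ζ^-mod : ∀ a b → a ≡ b [mod p ] → ∀ i → (ζ^ a) i ≡ (ζ^ b) i
  ζ^-mod a b a≡b i = δₚ-cong (+ toℕ i ℤ.- a) (+ toℕ i ℤ.- b)
    (≡.subst (+ p ∣ℤ_) (shift (+ toℕ i) a b) (mod-sym a b a≡b))
    where
    shift : ∀ i a b → b ℤ.- a ≡ (i ℤ.- a) ℤ.- (i ℤ.- b)
    shift = ℤ-solve-∀

  -- The product is a cyclic convolution. For fixed i the indicator of i + j ≡ m, read as a function
  -- of j, is the vector of ζᵐ⁻ⁱ, and `sift` collapses the inner sum.
  convolution : ∀ f g m → at (f * g) m ≡ sumℚ λ i → f i ℚ.* at g (m ℤ.- + toℕ i)
  convolution f g m = sum-cong-≗ λ i → begin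
    sumℚ (λ j → f i ℚ.* g j ℚ.* (ζ^ (+ (toℕ i ℕ.+ toℕ j))) a)
      ≡⟨ sum-cong-≗ (λ j → ≡.trans (ℚ.*-assoc (f i) (g j) _)
           (≡.cong (λ e → f i ℚ.* (g j ℚ.* e)) (reflect i j))) ⟩
    sumℚ (λ j → f i ℚ.* (g j ℚ.* (ζ^ (m ℤ.- + toℕ i)) j))
      ≡⟨ *-distribˡ-sum (f i) (λ j → g j ℚ.* (ζ^ (m ℤ.- + toℕ i)) j) ⟨
    f i ℚ.* sumℚ (λ j → g j ℚ.* (ζ^ (m ℤ.- + toℕ i)) j)
      ≡⟨ ≡.cong (f i ℚ.*_) (sift (m ℤ.- + toℕ i) _ g (proj₂ (residue (m ℤ.- + toℕ i)))) ⟩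
    f i ℚ.* at g (m ℤ.- + toℕ i) ∎
    where
    open ≡-Reasoning
    a = proj₁ (residue m)

    δₚ-neg : ∀ m → δₚ (ℤ.- m) ≡ δₚ m
    δₚ-neg m = ≡.cong (λ n → if does (p ℕ.∣? n) then 1ℚ else 0ℚ) (ℤ.∣-i∣≡∣i∣ m)

    reflect : ∀ i j → (ζ^ (+ (toℕ i ℕ.+ toℕ j))) a ≡ (ζ^ (m ℤ.- + toℕ i)) j
    reflect i j = ≡.trans (≡.sym (δₚ-neg (+ toℕ a ℤ.- (+ toℕ i ℤ.+ + toℕ j))))
      (δₚ-cong (ℤ.- (+ toℕ a ℤ.- (+ toℕ i ℤ.+ + toℕ j))) (+ toℕ j ℤ.- (m ℤ.- + toℕ i))
        (≡.subst (+ p ∣ℤ_) (difference (+ toℕ a) m (+ toℕ i) (+ toℕ j)) (proj₂ (residue m))))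
      where
      difference : ∀ a m i j → m ℤ.- a ≡ ℤ.- (a ℤ.- (i ℤ.+ j)) ℤ.- (j ℤ.- (m ℤ.- i))
      difference = ℤ-solve-∀

  *-at : ∀ f g i → (f * g) i ≡ sumℚ λ j → f j ℚ.* at g (+ toℕ i ℤ.- + toℕ j)
  *-at f g i = ≡.trans (≡.sym (at-mod (f * g) (+ toℕ i) i (mod-refl (+ toℕ i)))) (convolution f g (+ toℕ i))

  infix 4 _≗_
  -- Coordinatewise equality is equality in ℚ[X]/(Xᵖ - 1). The ring laws already hold there; passing
  -- to `_≈_` then only requires that the operations respect the added constant.
  _≗_ : ℚ⟨ζ⟩ → ℚ⟨ζ⟩ → Set
  f ≗ g = ∀ i → f i ≡ g i

  ≗⇒≈ : ∀ f g → f ≗ g → f ≈ g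
  ≗⇒≈ f g f≗g = 0ℚ , λ i → ≡.trans (f≗g i) (≡.sym (ℚ.+-identityʳ (g i)))

  *-congʳ-≗ : ∀ f {g h} → g ≗ h → f * g ≗ f * h
  *-congʳ-≗ f g≗h i = sum-cong-≗ {p} λ j → sum-cong-≗ {p} λ l →
    ≡.cong (λ e → f j ℚ.* e ℚ.* (ζ^ (+ (toℕ j ℕ.+ toℕ l))) i) (g≗h l)

  *-comm-≗ : ∀ f g → f * g ≗ g * f
  *-comm-≗ f g i = ≡.trans (∑-comm (λ j l → f j ℚ.* g l ℚ.* (ζ^ (+ (toℕ j ℕ.+ toℕ l))) i))
    (sum-cong-≗ λ l → sum-cong-≗ λ j → ≡.cong₂ (λ e n → e ℚ.* (ζ^ (+ n)) i)
      (ℚ.*-comm (f j) (g l)) (ℕ.+-comm (toℕ j) (toℕ l)))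

  -- Two uses of `convolution` make both sides the same double sum with the order of summation
  -- exchanged. Associativity then follows from this and commutativity.
  *-leftComm-≗ : ∀ f g h → f * (g * h) ≗ g * (f * h)
  *-leftComm-≗ f g h i = begin
    (f * (g * h)) i                                                    ≡⟨ double f g ⟩
    sumℚ (λ j → sumℚ λ l → f j ℚ.* (g l ℚ.* at h (i′ ℤ.- + toℕ j ℤ.- + toℕ l)))
      ≡⟨ ∑-comm (λ j l → f j ℚ.* (g l ℚ.* at h (i′ ℤ.- + toℕ j ℤ.- + toℕ l))) ⟩
    sumℚ (λ l → sumℚ λ j → f j ℚ.* (g l ℚ.* at h (i′ ℤ.- + toℕ j ℤ.- + toℕ l)))
      ≡⟨ sum-cong-≗ (λ l → sum-cong-≗ λ j → ≡.trans (swap (f j) (g l) _)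
           (≡.cong (λ m → g l ℚ.* (f j ℚ.* at h m)) (exchange i′ (+ toℕ j) (+ toℕ l)))) ⟩
    sumℚ (λ l → sumℚ λ j → g l ℚ.* (f j ℚ.* at h (i′ ℤ.- + toℕ l ℤ.- + toℕ j)))
                                                                       ≡⟨ double g f ⟨
    (g * (f * h)) i                                                    ∎
    where
    open ≡-Reasoning
    i′ = + toℕ i

    exchange : ∀ i j l → i ℤ.- j ℤ.- l ≡ i ℤ.- l ℤ.- j
    exchange = ℤ-solve-∀

    swap : ∀ a b c → a ℚ.* (b ℚ.* c) ≡ b ℚ.* (a ℚ.* c)
    swap a b c = ≡.trans (≡.sym (ℚ.*-assoc a b c)) (≡.trans (≡.cong (ℚ._* c) (ℚ.*-comm a b)) (ℚ.*-assoc b a c))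

    double : ∀ f g → (f * (g * h)) i ≡
      sumℚ λ j → sumℚ λ l → f j ℚ.* (g l ℚ.* at h (i′ ℤ.- + toℕ j ℤ.- + toℕ l))
    double f g = ≡.trans (*-at f (g * h) i) (sum-cong-≗ λ j → ≡.trans
      (≡.cong (f j ℚ.*_) (convolution g h (i′ ℤ.- + toℕ j)))
      (*-distribˡ-sum (f j) (λ l → g l ℚ.* at h (i′ ℤ.- + toℕ j ℤ.- + toℕ l))))

  *-assoc-≗ : ∀ f g h → (f * g) * h ≗ f * (g * h)
  *-assoc-≗ f g h i = ≡.trans (*-comm-≗ (f * g) h i)
    (≡.trans (*-leftComm-≗ h f g i) (*-congʳ-≗ f (*-comm-≗ h g) i))

  scale-1# : ∀ a f → (λ i → a ℚ.* 1# i) * f ≗ λ i → a ℚ.* f i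
  scale-1# a f i = begin
    ((λ i → a ℚ.* 1# i) * f) i                                       ≡⟨ *-at (λ j → a ℚ.* 1# j) f i ⟩
    sumℚ (λ j → a ℚ.* 1# j ℚ.* at f (+ toℕ i ℤ.- + toℕ j))           ≡⟨ sum-cong-≗ (λ j → rearrange a (1# j) (at f (+ toℕ i ℤ.- + toℕ j))) ⟩
    sumℚ (λ j → a ℚ.* at f (+ toℕ i ℤ.- + toℕ j) ℚ.* 1# j)           ≡⟨ sift 0ℤ Fin.zero (λ j → a ℚ.* at f (+ toℕ i ℤ.- + toℕ j)) (mod-refl 0ℤ) ⟩
    a ℚ.* at f (+ toℕ i ℤ.- 0ℤ)                                      ≡⟨ ≡.cong (a ℚ.*_) (at-mod f (+ toℕ i ℤ.- 0ℤ) i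
                                                                          (≡.subst (_≡ + toℕ i [mod p ]) (≡.sym (ℤ.+-identityʳ (+ toℕ i))) (mod-refl (+ toℕ i)))) ⟩
    a ℚ.* f i                                                        ∎
    where
    open ≡-Reasoning

    rearrange : ∀ a b c → a ℚ.* b ℚ.* c ≡ a ℚ.* c ℚ.* b
    rearrange a b c = ≡.trans (ℚ.*-assoc a b c) (≡.trans (≡.cong (a ℚ.*_) (ℚ.*-comm b c)) (≡.sym (ℚ.*-assoc a c b)))

  *-distribˡ-≗ : ∀ f g h → f * (g + h) ≗ f * g + f * h
  *-distribˡ-≗ f g h i = begin
    (f * (g + h)) i
      ≡⟨ *-at f (g + h) i ⟩
    sumℚ (λ j → f j ℚ.* (at g (+ toℕ i ℤ.- + toℕ j) ℚ.+ at h (+ toℕ i ℤ.- + toℕ j)))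
      ≡⟨ sum-cong-≗ (λ j → ℚ.*-distribˡ-+ (f j) (at g (+ toℕ i ℤ.- + toℕ j)) (at h (+ toℕ i ℤ.- + toℕ j))) ⟩
    sumℚ (λ j → f j ℚ.* at g (+ toℕ i ℤ.- + toℕ j) ℚ.+ f j ℚ.* at h (+ toℕ i ℤ.- + toℕ j))
      ≡⟨ ∑-distrib-+ (λ j → f j ℚ.* at g (+ toℕ i ℤ.- + toℕ j)) (λ j → f j ℚ.* at h (+ toℕ i ℤ.- + toℕ j)) ⟩
    sumℚ (λ j → f j ℚ.* at g (+ toℕ i ℤ.- + toℕ j)) ℚ.+ sumℚ (λ j → f j ℚ.* at h (+ toℕ i ℤ.- + toℕ j))
      ≡⟨ ≡.cong₂ ℚ._+_ (*-at f g i) (*-at f h i) ⟨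
    (f * g + f * h) i ∎
    where open ≡-Reasoning

  -- A constant `c` added to every coordinate of the second factor contributes c · Σf to every
  -- coordinate of the product: multiples of 1 + ζ + ... + ζᵖ⁻¹ form an ideal.
  *-congʳ-≈ : ∀ f g h → g ≈ h → f * g ≈ f * h
  *-congʳ-≈ f g h (c , g≡h+c) = sumℚ f ℚ.* c , λ i → begin
    (f * g) i
      ≡⟨ *-at f g i ⟩
    sumℚ (λ j → f j ℚ.* at g (+ toℕ i ℤ.- + toℕ j))
      ≡⟨ sum-cong-≗ (λ j → ≡.trans (≡.cong (f j ℚ.*_) (g≡h+c (proj₁ (residue (+ toℕ i ℤ.- + toℕ j))))) (ℚ.*-distribˡ-+ (f j) (at h (+ toℕ i ℤ.- + toℕ j)) c)) ⟩
    sumℚ (λ j → f j ℚ.* at h (+ toℕ i ℤ.- + toℕ j) ℚ.+ f j ℚ.* c)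
      ≡⟨ ∑-distrib-+ (λ j → f j ℚ.* at h (+ toℕ i ℤ.- + toℕ j)) (λ j → f j ℚ.* c) ⟩
    sumℚ (λ j → f j ℚ.* at h (+ toℕ i ℤ.- + toℕ j)) ℚ.+ sumℚ (λ j → f j ℚ.* c)
      ≡⟨ ≡.cong₂ ℚ._+_ (*-at f h i) (*-distribʳ-sum c f) ⟨
    (f * h) i ℚ.+ sumℚ f ℚ.* c ∎
    where open ≡-Reasoning

  ≈-refl : ∀ f → f ≈ f
  ≈-refl f = ≗⇒≈ f f λ _ → ≡.refl

  ≈-sym : ∀ f g → f ≈ g → g ≈ f
  ≈-sym f g (c , f≡g+c) = ℚ.- c , λ i → begin
    g i                       ≡⟨ ℚ.+-identityʳ (g i) ⟨
    g i ℚ.+ 0ℚ                ≡⟨ ≡.cong (g i ℚ.+_) (ℚ.+-inverseʳ c) ⟨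
    g i ℚ.+ (c ℚ.+ ℚ.- c)     ≡⟨ ℚ.+-assoc (g i) c (ℚ.- c) ⟨
    g i ℚ.+ c ℚ.+ ℚ.- c       ≡⟨ ≡.cong (ℚ._+ ℚ.- c) (f≡g+c i) ⟨
    f i ℚ.+ ℚ.- c             ∎
    where open ≡-Reasoning

  ≈-trans : ∀ f g h → f ≈ g → g ≈ h → f ≈ h
  ≈-trans f g h (c , f≡g+c) (d , g≡h+d) = d ℚ.+ c , λ i →
    ≡.trans (f≡g+c i) (≡.trans (≡.cong (ℚ._+ c) (g≡h+d i)) (ℚ.+-assoc (h i) d c))

  interchange : ∀ a b c d → (a ℚ.+ b) ℚ.+ (c ℚ.+ d) ≡ (a ℚ.+ c) ℚ.+ (b ℚ.+ d)
  interchange a b c d = begin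
    (a ℚ.+ b) ℚ.+ (c ℚ.+ d)   ≡⟨ ℚ.+-assoc a b (c ℚ.+ d) ⟩
    a ℚ.+ (b ℚ.+ (c ℚ.+ d))   ≡⟨ ≡.cong (a ℚ.+_) (ℚ.+-assoc b c d) ⟨
    a ℚ.+ (b ℚ.+ c ℚ.+ d)     ≡⟨ ≡.cong (λ e → a ℚ.+ (e ℚ.+ d)) (ℚ.+-comm b c) ⟩
    a ℚ.+ (c ℚ.+ b ℚ.+ d)     ≡⟨ ≡.cong (a ℚ.+_) (ℚ.+-assoc c b d) ⟩
    a ℚ.+ (c ℚ.+ (b ℚ.+ d))   ≡⟨ ℚ.+-assoc a c (b ℚ.+ d) ⟨
    (a ℚ.+ c) ℚ.+ (b ℚ.+ d)   ∎
    where open ≡-Reasoning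

  +-cong-≈ : ∀ f g h k → f ≈ g → h ≈ k → f + h ≈ g + k
  +-cong-≈ f g h k (c , f≡g+c) (d , h≡k+d) = c ℚ.+ d , λ i →
    ≡.trans (≡.cong₂ ℚ._+_ (f≡g+c i) (h≡k+d i)) (interchange (g i) c (k i) d)

  -‿cong-≈ : ∀ f g → f ≈ g → - f ≈ - g
  -‿cong-≈ f g (c , f≡g+c) = ℚ.- c , λ i → ≡.trans (≡.cong ℚ.-_ (f≡g+c i)) (ℚ.neg-distrib-+ (g i) c)

  *-comm-≈ : ∀ f g → f * g ≈ g * f
  *-comm-≈ f g = ≗⇒≈ (f * g) (g * f) (*-comm-≗ f g)

  *-cong-≈ : ∀ f g h k → f ≈ g → h ≈ k → f * h ≈ g * k
  *-cong-≈ f g h k f≈g h≈k = ≈-trans (f * h) (f * k) (g * k) (*-congʳ-≈ f h k h≈k)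
    (≈-trans (f * k) (k * f) (g * k) (*-comm-≈ f k)
      (≈-trans (k * f) (k * g) (g * k) (*-congʳ-≈ k f g f≈g) (*-comm-≈ k g)))

  *-identityˡ-≗ : ∀ f → 1# * f ≗ f
  *-identityˡ-≗ f i = ≡.trans (*-comm-≗ 1# f i) (≡.trans
    (*-congʳ-≗ f {1#} {λ j → 1ℚ ℚ.* 1# j} (λ j → ≡.sym (ℚ.*-identityˡ (1# j))) i)
    (≡.trans (*-comm-≗ f (λ j → 1ℚ ℚ.* 1# j) i) (≡.trans (scale-1# 1ℚ f i) (ℚ.*-identityˡ (f i)))))

  *-distribʳ-≗ : ∀ f g h → (g + h) * f ≗ g * f + h * f
  *-distribʳ-≗ f g h i = ≡.trans (*-comm-≗ (g + h) f i)
    (≡.trans (*-distribˡ-≗ f g h i) (≡.cong₂ ℚ._+_ (*-comm-≗ f g i) (*-comm-≗ f h i)))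

  cyclotomicRing : CommutativeRing 0ℓ 0ℓ
  cyclotomicRing = record
    { Carrier = ℚ⟨ζ⟩ ; _≈_ = _≈_ ; _+_ = _+_ ; _*_ = _*_ ; -_ = -_ ; 0# = 0# ; 1# = 1#
    ; isCommutativeRing = record
      { isRing = record
        { +-isAbelianGroup = record
          { isGroup = record
            { isMonoid = record
              { isSemigroup = record
                { isMagma = record
                  { isEquivalence = record
                    { refl  = λ {f} → ≈-refl f
                    ; sym   = λ {f} {g} → ≈-sym f g
                    ; trans = λ {f} {g} {h} → ≈-trans f g h
                    }
                  ; ∙-cong = λ {f} {g} {h} {k} → +-cong-≈ f g h k
                  }
                ; assoc = λ f g h → ≗⇒≈ (f + g + h) (f + (g + h)) λ i → ℚ.+-assoc (f i) (g i) (h i)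
                }
              ; identity = (λ f → ≗⇒≈ (0# + f) f λ i → ℚ.+-identityˡ (f i))
                         , (λ f → ≗⇒≈ (f + 0#) f λ i → ℚ.+-identityʳ (f i))
              }
            ; inverse = (λ f → ≗⇒≈ (- f + f) 0# λ i → ℚ.+-inverseˡ (f i))
                      , (λ f → ≗⇒≈ (f - f) 0# λ i → ℚ.+-inverseʳ (f i))
            ; ⁻¹-cong = λ {f} {g} → -‿cong-≈ f g
            }
          ; comm = λ f g → ≗⇒≈ (f + g) (g + f) λ i → ℚ.+-comm (f i) (g i)
          }
        ; *-cong     = λ {f} {g} {h} {k} → *-cong-≈ f g h k
        ; *-assoc    = λ f g h → ≗⇒≈ (f * g * h) (f * (g * h)) (*-assoc-≗ f g h)
        ; *-identity = (λ f → ≗⇒≈ (1# * f) f (*-identityˡ-≗ f))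
                     , (λ f → ≗⇒≈ (f * 1#) f λ i → ≡.trans (*-comm-≗ f 1# i) (*-identityˡ-≗ f i))
        ; distrib    = (λ f g h → ≗⇒≈ (f * (g + h)) (f * g + f * h) (*-distribˡ-≗ f g h))
                     , (λ f g h → ≗⇒≈ ((g + h) * f) (g * f + h * f) (*-distribʳ-≗ f g h))
        }
      ; *-comm = *-comm-≈
      }
    }

  ι : ℚ → ℚ⟨ζ⟩
  ι a i = a ℚ.* 1# i

  ι-homo : RingMorphisms.IsRingHomomorphism ℚ.+-*-rawRing rawRing ι
  ι-homo = record
    { isSemiringHomomorphism = record
      { isNearSemiringHomomorphism = record
        { +-isMonoidHomomorphism = record
          { isMagmaHomomorphism = record
            { isRelHomomorphism = record { cong = λ { {a} ≡.refl → ≈-refl (ι a) } }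
            ; homo = λ a b → ≗⇒≈ (ι (a ℚ.+ b)) (ι a + ι b) λ i → ℚ.*-distribʳ-+ (1# i) a b
            }
          ; ε-homo = ≗⇒≈ (ι 0ℚ) 0# λ i → ℚ.*-zeroˡ (1# i)
          }
        ; *-homo = λ a b → ≗⇒≈ (ι (a ℚ.* b)) (ι a * ι b) λ i → ≡.trans (ℚ.*-assoc a b (1# i)) (≡.sym (scale-1# a (ι b) i))
        }
      ; 1#-homo = ≗⇒≈ (ι 1ℚ) 1# λ i → ℚ.*-identityˡ (1# i)
      }
    ; -‿homo = λ a → ≗⇒≈ (ι (ℚ.- a)) (- ι a) λ i → ≡.sym (ℚ.neg-distribˡ-* a (1# i))
    }

  ι-zero : ∀ a → ι a Fin.zero ≡ a
  ι-zero a = ≡.trans (≡.cong (a ℚ.*_) (δₚ-1 0ℤ (mod-refl 0ℤ))) (ℚ.*-identityʳ a)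

  ι-one : ∀ a → ι a (Fin.suc Fin.zero) ≡ 0ℚ
  ι-one a = ≡.trans (≡.cong (a ℚ.*_) (δₚ-0 1ℤ λ p∣1 → ℕ.<⇒≱ (s≤s (s≤s z≤n)) (ℕ.∣⇒≤ p∣1))) (ℚ.*-zeroʳ a)

  sum-pointwise : ∀ {n} (F : Vector ℚ⟨ζ⟩ n) i → sum F i ≡ sumℚ λ j → F j i
  sum-pointwise {zero}  F i = ≡.refl
  sum-pointwise {suc n} F i = ≡.cong (F Fin.zero i ℚ.+_) (sum-pointwise (F ∘ Fin.suc) i)

  combination : Vector ℚ p → ℚ⟨ζ⟩
  combination f = sum λ i → ι (f i) * ζ^ (+ toℕ i)

  combination-≗ : ∀ f → combination f ≗ f
  combination-≗ f i = ≡.trans (sum-pointwise (λ j → ι (f j) * ζ^ (+ toℕ j)) i) (≡.trans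
    (sum-cong-≗ λ j → ≡.trans (scale-1# (f j) (ζ^ (+ toℕ j)) i)
      (≡.cong (λ n → f j ℚ.* (if does (p ℕ.∣? n) then 1ℚ else 0ℚ)) (ℤ.∣i-j∣≡∣j-i∣ (+ toℕ i) (+ toℕ j))))
    (sift (+ toℕ i) i f (mod-refl (+ toℕ i))))

  -- Differences of coordinates are what survives the quotient by constant vectors. On `ι a` the
  -- difference of coordinates 0 and 1 recovers `a`, which yields injectivity of `ι`.
  difference : ∀ f g → f ≈ g → ∀ i j → f i ℚ.+ ℚ.- f j ≡ g i ℚ.+ ℚ.- g j
  difference f g (c , f≡g+c) i j = begin
    f i ℚ.+ ℚ.- f j                       ≡⟨ ≡.cong₂ (λ a b → a ℚ.+ ℚ.- b) (f≡g+c i) (f≡g+c j) ⟩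
    g i ℚ.+ c ℚ.+ ℚ.- (g j ℚ.+ c)         ≡⟨ ≡.cong (g i ℚ.+ c ℚ.+_) (ℚ.neg-distrib-+ (g j) c) ⟩
    g i ℚ.+ c ℚ.+ (ℚ.- g j ℚ.+ ℚ.- c)     ≡⟨ interchange (g i) c (ℚ.- g j) (ℚ.- c) ⟩
    g i ℚ.+ ℚ.- g j ℚ.+ (c ℚ.+ ℚ.- c)     ≡⟨ ≡.cong (g i ℚ.+ ℚ.- g j ℚ.+_) (ℚ.+-inverseʳ c) ⟩
    g i ℚ.+ ℚ.- g j ℚ.+ 0ℚ                ≡⟨ ℚ.+-identityʳ _ ⟩
    g i ℚ.+ ℚ.- g j                       ∎
    where open ≡-Reasoning

  ι-difference : ∀ a → ι a Fin.zero ℚ.+ ℚ.- ι a (Fin.suc Fin.zero) ≡ a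
  ι-difference a = ≡.trans (≡.cong₂ (λ b c → b ℚ.+ ℚ.- c) (ι-zero a) (ι-one a)) (ℚ.+-identityʳ a)

  cyclotomicField : CyclotomicField p
  cyclotomicField = record
    { commutativeRing = cyclotomicRing
    ; ι               = ι
    ; ι-homo          = ι-homo
    ; ι-injective     = λ {a} {b} a≈b → ≡.trans (≡.sym (ι-difference a))
        (≡.trans (difference (ι a) (ι b) a≈b Fin.zero (Fin.suc Fin.zero)) (ι-difference b))
    ; ζ^_             = ζ^_
    ; ζ^-cong         = λ {a} {b} a≡b → ≗⇒≈ (ζ^ a) (ζ^ b) (ζ^-mod a b a≡b)
    ; ζ^-+            = λ a b → ≗⇒≈ (ζ^ (a ℤ.+ b)) (ζ^ a * ζ^ b) (ζ^-+ a b)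
    ; ζ^0             = ≈-refl 1#
    -- Coordinatewise the sum is the constant vector 1, so 1 is the constant that relates it to 0.
    ; ∑ζ              = 1ℚ , λ i → ≡.trans (∑ζ i) (≡.sym (ℚ.+-identityˡ 1ℚ))
    ; coordinates     = λ f → f , ≗⇒≈ f (combination f) (λ i → ≡.sym (combination-≗ f i))
    ; ι-integral      = ι-integral
    }
    where
    ζ^-+ : ∀ a b → ζ^ (a ℤ.+ b) ≗ ζ^ a * ζ^ b
    ζ^-+ a b i = ≡.sym (begin
      (ζ^ a * ζ^ b) i                                                ≡⟨ *-at (ζ^ a) (ζ^ b) i ⟩
      sumℚ (λ j → (ζ^ a) j ℚ.* at (ζ^ b) (+ toℕ i ℤ.- + toℕ j))      ≡⟨ sum-cong-≗ (λ j → ℚ.*-comm ((ζ^ a) j) (at (ζ^ b) (+ toℕ i ℤ.- + toℕ j))) ⟩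
      sumℚ (λ j → at (ζ^ b) (+ toℕ i ℤ.- + toℕ j) ℚ.* (ζ^ a) j)      ≡⟨ sift a l (λ j → at (ζ^ b) (+ toℕ i ℤ.- + toℕ j)) a≡l ⟩
      at (ζ^ b) (+ toℕ i ℤ.- + toℕ l)                                ≡⟨ at-ζ^ b (+ toℕ i ℤ.- + toℕ l) ⟩
      δₚ (+ toℕ i ℤ.- + toℕ l ℤ.- b)                                 ≡⟨ δₚ-cong (+ toℕ i ℤ.- + toℕ l ℤ.- b) (+ toℕ i ℤ.- (a ℤ.+ b))
                                                                          (≡.subst (+ p ∣ℤ_) (shift (+ toℕ i) (+ toℕ l) a b) a≡l) ⟩
      (ζ^ (a ℤ.+ b)) i                                               ∎)
      where
      open ≡-Reasoning
      l = proj₁ (residue a)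
      a≡l = proj₂ (residue a)

      shift : ∀ i l a b → a ℤ.- l ≡ (i ℤ.- l ℤ.- b) ℤ.- (i ℤ.- (a ℤ.+ b))
      shift = ℤ-solve-∀

    ∑ζ : ∀ i → sum {p} (λ j → ζ^ (+ toℕ j)) i ≡ 1ℚ
    ∑ζ i = begin
      sum {p} (λ j → ζ^ (+ toℕ j)) i               ≡⟨ sum-pointwise {p} (λ j → ζ^ (+ toℕ j)) i ⟩
      sumℚ {p} (λ j → (ζ^ (+ toℕ j)) i)            ≡⟨ sum-cong-≗ {p} (λ j → ≡.trans (scale-1# 1ℚ (ζ^ (+ toℕ j)) i)
                                                        (ℚ.*-identityˡ ((ζ^ (+ toℕ j)) i))) ⟨
      sumℚ {p} (λ j → (ι 1ℚ * ζ^ (+ toℕ j)) i)     ≡⟨ sum-pointwise {p} (λ j → ι 1ℚ * ζ^ (+ toℕ j)) i ⟨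
      combination (λ _ → 1ℚ) i                     ≡⟨ combination-≗ (λ _ → 1ℚ) i ⟩
      1ℚ                                           ∎
      where open ≡-Reasoning

    -- Subtracting coordinate 1 from coordinate 0 removes the unknown constant in `_≈_`: it leaves
    -- `a` on the left and a difference of two integers on the right.
    ι-integral : ∀ a (g : Vector ℤ p) → ι a ≈ combination (λ j → g j / 1) → IsInteger a
    ι-integral a g a≈g = g Fin.zero ℤ.- g (Fin.suc Fin.zero) , (begin
      a
        ≡⟨ ι-difference a ⟨
      ι a Fin.zero ℚ.+ ℚ.- ι a (Fin.suc Fin.zero)
        ≡⟨ difference (ι a) (combination (λ j → g j / 1)) a≈g Fin.zero (Fin.suc Fin.zero) ⟩
      combination (λ j → g j / 1) Fin.zero ℚ.+ ℚ.- combination (λ j → g j / 1) (Fin.suc Fin.zero)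
        ≡⟨ ≡.cong₂ (λ b c → b ℚ.+ ℚ.- c) (combination-≗ (λ j → g j / 1) Fin.zero)
             (combination-≗ (λ j → g j / 1) (Fin.suc Fin.zero)) ⟩
      (g Fin.zero / 1) ℚ.+ ℚ.- (g (Fin.suc Fin.zero) / 1)
        ≡⟨ ≡.cong ((g Fin.zero / 1) ℚ.+_) (/1-homo‿- (g (Fin.suc Fin.zero))) ⟨
      (g Fin.zero / 1) ℚ.+ ((ℤ.- g (Fin.suc Fin.zero)) / 1)
        ≡⟨ /1-homo-+ (g Fin.zero) (ℤ.- g (Fin.suc Fin.zero)) ⟨
      (g Fin.zero ℤ.- g (Fin.suc Fin.zero)) / 1 ∎)
      where open ≡-Reasoning

-- The action of σ on ℚ(ζ).

module Galois (q : ℕ) (prime : Prime (suc q)) (F : CyclotomicField (suc q))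
  (r : ℤ) (root : IsPrimitiveRoot (suc q) r)
  (σ : CyclotomicField.Carrier F → CyclotomicField.Carrier F)
  (σ-homo : RingMorphisms.IsRingHomomorphism (CyclotomicField.rawRing F) (CyclotomicField.rawRing F) σ)
  (σζ : CyclotomicField._≈_ F (σ (CyclotomicField.ζ^_ F 1ℤ)) (CyclotomicField.ζ^_ F r))
  where

  open Arithmetic F public
  open PrimeCongruence q prime public
  open PrimitiveRoot r root public
  open Endo Carrier using (^-homo) renaming (_^_ to _^∘_) public
  open RingMorphisms rawRing rawRing using (IsRingHomomorphism)

  ι-cancel : ∀ a → a ≢ 0ℚ → ∀ {x y} → ι a * x ≈ ι a * y → x ≈ y
  ι-cancel a a≢0 {x} {y} ax≈ay = trans (sym (unscale x)) (trans (*-congˡ ax≈ay) (unscale y))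
    where
    instance _ = ℚ.≢-nonZero a≢0

    unscale : ∀ x → ι (ℚ.1/ a) * (ι a * x) ≈ x
    unscale x = begin
      ι (ℚ.1/ a) * (ι a * x)   ≈⟨ *-assoc _ _ _ ⟨
      ι (ℚ.1/ a) * ι a * x     ≈⟨ *-congʳ (ι.*-homo (ℚ.1/ a) a) ⟨
      ι (ℚ.1/ a ℚ.* a) * x     ≈⟨ *-congʳ (trans (ι.⟦⟧-cong (ℚ.*-inverseˡ a)) ι.1#-homo) ⟩
      1# * x                   ≈⟨ *-identityˡ x ⟩
      x                        ∎

  ιℤ-cancel : ∀ c → c ≢ 0ℤ → ∀ {x y} → ιℤ c * x ≈ ιℤ c * y → x ≈ y
  ιℤ-cancel c c≢0 = ι-cancel (c / 1) (c≢0 ∘ /1-injective c 0ℤ)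

  -- Linearity over ℚ is a consequence of being a ring homomorphism: integers are sums of ±1, and a
  -- rational is determined by numerator = denominator · a.
  fixes-ι : ∀ {φ} → IsRingHomomorphism φ → ∀ a → φ (ι a) ≈ ι a
  fixes-ι {φ} φ-homo a = ιℤ-cancel (ℚ.↧ a) (λ ()) (begin
    ιℤ (ℚ.↧ a) * φ (ι a)         ≈⟨ *-congʳ (fixes-ιℤ (ℚ.↧ a)) ⟨
    φ (ιℤ (ℚ.↧ a)) * φ (ι a)     ≈⟨ φ.*-homo _ _ ⟨
    φ (ιℤ (ℚ.↧ a) * ι a)         ≈⟨ φ.⟦⟧-cong ↧a*a≈↥a ⟩
    φ (ιℤ (ℚ.↥ a))               ≈⟨ fixes-ιℤ (ℚ.↥ a) ⟩
    ιℤ (ℚ.↥ a)                   ≈⟨ ↧a*a≈↥a ⟨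
    ιℤ (ℚ.↧ a) * ι a             ∎)
    where
    module φ = IsRingHomomorphism φ-homo

    ↧a*a≈↥a : ιℤ (ℚ.↧ a) * ι a ≈ ιℤ (ℚ.↥ a)
    ↧a*a≈↥a = trans (sym (ι.*-homo _ _)) (ι.⟦⟧-cong (≡.sym (↥≡↧* a)))

    fixes-ℕ : ∀ n → φ (ιℤ (+ n)) ≈ ιℤ (+ n)
    fixes-ℕ zero    = trans (φ.⟦⟧-cong ι.0#-homo) (trans φ.0#-homo (sym ι.0#-homo))
    fixes-ℕ (suc n) = begin
      φ (ιℤ (1ℤ ℤ.+ + n))        ≈⟨ φ.⟦⟧-cong (ιℤ-+ 1ℤ (+ n)) ⟩
      φ (ιℤ 1ℤ + ιℤ (+ n))       ≈⟨ φ.+-homo _ _ ⟩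
      φ (ιℤ 1ℤ) + φ (ιℤ (+ n))   ≈⟨ +-cong (trans (φ.⟦⟧-cong ι.1#-homo) (trans φ.1#-homo (sym ι.1#-homo))) (fixes-ℕ n) ⟩
      ιℤ 1ℤ + ιℤ (+ n)           ≈⟨ ιℤ-+ 1ℤ (+ n) ⟨
      ιℤ (1ℤ ℤ.+ + n)            ∎

    fixes-ιℤ : ∀ i → φ (ιℤ i) ≈ ιℤ i
    fixes-ιℤ (+ n)      = fixes-ℕ n
    fixes-ιℤ -[1+ n ] = begin
      φ (ιℤ (ℤ.- (+ suc n)))     ≈⟨ φ.⟦⟧-cong (ιℤ-neg (+ suc n)) ⟩
      φ (- ιℤ (+ suc n))         ≈⟨ φ.-‿homo _ ⟩
      - φ (ιℤ (+ suc n))         ≈⟨ -‿cong (fixes-ℕ (suc n)) ⟩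
      - ιℤ (+ suc n)             ≈⟨ ιℤ-neg (+ suc n) ⟨
      ιℤ (ℤ.- (+ suc n))         ∎

  σ^ : ℕ → Carrier → Carrier
  σ^ k = σ ^∘ k

  σ^-homo : ∀ k → IsRingHomomorphism (σ^ k)
  σ^-homo zero    = Identity.isRingHomomorphism rawRing refl
  σ^-homo (suc k) = Composition.isRingHomomorphism trans (σ^-homo k) σ-homo

  module σ = IsRingHomomorphism σ-homo
  module σ^ k = IsRingHomomorphism (σ^-homo k)

  σ^-+ : ∀ j k y → σ^ (j ℕ.+ k) y ≡ σ^ j (σ^ k y)
  σ^-+ j k y = ≡.cong-app (^-homo σ j k) y

  σ^-σ : ∀ k y → σ^ k (σ y) ≡ σ (σ^ k y)
  σ^-σ zero    y = ≡.refl
  σ^-σ (suc k) y = ≡.cong σ (σ^-σ k y)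

  σ^-sum : ∀ k {n} (f : Vector Carrier n) → σ^ k (sum f) ≈ sum (σ^ k ∘ f)
  σ^-sum k = SumHomomorphism.homo-sum +-monoid +-monoid (σ^ k) (σ^.+-isMonoidHomomorphism k)

  σ^-product : ∀ k {n} (f : Vector Carrier n) → σ^ k (product f) ≈ product (σ^ k ∘ f)
  σ^-product k = SumHomomorphism.homo-sum *-monoid *-monoid (σ^ k) (σ^.*-isMonoidHomomorphism k)

  σ-ζ^ : ∀ m → σ (ζ^ m) ≈ ζ^ (m ℤ.* r)
  σ-ζ^ m = begin
    σ (ζ^ m)            ≈⟨ σ.⟦⟧-cong (ζ^-cong m≡i) ⟩
    σ (ζ^ (+ toℕ i))    ≈⟨ natural (toℕ i) ⟩
    ζ^ (+ toℕ i ℤ.* r)  ≈⟨ ζ^-cong (mod-* m (+ toℕ i) r r m≡i (mod-refl r)) ⟨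
    ζ^ (m ℤ.* r)        ∎
    where
    i = proj₁ (residue m)
    m≡i = proj₂ (residue m)

    distribute : ∀ n r → (1ℤ ℤ.+ n) ℤ.* r ≡ r ℤ.+ n ℤ.* r
    distribute = ℤ-solve-∀

    -- Induction over natural exponents suffices, since an arbitrary `m` has been replaced by its
    -- residue.
    natural : ∀ n → σ (ζ^ (+ n)) ≈ ζ^ (+ n ℤ.* r)
    natural zero    = trans (σ.⟦⟧-cong ζ^0) (trans σ.1#-homo (trans (sym ζ^0) (reflexive (≡.cong ζ^_ (≡.sym (ℤ.*-zeroˡ r))))))
    natural (suc n) = begin
      σ (ζ^ (1ℤ ℤ.+ + n))          ≈⟨ σ.⟦⟧-cong (ζ^-+ 1ℤ (+ n)) ⟩
      σ (ζ^ 1ℤ * ζ^ (+ n))         ≈⟨ σ.*-homo _ _ ⟩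
      σ (ζ^ 1ℤ) * σ (ζ^ (+ n))     ≈⟨ *-cong σζ (natural n) ⟩
      ζ^ r * ζ^ (+ n ℤ.* r)        ≈⟨ ζ^-+ r (+ n ℤ.* r) ⟨
      ζ^ (r ℤ.+ + n ℤ.* r)         ≡⟨ ≡.cong ζ^_ (distribute (+ n) r) ⟨
      ζ^ (+ suc n ℤ.* r)           ∎

  σ^-ζ^ : ∀ k m → σ^ k (ζ^ m) ≈ ζ^ (m ℤ.* r ℤ.^ k)
  σ^-ζ^ zero    m = reflexive (≡.cong ζ^_ (≡.sym (ℤ.*-identityʳ m)))
  σ^-ζ^ (suc k) m = begin
    σ (σ^ k (ζ^ m))               ≈⟨ σ.⟦⟧-cong (σ^-ζ^ k m) ⟩
    σ (ζ^ (m ℤ.* r ℤ.^ k))        ≈⟨ σ-ζ^ (m ℤ.* r ℤ.^ k) ⟩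
    ζ^ (m ℤ.* r ℤ.^ k ℤ.* r)      ≡⟨ ≡.cong ζ^_ (rearrange m (r ℤ.^ k) r) ⟩
    ζ^ (m ℤ.* (r ℤ.* r ℤ.^ k))    ∎
    where
    rearrange : ∀ a b c → a ℤ.* b ℤ.* c ≡ a ℤ.* (c ℤ.* b)
    rearrange = ℤ-solve-∀

  σ^-combination : ∀ k f → σ^ k (combination f) ≈ sum λ i → ι (f i) * σ^ k (ζ^ (+ toℕ i))
  σ^-combination k f = trans (σ^-sum k (λ i → ι (f i) * ζ^ (+ toℕ i)))
    (sum-cong-≋ {p} λ i → trans (σ^.*-homo k (ι (f i)) (ζ^ (+ toℕ i))) (*-congʳ (fixes-ι (σ^-homo k) (f i))))

  σ^q≈id : ∀ y → σ^ q y ≈ y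
  σ^q≈id y = let f , y≈f = coordinates y in begin
    σ^ q y                                          ≈⟨ σ^.⟦⟧-cong q y≈f ⟩
    σ^ q (combination f)                            ≈⟨ σ^-combination q f ⟩
    (sum λ i → ι (f i) * σ^ q (ζ^ (+ toℕ i)))       ≈⟨ sum-cong-≋ {p} (λ i → *-congˡ {ι (f i)} (fixed (+ toℕ i))) ⟩
    combination f                                   ≈⟨ y≈f ⟨
    y                                               ∎
    where
    fixed : ∀ m → σ^ q (ζ^ m) ≈ ζ^ m
    fixed m = trans (σ^-ζ^ q m) (trans (ζ^-cong (mod-* m m (r ℤ.^ q) 1ℤ (mod-refl m) r^q≡1))
      (reflexive (≡.cong ζ^_ (ℤ.*-identityʳ m))))

  ℤζ-σ^ : ∀ k {y} → ℤζ y → ℤζ (σ^ k y)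
  ℤζ-σ^ k (g , y≈g) = ℤζ-resp (sym (trans (σ^.⟦⟧-cong k y≈g) (σ^-combination k (λ i → g i / 1))))
    (ℤζ-sum _ λ i → ℤζ-ιℤ* (g i) (ℤζ-resp (sym (σ^-ζ^ k (+ toℕ i))) (ℤζ-ζ^ (+ toℕ i ℤ.* r ℤ.^ k))))

  -- The trace to ℚ.

  tr : Carrier → Carrier
  tr y = sum {q} λ k → σ^ (toℕ k) y

  tr-cong : ∀ {x y} → x ≈ y → tr x ≈ tr y
  tr-cong x≈y = sum-cong-≋ {q} λ k → σ^.⟦⟧-cong (toℕ k) x≈y

  tr-ι* : ∀ a y → tr (ι a * y) ≈ ι a * tr y
  tr-ι* a y = trans
    (sum-cong-≋ {q} λ k → trans (σ^.*-homo (toℕ k) (ι a) y) (*-congʳ (fixes-ι (σ^-homo (toℕ k)) a)))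
    (sym (*-distribˡ-sum {q} (ι a) (λ k → σ^ (toℕ k) y)))

  tr-sum : ∀ {n} (f : Vector Carrier n) → tr (sum f) ≈ sum (tr ∘ f)
  tr-sum f = trans (sum-cong-≋ {q} λ k → σ^-sum (toℕ k) f) (∑-comm {q} (λ k i → σ^ (toℕ k) (f i)))

  tr-neg : ∀ y → tr (- y) ≈ - tr y
  tr-neg y = trans (tr-cong (sym (ιℤ-1* y))) (trans (tr-ι* ((ℤ.- 1ℤ) / 1) y) (ιℤ-1* (tr y)))

  tr-σ : ∀ y → tr (σ y) ≈ tr y
  tr-σ y = trans (sum-cong-≋ {q} λ k → reflexive (σ^-σ (toℕ k) y)) (+Sum.sum-cycle q (λ k → σ^ k y) (σ^q≈id y))

  tr-σ^ : ∀ k y → tr (σ^ k y) ≈ tr y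
  tr-σ^ zero    y = refl
  tr-σ^ (suc k) y = trans (tr-σ (σ^ k y)) (tr-σ^ k y)

  fixed-σ^ : ∀ {y} → σ y ≈ y → ∀ k → σ^ k y ≈ y
  fixed-σ^ σy≈y zero    = refl
  fixed-σ^ σy≈y (suc k) = trans (σ.⟦⟧-cong (fixed-σ^ σy≈y k)) σy≈y

  sum-const : ∀ n x → sum {n} (λ _ → x) ≈ ιℤ (+ n) * x
  sum-const zero    x = sym (trans (*-congʳ ι.0#-homo) (zeroˡ x))
  sum-const (suc n) x = begin
    x + sum {n} (λ _ → x)          ≈⟨ +-cong (*-identityˡ x) (sym (sum-const n x)) ⟨
    1# * x + ιℤ (+ n) * x          ≈⟨ +-congʳ (*-congʳ ι.1#-homo) ⟨
    ιℤ 1ℤ * x + ιℤ (+ n) * x       ≈⟨ distribʳ x _ _ ⟨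
    (ιℤ 1ℤ + ιℤ (+ n)) * x         ≈⟨ *-congʳ (ιℤ-+ 1ℤ (+ n)) ⟨
    ιℤ (+ suc n) * x               ∎

  tr-fixed : ∀ {y} → σ y ≈ y → tr y ≈ ιℤ (+ q) * y
  tr-fixed {y} σy≈y = trans (sum-cong-≋ {q} λ k → fixed-σ^ σy≈y (toℕ k)) (sum-const q y)

  q≢0 : q ≢ 0
  q≢0 q≡0 = ℕ.nonTrivial⇒≢1 {{prime⇒nonTrivial prime}} (≡.cong suc q≡0)

  +q≢0 : + q ≢ 0ℤ
  +q≢0 = q≢0 ∘ ℤ.+-injective

  -- All ζᵐ with p ∤ m are conjugate, so their traces agree. Adding the q of them gives q · tr(ζ) =
  -- tr(ζ + ... + ζ^q) = tr(-1) = -q, and q cancels.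
  tr-ζ^ : ∀ m → ¬ (+ p ∣ℤ m) → tr (ζ^ m) ≈ - 1#
  tr-ζ^ m p∤m = trans (tr-conjugate m p∤m) (ιℤ-cancel (+ q) +q≢0 (begin
    ιℤ (+ q) * tr ζ                          ≈⟨ sum-const q (tr ζ) ⟨
    sum {q} (λ _ → tr ζ)                     ≈⟨ sum-cong-≋ {q} (λ i → tr-conjugate (+ suc (toℕ i)) (+suc≢0 i)) ⟨
    sum {q} (λ i → tr (ζ^ (+ suc (toℕ i))))  ≈⟨ tr-sum {q} (λ i → ζ^ (+ suc (toℕ i))) ⟨
    tr (sum {q} λ i → ζ^ (+ suc (toℕ i)))    ≈⟨ tr-cong ∑ζ⁺ ⟩
    tr (- 1#)                                ≈⟨ tr-fixed (trans (σ.-‿homo 1#) (-‿cong σ.1#-homo)) ⟩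
    ιℤ (+ q) * - 1#                          ∎))
    where
    tr-conjugate : ∀ m → ¬ (+ p ∣ℤ m) → tr (ζ^ m) ≈ tr ζ
    tr-conjugate m p∤m = let e , m≡rᵉ = proj₂ root m p∤m in begin
      tr (ζ^ m)                   ≈⟨ tr-cong (ζ^-cong m≡rᵉ) ⟩
      tr (ζ^ (r ℤ.^ e))           ≡⟨ ≡.cong (tr ∘ ζ^_) (ℤ.*-identityˡ (r ℤ.^ e)) ⟨
      tr (ζ^ (1ℤ ℤ.* r ℤ.^ e))    ≈⟨ tr-cong (σ^-ζ^ e 1ℤ) ⟨
      tr (σ^ e ζ)                 ≈⟨ tr-σ^ e ζ ⟩
      tr ζ                        ∎

    ∑ζ⁺ : sum {q} (λ i → ζ^ (+ suc (toℕ i))) ≈ - 1#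
    ∑ζ⁺ = begin
      S                           ≈⟨ expand 1# S ⟩
      - 1# + (1# + S)             ≈⟨ +-congˡ (+-congʳ ζ^0) ⟨
      - 1# + (ζ^ 0ℤ + S)          ≈⟨ +-congˡ ∑ζ ⟩
      - 1# + 0#                   ≈⟨ +-identityʳ _ ⟩
      - 1#                        ∎
      where
      S = sum {q} λ i → ζ^ (+ suc (toℕ i))
      open Solver
      expand : ∀ a b → b ≈ - a + (a + b)
      expand = solve 2 (λ a b → b := :- a :+ (a :+ b)) refl

  [p∣_] : ℤ → ℤ
  [p∣ m ] = if does (p ℕ.∣? ∣ m ∣) then 1ℤ else 0ℤ

  tr-ζ^-formula : ∀ m → tr (ζ^ m) ≈ ιℤ (+ p ℤ.* [p∣ m ] ℤ.- 1ℤ)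
  tr-ζ^-formula m with p ℕ.∣? ∣ m ∣
  ... | yes p∣m = begin
    tr (ζ^ m)                     ≈⟨ tr-cong (ζ^-cong (≡.subst (+ p ∣ℤ_) (≡.sym (ℤ.+-identityʳ m)) p∣m)) ⟩
    tr (ζ^ 0ℤ)                    ≈⟨ tr-cong ζ^0 ⟩
    tr 1#                         ≈⟨ tr-fixed σ.1#-homo ⟩
    ιℤ (+ q) * 1#                 ≈⟨ *-identityʳ _ ⟩
    ιℤ (+ q)                      ≡⟨ ≡.cong ιℤ (≡.trans (simplify (+ q)) (≡.cong (λ e → + p ℤ.* e ℤ.- 1ℤ) (≡.sym 1≡))) ⟩
    ιℤ (+ p ℤ.* [p∣ m ] ℤ.- 1ℤ)   ∎
    where
    1≡ : [p∣ m ] ≡ 1ℤ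
    1≡ = ≡.cong (if_then 1ℤ else 0ℤ) (dec-true (p ℕ.∣? ∣ m ∣) p∣m)

    simplify : ∀ q → q ≡ (1ℤ ℤ.+ q) ℤ.* 1ℤ ℤ.- 1ℤ
    simplify = ℤ-solve-∀
  ... | no p∤m = begin
    tr (ζ^ m)                     ≈⟨ tr-ζ^ m p∤m ⟩
    - 1#                          ≈⟨ trans (ιℤ-neg 1ℤ) (-‿cong ι.1#-homo) ⟨
    ιℤ (ℤ.- 1ℤ)                   ≡⟨ ≡.cong ιℤ (≡.trans (simplify (+ p)) (≡.cong (λ e → + p ℤ.* e ℤ.- 1ℤ) (≡.sym 0≡))) ⟩
    ιℤ (+ p ℤ.* [p∣ m ] ℤ.- 1ℤ)   ∎
    where
    0≡ : [p∣ m ] ≡ 0ℤ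
    0≡ = ≡.cong (if_then 1ℤ else 0ℤ) (dec-false (p ℕ.∣? ∣ m ∣) p∤m)

    simplify : ∀ p → ℤ.- 1ℤ ≡ p ℤ.* 0ℤ ℤ.- 1ℤ
    simplify = ℤ-solve-∀

  sum-- : ∀ {n} (f g : Vector Carrier n) → sum (λ i → f i - g i) ≈ sum f - sum g
  sum-- {zero}  f g = sym (-‿inverseʳ 0#)
  sum-- {suc n} f g = trans (+-congˡ (sum-- (f ∘ Fin.suc) (g ∘ Fin.suc)))
    (solve 4 (λ a b c d → a :- b :+ (c :- d) := a :+ c :- (b :+ d)) refl _ _ _ _)
    where open Solver

  tr-- : ∀ x y → tr (x - y) ≈ tr x - tr y
  tr-- x y = trans +-distrib (+-congˡ (tr-neg y))
    where
    +-distrib : tr (x - y) ≈ tr x + tr (- y)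
    +-distrib = trans (sum-cong-≋ {q} λ k → σ^.+-homo (toℕ k) x (- y))
      (∑-distrib-+ {q} (λ k → σ^ (toℕ k) x) (λ k → σ^ (toℕ k) (- y)))

  -- By `tr-ζ^-formula` each trace is p times an indicator minus 1. Multiplying by ζᵃ - 1 makes
  -- these -1 cancel, so a factor p appears in every term.
  tr-*[ζ^-1] : ∀ f a → tr (combination f * (ζ^ a - 1#)) ≈
    sum λ i → ι (f i) * ιℤ (+ p ℤ.* ([p∣ + toℕ i ℤ.+ a ] ℤ.- [p∣ + toℕ i ]))
  tr-*[ζ^-1] f a = begin
    tr (combination f * (ζ^ a - 1#))
      ≈⟨ tr-cong (trans (*-distribʳ-sum (ζ^ a - 1#) (λ i → ι (f i) * ζ^ (+ toℕ i)))
           (sum-cong-≋ λ i → trans (expand (ι (f i)) (ζ^ (+ toℕ i)) (ζ^ a))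
             (*-congˡ (+-congʳ (sym (ζ^-+ (+ toℕ i) a)))))) ⟩
    tr (sum λ i → ι (f i) * (ζ^ (+ toℕ i ℤ.+ a) - ζ^ (+ toℕ i)))
      ≈⟨ tr-sum (λ i → ι (f i) * (ζ^ (+ toℕ i ℤ.+ a) - ζ^ (+ toℕ i))) ⟩
    (sum λ i → tr (ι (f i) * (ζ^ (+ toℕ i ℤ.+ a) - ζ^ (+ toℕ i))))
      ≈⟨ sum-cong-≋ (λ i → trans (tr-ι* (f i) (ζ^ (+ toℕ i ℤ.+ a) - ζ^ (+ toℕ i))) (*-congˡ (difference (+ toℕ i ℤ.+ a) (+ toℕ i)))) ⟩
    (sum λ i → ι (f i) * ιℤ (+ p ℤ.* ([p∣ + toℕ i ℤ.+ a ] ℤ.- [p∣ + toℕ i ]))) ∎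
    where
    expand : ∀ c x y → c * x * (y - 1#) ≈ c * (x * y - x)
    expand = solve 3 (λ c x y → c :* x :* (y :- con 1ℤ) := c :* (x :* y :- x)) refl
      where open Solver

    subtract : ∀ p a b → (p ℤ.* a ℤ.- 1ℤ) ℤ.+ ℤ.- (p ℤ.* b ℤ.- 1ℤ) ≡ p ℤ.* (a ℤ.- b)
    subtract = ℤ-solve-∀

    difference : ∀ a b → tr (ζ^ a - ζ^ b) ≈ ιℤ (+ p ℤ.* ([p∣ a ] ℤ.- [p∣ b ]))
    difference a b = begin
      tr (ζ^ a - ζ^ b)                                                  ≈⟨ tr-- (ζ^ a) (ζ^ b) ⟩
      tr (ζ^ a) - tr (ζ^ b)                                             ≈⟨ +-cong (tr-ζ^-formula a) (-‿cong (tr-ζ^-formula b)) ⟩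
      ιℤ (+ p ℤ.* [p∣ a ] ℤ.- 1ℤ) - ιℤ (+ p ℤ.* [p∣ b ] ℤ.- 1ℤ)         ≈⟨ +-congˡ (ιℤ-neg (+ p ℤ.* [p∣ b ] ℤ.- 1ℤ)) ⟨
      ιℤ (+ p ℤ.* [p∣ a ] ℤ.- 1ℤ) + ιℤ (ℤ.- (+ p ℤ.* [p∣ b ] ℤ.- 1ℤ))   ≈⟨ ιℤ-+ (+ p ℤ.* [p∣ a ] ℤ.- 1ℤ) (ℤ.- (+ p ℤ.* [p∣ b ] ℤ.- 1ℤ)) ⟨
      ιℤ ((+ p ℤ.* [p∣ a ] ℤ.- 1ℤ) ℤ.+ ℤ.- (+ p ℤ.* [p∣ b ] ℤ.- 1ℤ))    ≡⟨ ≡.cong ιℤ (subtract (+ p) [p∣ a ] [p∣ b ]) ⟩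
      ιℤ (+ p ℤ.* ([p∣ a ] ℤ.- [p∣ b ]))                                ∎

  p∣tr-*[ζ^-1] : ∀ {h} → ℤζ h → ∀ a → ∃ λ t → tr (h * (ζ^ a - 1#)) ≈ ιℤ (+ p ℤ.* t)
  p∣tr-*[ζ^-1] {h} (g , h≈g) a =
    let t , eq = +Sum.sum-closed (λ y → ∃ λ t → y ≈ ιℤ (+ p ℤ.* t)) zero-case plus-case
                   (λ i → ιℤ (g i) * ιℤ (+ p ℤ.* c i))
                   (λ i → g i ℤ.* c i , trans (sym (ιℤ-* (g i) (+ p ℤ.* c i))) (reflexive (≡.cong ιℤ (swap (g i) (+ p) (c i)))))
    in t , trans (tr-cong (*-congʳ h≈g)) (trans (tr-*[ζ^-1] (λ i → g i / 1) a) eq)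
    where
    c : Fin p → ℤ
    c i = [p∣ + toℕ i ℤ.+ a ] ℤ.- [p∣ + toℕ i ]

    swap : ∀ g p c → g ℤ.* (p ℤ.* c) ≡ p ℤ.* (g ℤ.* c)
    swap = ℤ-solve-∀

    zero-case : ∃ λ t → 0# ≈ ιℤ (+ p ℤ.* t)
    zero-case = 0ℤ , trans (sym ι.0#-homo) (reflexive (≡.cong ιℤ (≡.sym (ℤ.*-zeroʳ (+ p)))))

    plus-case : ∀ {x y} → (∃ λ t → x ≈ ιℤ (+ p ℤ.* t)) → (∃ λ t → y ≈ ιℤ (+ p ℤ.* t)) →
                ∃ λ t → x + y ≈ ιℤ (+ p ℤ.* t)
    plus-case (s , x≈s) (t , y≈t) = s ℤ.+ t , trans (+-cong x≈s y≈t)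
      (trans (sym (ιℤ-+ (+ p ℤ.* s) (+ p ℤ.* t))) (reflexive (≡.cong ιℤ (≡.sym (ℤ.*-distribˡ-+ (+ p) s t)))))

  [p∣i-j]≡δ : ∀ (i j : Fin p) → [p∣ + toℕ i ℤ.- + toℕ j ] ≡ δ j i
  [p∣i-j]≡δ i j with i Fin.≟ j
  ... | yes ≡.refl = ≡.cong (if_then 1ℤ else 0ℤ)
    (dec-true (p ℕ.∣? ∣ + toℕ i ℤ.- + toℕ i ∣) (mod-refl (+ toℕ i)))
  ... | no i≢j = ≡.cong (if_then 1ℤ else 0ℤ) (dec-false (p ℕ.∣? ∣ + toℕ i ℤ.- + toℕ j ∣)
    (i≢j ∘ Fin.toℕ-injective ∘ residue-unique (Fin.toℕ<n i) (Fin.toℕ<n j)))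

  -- The choice a = -j turns the two indicators into those of i = j and i = 0: up to p, the elements
  -- ζ⁻ʲ - 1 are dual under the trace form to the differences of coordinates.
  tr-coordinate : ∀ f j → tr (combination f * (ζ^ (ℤ.- + toℕ j) - 1#)) ≈ ιℤ (+ p) * (ι (f j) - ι (f Fin.zero))
  tr-coordinate f j = begin
    tr (combination f * (ζ^ (ℤ.- + toℕ j) - 1#))
      ≈⟨ tr-*[ζ^-1] f (ℤ.- + toℕ j) ⟩
    (sum λ i → ι (f i) * ιℤ (+ p ℤ.* ([p∣ + toℕ i ℤ.- + toℕ j ] ℤ.- [p∣ + toℕ i ])))
      ≈⟨ sum-cong-≋ {p} (λ i → trans
           (*-congˡ (trans (reflexive (≡.cong₂ (λ a b → ιℤ (+ p ℤ.* (a ℤ.- b))) ([p∣i-j]≡δ i j) ([p∣i]≡δ i)))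
             (trans (ιℤ-* (+ p) (δ j i ℤ.- δ Fin.zero i)) (*-congˡ (trans (ιℤ-+ (δ j i) (ℤ.- δ Fin.zero i)) (+-congˡ (ιℤ-neg (δ Fin.zero i))))))))
           (rearrange (ι (f i)) (ιℤ (+ p)) (ιℤ (δ j i)) (ιℤ (δ Fin.zero i)))) ⟩
    (sum λ i → ιℤ (+ p) * (ιℤ (δ j i) * ι (f i) - ιℤ (δ Fin.zero i) * ι (f i)))
      ≈⟨ *-distribˡ-sum {p} (ιℤ (+ p)) (λ i → ιℤ (δ j i) * ι (f i) - ιℤ (δ Fin.zero i) * ι (f i)) ⟨
    ιℤ (+ p) * (sum λ i → ιℤ (δ j i) * ι (f i) - ιℤ (δ Fin.zero i) * ι (f i))
      ≈⟨ *-congˡ (sum-- (λ i → ιℤ (δ j i) * ι (f i)) (λ i → ιℤ (δ Fin.zero i) * ι (f i))) ⟩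
    ιℤ (+ p) * (sum (λ i → ιℤ (δ j i) * ι (f i)) - sum (λ i → ιℤ (δ Fin.zero i) * ι (f i)))
      ≈⟨ *-congˡ (+-cong (sum-δ j (ι ∘ f)) (-‿cong (sum-δ Fin.zero (ι ∘ f)))) ⟩
    ιℤ (+ p) * (ι (f j) - ι (f Fin.zero)) ∎
    where
    [p∣i]≡δ : ∀ i → [p∣ + toℕ i ] ≡ δ Fin.zero i
    [p∣i]≡δ i = ≡.trans (≡.cong [p∣_] (≡.sym (ℤ.+-identityʳ (+ toℕ i)))) ([p∣i-j]≡δ i Fin.zero)

    rearrange : ∀ f p a b → f * (p * (a - b)) ≈ p * (a * f - b * f)
    rearrange = solve 4 (λ f p a b → f :* (p :* (a :- b)) := p :* (a :* f :- b :* f)) refl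
      where open Solver

  IsRational : Carrier → Set
  IsRational y = ∃ λ a → y ≈ ι a

  rational-sum : ∀ {n} (f : Vector Carrier n) → (∀ i → IsRational (f i)) → IsRational (sum f)
  rational-sum = +Sum.sum-closed IsRational (0ℚ , sym ι.0#-homo)
    (λ (a , x≈a) (b , y≈b) → a ℚ.+ b , trans (+-cong x≈a y≈b) (sym (ι.+-homo a b)))

  -- A fixed `y` satisfies q y = tr(y), and the trace of a rational combination of powers of ζ is
  -- rational; dividing by q gives the witness.
  fixed⇒rational : ∀ {y} → σ y ≈ y → IsRational y
  fixed⇒rational {y} σy≈y =
    let f , y≈f = coordinates y
        a , tr≈a = rational-sum (λ i → ι (f i) * tr (ζ^ (+ toℕ i)))
          (λ i → f i ℚ.* ((+ p ℤ.* [p∣ + toℕ i ] ℤ.- 1ℤ) / 1) , trans (*-congˡ (tr-ζ^-formula (+ toℕ i)))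
            (sym (ι.*-homo (f i) ((+ p ℤ.* [p∣ + toℕ i ] ℤ.- 1ℤ) / 1))))
    in (ℚ.1/ q′) ℚ.* a , ι-cancel q′ q′≢0 (begin
      ι q′ * y                               ≈⟨ tr-fixed σy≈y ⟨
      tr y                                   ≈⟨ tr-cong y≈f ⟩
      tr (combination f)                     ≈⟨ tr-sum (λ i → ι (f i) * ζ^ (+ toℕ i)) ⟩
      (sum λ i → tr (ι (f i) * ζ^ (+ toℕ i)))  ≈⟨ sum-cong-≋ {p} (λ i → tr-ι* (f i) (ζ^ (+ toℕ i))) ⟩
      (sum λ i → ι (f i) * tr (ζ^ (+ toℕ i)))  ≈⟨ tr≈a ⟩
      ι a                                    ≈⟨ ι.⟦⟧-cong (ℚ.*-identityˡ a) ⟨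
      ι (1ℚ ℚ.* a)                           ≈⟨ ι.⟦⟧-cong (≡.cong (ℚ._* a) (ℚ.*-inverseʳ q′)) ⟨
      ι (q′ ℚ.* ℚ.1/ q′ ℚ.* a)               ≈⟨ ι.⟦⟧-cong (ℚ.*-assoc q′ (ℚ.1/ q′) a) ⟩
      ι (q′ ℚ.* (ℚ.1/ q′ ℚ.* a))             ≈⟨ ι.*-homo q′ _ ⟩
      ι q′ * ι (ℚ.1/ q′ ℚ.* a)               ∎)
    where
    q′ = + q / 1

    q′≢0 : q′ ≢ 0ℚ
    q′≢0 = +q≢0 ∘ /1-injective (+ q) 0ℤ

    instance _ = ℚ.≢-nonZero q′≢0

  fixed⇒integer : ∀ {y} → σ y ≈ y → ℤζ y → ∃ λ c → y ≈ ιℤ c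
  fixed⇒integer σy≈y y∈ =
    let a , y≈a = fixed⇒rational σy≈y
        c , a≡c = ℤζ-ι⇒isInteger a (ℤζ-resp y≈a y∈)
    in c , trans y≈a (ι.⟦⟧-cong a≡c)

  -- The norm to ℚ, and divisibility by ζ - 1.

  norm : Carrier → Carrier
  norm y = product {q} λ k → σ^ (toℕ k) y

  norm-* : ∀ x y → norm (x * y) ≈ norm x * norm y
  norm-* x y = trans (product-cong {q} λ k → σ^.*-homo (toℕ k) x y)
    (product-distrib-* {q} (λ k → σ^ (toℕ k) x) (λ k → σ^ (toℕ k) y))

  σ-norm : ∀ y → σ (norm y) ≈ norm y
  σ-norm y = trans (σ^-product 1 {q} (λ k → σ^ (toℕ k) y)) (*Sum.sum-cycle q (λ k → σ^ k y) (σ^q≈id y))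

  norm-fixed : ∀ {y} → σ y ≈ y → norm y ≈ y ^ q
  norm-fixed {y} σy≈y = trans (product-cong {q} λ k → fixed-σ^ σy≈y (toℕ k)) (product-replicate q)

  -- The norm is an integer M and equals h (ζ - 1), with h in ℤ[ζ] the product of the other
  -- conjugates. Its trace is q M, but also a multiple of p by `p∣tr-*[ζ^-1]`; since p does not
  -- divide q = p - 1, it divides M.
  p∣norm[ζ-1] : ∃ λ M → norm (ζ - 1#) ≈ ιℤ M × + p ∣ℤ M
  p∣norm[ζ-1] = M , N≈M , [ (λ p∣q → contradiction p∣q p∤q) , (λ p∣M → p∣M) ]′ (euclid (+ q) M p∣qM)
    where
    ζ-1∈ : ℤζ (ζ - 1#)
    ζ-1∈ = ℤζ-+ (ℤζ-ζ^ 1ℤ) (ℤζ-neg ℤζ-1)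

    N-integer = fixed⇒integer (σ-norm (ζ - 1#)) (ℤζ-product {q} _ λ k → ℤζ-σ^ (toℕ k) ζ-1∈)
    M = proj₁ N-integer
    N≈M = proj₂ N-integer

    -- Stated for any nonempty product, so that the first factor σ⁰(ζ - 1) = ζ - 1 can be separated
    -- without a successor form of `q`.
    split : ∀ n → n ≢ 0 → (f : ℕ → Carrier) → (∀ k → ℤζ (f k)) →
            ∃ λ h → ℤζ h × product {n} (f ∘ toℕ) ≈ h * f 0
    split zero    n≢0 f f∈ = contradiction ≡.refl n≢0
    split (suc n) n≢0 f f∈ = product {n} (f ∘ suc ∘ toℕ) , ℤζ-product {n} _ (f∈ ∘ suc ∘ toℕ) , *-comm _ _

    p∤q : ¬ (+ p ∣ℤ + q)
    p∤q p∣q = ℕ.<⇒≱ (ℕ.n<1+n q) (ℕ.∣⇒≤ {{ℕ.≢-nonZero q≢0}} p∣q)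

    factorization = split q q≢0 (λ k → σ^ k (ζ - 1#)) (λ k → ℤζ-σ^ k ζ-1∈)
    h = proj₁ factorization

    tr-h = p∣tr-*[ζ^-1] (proj₁ (proj₂ factorization)) 1ℤ
    t = proj₁ tr-h

    qM≡pt : ιℤ (+ q ℤ.* M) ≈ ιℤ (+ p ℤ.* t)
    qM≡pt = begin
      ιℤ (+ q ℤ.* M)                  ≈⟨ ιℤ-* (+ q) M ⟩
      ιℤ (+ q) * ιℤ M                 ≈⟨ *-congˡ N≈M ⟨
      ιℤ (+ q) * norm (ζ - 1#)        ≈⟨ tr-fixed (σ-norm (ζ - 1#)) ⟨
      tr (norm (ζ - 1#))              ≈⟨ tr-cong (proj₂ (proj₂ factorization)) ⟩
      tr (h * (ζ - 1#))               ≈⟨ proj₂ tr-h ⟩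
      ιℤ (+ p ℤ.* t)                  ∎

    p∣qM : + p ∣ℤ + q ℤ.* M
    p∣qM = ∣⇒∣ᵤ {+ p} {+ q ℤ.* M}
      (divides t (≡.trans (ιℤ-injective (+ q ℤ.* M) (+ p ℤ.* t) qM≡pt) (ℤ.*-comm (+ p) t)))

  -- The cofactor is the geometric sum 1 + ζ + ... + ζⁱ⁻¹ in Horner form, for i the residue of `m`;
  -- hence negative exponents are covered as well.
  ζ-1∣ζ^-1 : ∀ m → ∃ λ e → ℤζ e × ζ^ m - 1# ≈ (ζ - 1#) * e
  ζ-1∣ζ^-1 m =
    let i , m≡i = residue m
        e , e∈ , eq = natural (toℕ i)
    in e , e∈ , trans (+-congʳ (ζ^-cong m≡i)) eq
    where
    natural : ∀ n → ∃ λ e → ℤζ e × ζ^ (+ n) - 1# ≈ (ζ - 1#) * e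
    natural zero    = 0# , ℤζ-0 , trans (+-congʳ ζ^0) (trans (-‿inverseʳ 1#) (sym (zeroʳ _)))
    natural (suc n) = let e , e∈ , eq = natural n in
      1# + ζ * e , ℤζ-+ ℤζ-1 (ℤζ-* (ℤζ-ζ^ 1ℤ) e∈) , (begin
        ζ^ (1ℤ ℤ.+ + n) - 1#                  ≈⟨ +-congʳ (ζ^-+ 1ℤ (+ n)) ⟩
        ζ * ζ^ (+ n) - 1#                     ≈⟨ collect ζ (ζ^ (+ n)) ⟩
        (ζ - 1#) + ζ * (ζ^ (+ n) - 1#)        ≈⟨ +-congˡ (*-congˡ eq) ⟩
        (ζ - 1#) + ζ * ((ζ - 1#) * e)         ≈⟨ factor ζ e ⟩
        (ζ - 1#) * (1# + ζ * e)               ∎)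
      where
      open Solver
      collect : ∀ a b → a * b - 1# ≈ (a - 1#) + a * (b - 1#)
      collect = solve 2 (λ a b → a :* b :- con 1ℤ := (a :- con 1ℤ) :+ a :* (b :- con 1ℤ)) refl
      factor : ∀ a e → (a - 1#) + a * ((a - 1#) * e) ≈ (a - 1#) * (1# + a * e)
      factor = solve 2 (λ a e → (a :- con 1ℤ) :+ a :* ((a :- con 1ℤ) :* e) := (a :- con 1ℤ) :* (con 1ℤ :+ a :* e)) refl

  -- Integral elements of ℚ(ζ) and ℤ[ζ].

  -- Complete integrality over ℤ[ζ], with the common denominator taken in ℤ. One `D` has to serve
  -- all exponents.
  AlmostIntegral : Carrier → Set
  AlmostIntegral y = ∃ λ D → D ≢ 0ℤ × (∀ k → ℤζ (ιℤ D * y ^ k))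

  almostIntegral-resp : ∀ {x y} → x ≈ y → AlmostIntegral x → AlmostIntegral y
  almostIntegral-resp x≈y (D , D≢0 , D∈) = D , D≢0 , λ k → ℤζ-resp (*-congˡ (^-congˡ k x≈y)) (D∈ k)

  almostIntegral-ℤζ : ∀ {y} → ℤζ y → AlmostIntegral y
  almostIntegral-ℤζ y∈ = 1ℤ , (λ ()) , λ k → ℤζ-ιℤ* 1ℤ (ℤζ-^ k y∈)

  almostIntegral-* : ∀ {x y} → AlmostIntegral x → AlmostIntegral y → AlmostIntegral (x * y)
  almostIntegral-* {x} {y} (C , C≢0 , C∈) (D , D≢0 , D∈) = C ℤ.* D , ≢0-* C≢0 D≢0 , λ k →
    ℤζ-resp (sym (trans (*-cong (ιℤ-* C D) (^-distrib-* x y k)) (interchange (ιℤ C) (ιℤ D) (x ^ k) (y ^ k))))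
      (ℤζ-* (C∈ k) (D∈ k))
    where
    open Solver
    interchange : ∀ a b c d → a * b * (c * d) ≈ a * c * (b * d)
    interchange = solve 4 (λ a b c d → a :* b :* (c :* d) := a :* c :* (b :* d)) refl

  -- In every monomial xⁱ yʲ of (x + y)ᵏ the constant `C` takes care of xⁱ and `D` of yʲ. `bounded`
  -- expands one factor x + y at a time, accumulating the exponents in `i` and `j`, so no binomial
  -- coefficients arise.
  almostIntegral-+ : ∀ {x y} → AlmostIntegral x → AlmostIntegral y → AlmostIntegral (x + y)
  almostIntegral-+ {x} {y} (C , C≢0 , C∈) (D , D≢0 , D∈) = C ℤ.* D , ≢0-* C≢0 D≢0 , λ k →
    ℤζ-resp (trans (unit (ιℤ C) (ιℤ D) ((x + y) ^ k)) (*-congʳ (sym (ιℤ-* C D)))) (bounded k 0 0)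
    where
    open Solver
    unit : ∀ c d s → c * 1# * (d * 1#) * s ≈ c * d * s
    unit = solve 3 (λ c d s → c :* con 1ℤ :* (d :* con 1ℤ) :* s := c :* d :* s) refl

    step : ∀ c a d b x y s → c * (x * a) * (d * b) * s + c * a * (d * (y * b)) * s ≈ c * a * (d * b) * ((x + y) * s)
    step = solve 7 (λ c a d b x y s → c :* (x :* a) :* (d :* b) :* s :+ c :* a :* (d :* (y :* b)) :* s
      := c :* a :* (d :* b) :* ((x :+ y) :* s)) refl

    bounded : ∀ k i j → ℤζ (ιℤ C * x ^ i * (ιℤ D * y ^ j) * (x + y) ^ k)
    bounded zero    i j = ℤζ-resp (sym (*-identityʳ _)) (ℤζ-* (C∈ i) (D∈ j))
    bounded (suc k) i j = ℤζ-resp (step (ιℤ C) (x ^ i) (ιℤ D) (y ^ j) x y ((x + y) ^ k))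
      (ℤζ-+ (bounded k (suc i) j) (bounded k i (suc j)))

  almostIntegral-sum : ∀ {n} (f : Vector Carrier n) → (∀ i → AlmostIntegral (f i)) → AlmostIntegral (sum f)
  almostIntegral-sum = +Sum.sum-closed AlmostIntegral (almostIntegral-ℤζ ℤζ-0) almostIntegral-+

  almostIntegral-product : ∀ {n} (f : Vector Carrier n) → (∀ i → AlmostIntegral (f i)) → AlmostIntegral (product f)
  almostIntegral-product = *Sum.sum-closed AlmostIntegral (almostIntegral-ℤζ ℤζ-1) almostIntegral-*

  almostIntegral-σ^ : ∀ m {y} → AlmostIntegral y → AlmostIntegral (σ^ m y)
  almostIntegral-σ^ m {y} (D , D≢0 , D∈) = D , D≢0 , λ k →
    ℤζ-resp (trans (σ^.*-homo m (ιℤ D) (y ^ k)) (*-cong (fixes-ι (σ^-homo m) (D / 1)) (σ^-^ k)))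
      (ℤζ-σ^ m (D∈ k))
    where
    σ^-^ : ∀ k → σ^ m (y ^ k) ≈ σ^ m y ^ k
    σ^-^ zero    = σ^.1#-homo m
    σ^-^ (suc k) = trans (σ^.*-homo m y (y ^ k)) (*-congˡ (σ^-^ k))

  ι-^ : ∀ a k → ι (a ^ℚ k) ≈ ι a ^ k
  ι-^ a zero    = ι.1#-homo
  ι-^ a (suc k) = trans (ι.*-homo a (a ^ℚ k)) (*-congˡ (ι-^ a k))

  almostIntegral-ι⇒isInteger : ∀ a → AlmostIntegral (ι a) → IsInteger a
  almostIntegral-ι⇒isInteger a (D , D≢0 , D∈) = almostInteger⇒isInteger a D {{ℤ.≢-nonZero D≢0}} λ k →
    ℤζ-ι⇒isInteger ((D / 1) ℚ.* (a ^ℚ k))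
      (ℤζ-resp (sym (trans (ι.*-homo (D / 1) (a ^ℚ k)) (*-congˡ (ι-^ a k)))) (D∈ k))

  IntegralElement : Carrier → Set
  IntegralElement y = ∃ λ d → ∃ λ (a : Vector ℤ d) → y ^ d + sum (λ i → ιℤ (a i) * y ^ toℕ i) ≈ 0#

  integral⇒almostIntegral : ∀ {y} → IntegralElement y → AlmostIntegral y
  -- With N a common denominator of the coordinates of y, the constant is Nᵈ. For k ≤ d it contains
  -- Nᵏ, and (N y)ᵏ lies in ℤ[ζ]; for k ≥ d the monic relation rewrites yᵏ through lower powers,
  -- hence the strong induction.
  integral⇒almostIntegral {y} (d , a , relation) = N ℤ.^ d , Nᵈ≢0 , <-rec _ bounded
    where
    f = proj₁ (coordinates y)
    N = proj₁ (commonDenominator f)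

    N≢0 : N ≢ 0ℤ
    N≢0 = proj₁ (proj₂ (commonDenominator f))

    Nᵈ≢0 : N ℤ.^ d ≢ 0ℤ
    Nᵈ≢0 = N≢0 ∘ ℤ.i^n≡0⇒i≡0 N d

    Ny∈ : ℤζ (ιℤ N * y)
    Ny∈ = (λ i → proj₁ (proj₂ (proj₂ (commonDenominator f)) i)) ,
      trans (*-congˡ (proj₂ (coordinates y))) (trans (sym (combination-* (N / 1) f))
        (combination-cong λ i → proj₂ (proj₂ (proj₂ (commonDenominator f)) i)))

    ιℤ-^ : ∀ k → ιℤ (N ℤ.^ k) ≈ ιℤ N ^ k
    ιℤ-^ k = trans (ι.⟦⟧-cong (/1-homo-^ N k)) (ι-^ (N / 1) k)

    small : ∀ {k} → k ℕ.≤ d → ℤζ (ιℤ (N ℤ.^ d) * y ^ k)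
    small {k} k≤d = ℤζ-resp (begin
        ιℤ (N ℤ.^ e) * (ιℤ N * y) ^ k               ≈⟨ *-congˡ (^-distrib-* (ιℤ N) y k) ⟩
        ιℤ (N ℤ.^ e) * (ιℤ N ^ k * y ^ k)           ≈⟨ *-assoc _ _ _ ⟨
        ιℤ (N ℤ.^ e) * ιℤ N ^ k * y ^ k             ≈⟨ *-congʳ (*-congˡ (ιℤ-^ k)) ⟨
        ιℤ (N ℤ.^ e) * ιℤ (N ℤ.^ k) * y ^ k         ≈⟨ *-congʳ (ιℤ-* (N ℤ.^ e) (N ℤ.^ k)) ⟨
        ιℤ (N ℤ.^ e ℤ.* N ℤ.^ k) * y ^ k            ≡⟨ ≡.cong (λ c → ιℤ c * y ^ k) (ℤ.^-distribˡ-+-* N e k) ⟨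
        ιℤ (N ℤ.^ (e ℕ.+ k)) * y ^ k                ≡⟨ ≡.cong (λ m → ιℤ (N ℤ.^ m) * y ^ k) (ℕ.m∸n+n≡m k≤d) ⟩
        ιℤ (N ℤ.^ d) * y ^ k                        ∎)
      (ℤζ-ιℤ* (N ℤ.^ e) (ℤζ-^ k Ny∈))
      where
      e = d ℕ.∸ k

    large : ∀ e → (∀ i → i ℕ.< d ℕ.+ e → ℤζ (ιℤ (N ℤ.^ d) * y ^ i)) → ℤζ (ιℤ (N ℤ.^ d) * y ^ (d ℕ.+ e))
    large e below = ℤζ-resp (begin
        - sum (λ i → ιℤ (a i) * (D * y ^ (toℕ i ℕ.+ e)))   ≈⟨ -‿cong (sum-cong-≋ {d} λ i → trans
                                                                (*-congˡ (*-congˡ (^-homo-* y (toℕ i) e)))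
                                                                (rearrange (ιℤ (a i)) D (y ^ toℕ i) (y ^ e))) ⟩
        - sum (λ i → D * y ^ e * (ιℤ (a i) * y ^ toℕ i))   ≈⟨ -‿cong (*-distribˡ-sum {d} (D * y ^ e) (λ i → ιℤ (a i) * y ^ toℕ i)) ⟨
        - (D * y ^ e * R)                                  ≈⟨ +-identityˡ _ ⟨
        0# - D * y ^ e * R                                 ≈⟨ +-congʳ (trans (*-congˡ relation) (zeroʳ _)) ⟨
        D * y ^ e * (y ^ d + R) - D * y ^ e * R            ≈⟨ cancel D (y ^ e) (y ^ d) R ⟩
        D * (y ^ d * y ^ e)                                ≈⟨ *-congˡ (^-homo-* y d e) ⟨
        D * y ^ (d ℕ.+ e)                                  ∎)
      (ℤζ-neg (ℤζ-sum {d} _ λ i → ℤζ-ιℤ* (a i) (below (toℕ i ℕ.+ e) (ℕ.+-monoˡ-< e (Fin.toℕ<n i)))))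
      where
      D = ιℤ (N ℤ.^ d)
      R = sum λ i → ιℤ (a i) * y ^ toℕ i
      open Solver
      rearrange : ∀ a d x z → a * (d * (x * z)) ≈ d * z * (a * x)
      rearrange = solve 4 (λ a d x z → a :* (d :* (x :* z)) := d :* z :* (a :* x)) refl
      cancel : ∀ d z x r → d * z * (x + r) - d * z * r ≈ d * (x * z)
      cancel = solve 4 (λ d z x r → d :* z :* (x :+ r) :- d :* z :* r := d :* (x :* z)) refl

    bounded : ∀ k → (∀ {i} → i ℕ.< k → ℤζ (ιℤ (N ℤ.^ d) * y ^ i)) → ℤζ (ιℤ (N ℤ.^ d) * y ^ k)
    bounded k below with ℕ.≤-total k d
    ... | inj₁ k≤d = small k≤d
    ... | inj₂ d≤k = ≡.subst (λ m → ℤζ (ιℤ (N ℤ.^ d) * y ^ m)) (ℕ.m+[n∸m]≡n d≤k)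
      (large (k ℕ.∸ d) λ i i<d+e → below (≡.subst (i ℕ.<_) (ℕ.m+[n∸m]≡n d≤k) i<d+e))

  -- The differences of coordinates of y are, up to the factor p, traces of multiples of
  -- ζ − 1 by an almost integral element; the norm of ζ − 1 supplies the factor p.

  coordinate-difference : ∀ {y} f → y ≈ combination f → AlmostIntegral y → ∀ j → IsInteger (f j ℚ.- f Fin.zero)
  coordinate-difference {y} f y≈f y∈ j = s , ι-injective (ιℤ-cancel (+ p) (λ ()) (begin
      ιℤ (+ p) * ι (f j ℚ.- f Fin.zero)          ≈⟨ T≈p[fⱼ-f₀] ⟨
      T                                          ≈⟨ T≈τ ⟩
      ιℤ τ                                       ≡⟨ ≡.cong ιℤ (≡.trans (ℤ∣._∣_.equality p∣τ) (ℤ.*-comm s (+ p))) ⟩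
      ιℤ (+ p ℤ.* s)                             ≈⟨ ιℤ-* (+ p) s ⟩
      ιℤ (+ p) * ιℤ s                            ∎))
    where
    m = ℤ.- + toℕ j
    T = tr (y * (ζ^ m - 1#))

    T≈p[fⱼ-f₀] : T ≈ ιℤ (+ p) * ι (f j ℚ.- f Fin.zero)
    T≈p[fⱼ-f₀] = trans (tr-cong (*-congʳ y≈f)) (trans (tr-coordinate f j)
      (*-congˡ (sym (trans (ι.+-homo _ _) (+-congˡ (ι.-‿homo (f Fin.zero)))))))

    T-rational : T ≈ ι ((+ p / 1) ℚ.* (f j ℚ.- f Fin.zero))
    T-rational = trans T≈p[fⱼ-f₀] (sym (ι.*-homo (+ p / 1) _))

    e : ℕ → Carrier
    e k = proj₁ (ζ-1∣ζ^-1 (m ℤ.* r ℤ.^ k))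

    b : Carrier
    b = sum {q} λ k → σ^ (toℕ k) y * e (toℕ k)

    b∈ : AlmostIntegral b
    b∈ = almostIntegral-sum {q} _ λ k → almostIntegral-* (almostIntegral-σ^ (toℕ k) y∈)
      (almostIntegral-ℤζ (proj₁ (proj₂ (ζ-1∣ζ^-1 (m ℤ.* r ℤ.^ toℕ k)))))

    T≈[ζ-1]b : T ≈ (ζ - 1#) * b
    T≈[ζ-1]b = trans (sum-cong-≋ {q} (conjugate ∘ toℕ))
      (sym (*-distribˡ-sum {q} (ζ - 1#) (λ k → σ^ (toℕ k) y * e (toℕ k))))
      where
      open Solver
      rearrange : ∀ a b c → a * (b * c) ≈ b * (a * c)
      rearrange = solve 3 (λ a b c → a :* (b :* c) := b :* (a :* c)) refl

      conjugate : ∀ k → σ^ k (y * (ζ^ m - 1#)) ≈ (ζ - 1#) * (σ^ k y * e k)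
      conjugate k = begin
        σ^ k (y * (ζ^ m - 1#))                   ≈⟨ σ^.*-homo k y (ζ^ m - 1#) ⟩
        σ^ k y * σ^ k (ζ^ m - 1#)                ≈⟨ *-congˡ (trans (σ^.+-homo k (ζ^ m) (- 1#))
                                                      (+-cong (σ^-ζ^ k m) (trans (σ^.-‿homo k 1#) (-‿cong (σ^.1#-homo k))))) ⟩
        σ^ k y * (ζ^ (m ℤ.* r ℤ.^ k) - 1#)       ≈⟨ *-congˡ (proj₂ (proj₂ (ζ-1∣ζ^-1 (m ℤ.* r ℤ.^ k)))) ⟩
        σ^ k y * ((ζ - 1#) * e k)                ≈⟨ rearrange _ _ _ ⟩
        (ζ - 1#) * (σ^ k y * e k)                ∎

    T∈ : AlmostIntegral T
    T∈ = almostIntegral-resp (sym T≈[ζ-1]b)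
      (almostIntegral-* (almostIntegral-ℤζ (ℤζ-+ (ℤζ-ζ^ 1ℤ) (ℤζ-neg ℤζ-1))) b∈)

    integer : ∀ {x} → IsRational x → AlmostIntegral x → ∃ λ c → x ≈ ιℤ c
    integer (a , x≈a) x∈ = let c , a≡c = almostIntegral-ι⇒isInteger a (almostIntegral-resp x≈a x∈) in
      c , trans x≈a (ι.⟦⟧-cong a≡c)

    T-integer = integer (_ , T-rational) T∈
    τ = proj₁ T-integer
    T≈τ = proj₂ T-integer

    norm-b-integer = integer (fixed⇒rational (σ-norm b)) (almostIntegral-product {q} _ λ k → almostIntegral-σ^ (toℕ k) b∈)
    B = proj₁ norm-b-integer
    M = proj₁ p∣norm[ζ-1]

    -- Taking norms in τ = (ζ - 1) b: the rational τ has norm τ^q, and the norm of b is an integer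
    -- B, being fixed by σ and almost integral. As p divides M, it divides τ^q and therefore τ.
    τ^q≡MB : τ ℤ.^ q ≡ M ℤ.* B
    τ^q≡MB = ιℤ-injective (τ ℤ.^ q) (M ℤ.* B) (begin
      ιℤ (τ ℤ.^ q)                 ≈⟨ trans (ι.⟦⟧-cong (/1-homo-^ τ q)) (ι-^ (τ / 1) q) ⟩
      ιℤ τ ^ q                     ≈⟨ norm-fixed (fixes-ι σ-homo (τ / 1)) ⟨
      norm (ιℤ τ)                  ≈⟨ product-cong {q} (λ k → σ^.⟦⟧-cong (toℕ k) (trans (sym T≈τ) T≈[ζ-1]b)) ⟩
      norm ((ζ - 1#) * b)          ≈⟨ norm-* (ζ - 1#) b ⟩
      norm (ζ - 1#) * norm b       ≈⟨ *-cong (proj₁ (proj₂ p∣norm[ζ-1])) (proj₂ norm-b-integer) ⟩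
      ιℤ M * ιℤ B                  ≈⟨ ιℤ-* M B ⟨
      ιℤ (M ℤ.* B)                 ∎)

    p∣τ : + p ℤ∣.∣ τ
    p∣τ = ∣ᵤ⇒∣ {+ p} {τ} (∣^⇒∣ τ q (≡.subst (+ p ∣ℤ_) (≡.sym τ^q≡MB)
      (∣⇒∣ᵤ {+ p} {M ℤ.* B} (ℤ∣.∣m⇒∣m*n B (∣ᵤ⇒∣ {+ p} {M} (proj₂ (proj₂ p∣norm[ζ-1])))))))

    s = ℤ∣.quotient p∣τ

  integral⇒ℤζ : ∀ {y} → IntegralElement y → ℤζ y
  integral⇒ℤζ {y} y-integral = (λ i → proj₁ (integer i)) , (begin
      y                                                        ≈⟨ y≈f ⟩
      combination f                                            ≈⟨ +-identityʳ _ ⟨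
      -- The zero is written as -f(0) · (1 + ζ + ... + ζᵖ⁻¹), which replaces each coordinate f(i) by
      -- the integer f(i) - f(0).
      combination f + 0#                                       ≈⟨ +-congˡ (trans (*-congˡ ∑ζ) (zeroʳ _)) ⟨
      combination f + ι (ℚ.- f Fin.zero) * sum {p} (λ i → ζ^ (+ toℕ i))
                                                               ≈⟨ +-congˡ (*-distribˡ-sum {p} (ι (ℚ.- f Fin.zero)) (λ i → ζ^ (+ toℕ i))) ⟩
      combination f + combination (λ _ → ℚ.- f Fin.zero)       ≈⟨ combination-+ f (λ _ → ℚ.- f Fin.zero) ⟨
      combination (λ i → f i ℚ.- f Fin.zero)                   ≈⟨ combination-cong (λ i → proj₂ (integer i)) ⟩
      combination (λ i → proj₁ (integer i) / 1)                ∎)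
    where
    f = proj₁ (coordinates y)
    y≈f = proj₂ (coordinates y)
    integer = coordinate-difference f y≈f (integral⇒almostIntegral y-integral)

  -- Polynomials are given by their coefficient sequences.

  [X-_]*_ : Carrier → (ℕ → Carrier) → ℕ → Carrier
  ([X- v ]* P) zero    = - (v * P 0)
  ([X- v ]* P) (suc i) = P i - v * P (suc i)

  ∏[X-_] : (ℕ → Carrier) → ℕ → ℕ → Carrier
  ∏[X- v ] zero    zero    = 1#
  ∏[X- v ] zero    (suc i) = 0#
  ∏[X- v ] (suc n)         = [X- v 0 ]* ∏[X- v ∘ suc ] n

  [X-]*-cong : ∀ {u v} {P Q : ℕ → Carrier} → u ≈ v → (∀ i → P i ≈ Q i) → ∀ i → ([X- u ]* P) i ≈ ([X- v ]* Q) i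
  [X-]*-cong u≈v P≈Q zero    = -‿cong (*-cong u≈v (P≈Q 0))
  [X-]*-cong u≈v P≈Q (suc i) = +-cong (P≈Q i) (-‿cong (*-cong u≈v (P≈Q (suc i))))

  [X-]*-comm : ∀ u v P i → ([X- u ]* ([X- v ]* P)) i ≈ ([X- v ]* ([X- u ]* P)) i
  [X-]*-comm u v P zero          = solve 3 (λ u v a → :- (u :* (:- (v :* a))) := :- (v :* (:- (u :* a)))) refl u v (P 0)
    where open Solver
  [X-]*-comm u v P (suc zero)    = solve 4 (λ u v a b → :- (v :* a) :- u :* (a :- v :* b) := :- (u :* a) :- v :* (a :- u :* b)) refl
      u v (P 0) (P 1)
    where open Solver
  [X-]*-comm u v P (suc (suc i)) = solve 5 (λ u v a b c → a :- v :* b :- u :* (b :- v :* c) := a :- u :* b :- v :* (b :- u :* c)) refl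
      u v (P i) (P (suc i)) (P (suc (suc i)))
    where open Solver

  ∏[X-]-snoc : ∀ v n i → ∏[X- v ] (suc n) i ≈ ([X- v n ]* ∏[X- v ] n) i
  ∏[X-]-snoc v zero    i = [X-]*-cong refl (λ { zero → refl ; (suc _) → refl }) i
  ∏[X-]-snoc v (suc n) i = trans ([X-]*-cong refl (∏[X-]-snoc (v ∘ suc) n) i)
    ([X-]*-comm (v 0) (v (suc n)) (∏[X- v ∘ suc ] n) i)

  -- Rotating the roots moves the first linear factor to the end, and linear factors commute. Since
  -- σ permutes the conjugates cyclically, this rotation shows that it fixes all coefficients.
  ∏[X-]-cycle : ∀ v n → v n ≈ v 0 → ∀ i → ∏[X- v ∘ suc ] n i ≈ ∏[X- v ] n i
  ∏[X-]-cycle v zero    _     zero    = refl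
  ∏[X-]-cycle v zero    _     (suc i) = refl
  ∏[X-]-cycle v (suc n) vₙ≈v₀ i       = trans (∏[X-]-snoc (v ∘ suc) n i) ([X-]*-cong vₙ≈v₀ (λ _ → refl) i)

  ∏[X-]-degree : ∀ v n i → n ℕ.< i → ∏[X- v ] n i ≈ 0#
  ∏[X-]-degree v zero    (suc i) _         = refl
  ∏[X-]-degree v (suc n) (suc i) (s≤s n<i) = trans
    (+-cong (∏[X-]-degree (v ∘ suc) n i n<i) (-‿cong (trans
      (*-congˡ (∏[X-]-degree (v ∘ suc) n (suc i) (ℕ.m<n⇒m<1+n n<i))) (zeroʳ (v 0)))))
    (-‿inverseʳ 0#)

  ∏[X-]-monic : ∀ v n → ∏[X- v ] n n ≈ 1#
  ∏[X-]-monic v zero    = refl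
  ∏[X-]-monic v (suc n) = trans
    (+-cong (∏[X-]-monic (v ∘ suc) n) (trans (-‿cong (trans
      (*-congˡ (∏[X-]-degree (v ∘ suc) n (suc n) (ℕ.n<1+n n))) (zeroʳ (v 0)))) -0#≈0#))
    (+-identityʳ 1#)

  -- Evaluating (X - u) P at u, cut off after degree n, telescopes and leaves only the unmatched
  -- last term. That term vanishes once n exceeds the degree of P.
  [X-u]*-eval : ∀ u P n → sum {suc n} (λ i → ([X- u ]* P) (toℕ i) * u ^ toℕ i) ≈ - (P n * u ^ suc n)
  [X-u]*-eval u P zero    = solve 2 (λ u a → :- (u :* a) :* con 1ℤ :+ con 0ℤ := :- (a :* (u :* con 1ℤ))) refl u (P 0)
    where open Solver
  [X-u]*-eval u P (suc n) = trans (+Sum.sum-snoc (suc n) (λ i → ([X- u ]* P) i * u ^ i))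
    (trans (+-congʳ ([X-u]*-eval u P n))
      (solve 4 (λ u a b s → :- (a :* s) :+ (a :- u :* b) :* s := :- (b :* (u :* s))) refl
        u (P n) (P (suc n)) (u ^ suc n)))
    where open Solver

  ∏[X-]-root : ∀ v n → n ≢ 0 → sum {suc n} (λ i → ∏[X- v ] n (toℕ i) * v 0 ^ toℕ i) ≈ 0#
  ∏[X-]-root v zero    n≢0 = contradiction ≡.refl n≢0
  ∏[X-]-root v (suc n) _   = trans ([X-u]*-eval (v 0) (∏[X- v ∘ suc ] n) (suc n))
    (trans (-‿cong (trans (*-congʳ (∏[X-]-degree (v ∘ suc) n (suc n) (ℕ.n<1+n n))) (zeroˡ _))) -0#≈0#)

  ∏[X-]-ℤζ : ∀ v n i → (∀ k → ℤζ (v k)) → ℤζ (∏[X- v ] n i)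
  ∏[X-]-ℤζ v zero    zero    v∈ = ℤζ-1
  ∏[X-]-ℤζ v zero    (suc i) v∈ = ℤζ-0
  ∏[X-]-ℤζ v (suc n) zero    v∈ = ℤζ-neg (ℤζ-* (v∈ 0) (∏[X-]-ℤζ (v ∘ suc) n 0 (v∈ ∘ suc)))
  ∏[X-]-ℤζ v (suc n) (suc i) v∈ = ℤζ-+ (∏[X-]-ℤζ (v ∘ suc) n i (v∈ ∘ suc))
    (ℤζ-neg (ℤζ-* (v∈ 0) (∏[X-]-ℤζ (v ∘ suc) n (suc i) (v∈ ∘ suc))))

  σ-∏[X-] : ∀ v n i → σ (∏[X- v ] n i) ≈ ∏[X- σ ∘ v ] n i
  σ-∏[X-] v zero    zero    = σ.1#-homo
  σ-∏[X-] v zero    (suc i) = σ.0#-homo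
  σ-∏[X-] v (suc n) zero    = trans (σ.-‿homo _) (-‿cong (trans (σ.*-homo _ _) (*-congˡ (σ-∏[X-] (v ∘ suc) n 0))))
  σ-∏[X-] v (suc n) (suc i) = trans (σ.+-homo _ _) (+-cong (σ-∏[X-] (v ∘ suc) n i)
    (trans (σ.-‿homo _) (-‿cong (trans (σ.*-homo _ _) (*-congˡ (σ-∏[X-] (v ∘ suc) n (suc i)))))))

  -- u is a root of the polynomial with roots σᵏ(u), whose coefficients are fixed by σ.

  ℤζ⇒integral : ∀ {u} → ℤζ u → IntegralElement u
  ℤζ⇒integral {u} u∈ = q , c ∘ toℕ , (begin
      u ^ q + sum {q} (λ i → ιℤ (c (toℕ i)) * u ^ toℕ i)      ≈⟨ +-cong (*-identityˡ _)
                                                                   (sum-cong-≋ {q} λ i → *-congʳ {u ^ toℕ i} (P≈c (toℕ i))) ⟨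
      1# * u ^ q + sum {q} (λ i → P (toℕ i) * u ^ toℕ i)      ≈⟨ +-congʳ (*-congʳ (∏[X-]-monic (λ k → σ^ k u) q)) ⟨
      P q * u ^ q + sum {q} (λ i → P (toℕ i) * u ^ toℕ i)     ≈⟨ +-comm _ _ ⟩
      sum {q} (λ i → P (toℕ i) * u ^ toℕ i) + P q * u ^ q     ≈⟨ +Sum.sum-snoc q (λ i → P i * u ^ i) ⟨
      sum {suc q} (λ i → P (toℕ i) * u ^ toℕ i)               ≈⟨ ∏[X-]-root (λ k → σ^ k u) q q≢0 ⟩
      0#                                                      ∎)
    where
    P = ∏[X- (λ k → σ^ k u) ] q

    integer : ∀ i → ∃ λ c → P i ≈ ιℤ c
    integer i = fixed⇒integer
      (trans (σ-∏[X-] (λ k → σ^ k u) q i) (∏[X-]-cycle (λ k → σ^ k u) q (σ^q≈id u) i))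
      (∏[X-]-ℤζ (λ k → σ^ k u) q i (λ k → ℤζ-σ^ k u∈))

    c : ℕ → ℤ
    c i = proj₁ (integer i)

    P≈c : ∀ i → P i ≈ ιℤ (c i)
    P≈c i = proj₂ (integer i)

  -- The span of the conjugates of x and the ideal generated by x.

  module ConjugateSpan (n m : ℕ) (mn≡q : m ℕ.* n ≡ q) (h : ℕ) (q≡2h : q ≡ suc h ℕ.* 2)
    (l : ℤ) (l[r-1]≡1 : l ℤ.* (r ℤ.- 1ℤ) ≡ 1ℤ [mod p ]) where

    factor : ℕ → Carrier
    factor j = 1# - ζ^ (r ℤ.^ j)

    α w z x : Carrier
    α = product {suc h} (factor ∘ toℕ)
    w = ζ^ l * α
    z = w * (1# - ζ)

    Tr : Carrier → Carrier
    Tr y = sum {m} λ j → σ^ (suc (toℕ j) ℕ.* n) y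

    x = Tr z

    σ-1-ζ^ : ∀ k → σ (1# - ζ^ k) ≈ 1# - ζ^ (k ℤ.* r)
    σ-1-ζ^ k = trans (σ.+-homo 1# (- ζ^ k)) (+-cong σ.1#-homo (trans (σ.-‿homo (ζ^ k)) (-‿cong (σ-ζ^ k))))

    σ-factor : ∀ j → σ (factor j) ≈ factor (suc j)
    σ-factor j = trans (σ-1-ζ^ (r ℤ.^ j)) (reflexive (≡.cong (λ k → 1# - ζ^ k) (ℤ.*-comm (r ℤ.^ j) r)))

    -- σ replaces the factor 1 − ζ of α by 1 − ζ⁻¹ = −ζ⁻¹ (1 − ζ), because rʰ⁺¹ ≡ −1.

    σw≈-w : σ w ≈ - w
    σw≈-w = begin
      σ (ζ^ l * α)                                     ≈⟨ σ.*-homo (ζ^ l) α ⟩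
      σ (ζ^ l) * σ α                                   ≈⟨ *-cong (σ-ζ^ l) σα ⟩
      ζ^ (l ℤ.* r) * (β * (1# - ζ⁻¹))                  ≈⟨ *-congˡ (*-congˡ (+-congʳ (trans (sym ζ^0) (ζ^-+ 1ℤ (ℤ.- 1ℤ))))) ⟩
      ζ^ (l ℤ.* r) * (β * (ζ * ζ⁻¹ - ζ⁻¹))             ≈⟨ rearrange (ζ^ (l ℤ.* r)) β ζ ζ⁻¹ ⟩
      - (ζ^ (l ℤ.* r) * ζ⁻¹ * ((1# - ζ) * β))          ≈⟨ -‿cong (*-congʳ (trans (sym (ζ^-+ (l ℤ.* r) (ℤ.- 1ℤ))) (ζ^-cong lr-1≡l))) ⟩
      -- The factor of α with index 0 is 1 - ζ, since r⁰ = 1; so (1 - ζ) β is α by computation.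
      - (ζ^ l * ((1# - ζ) * β))                        ≡⟨⟩
      - w                                              ∎
      where
      β = product {h} (factor ∘ suc ∘ toℕ)
      ζ⁻¹ = ζ^ (ℤ.- 1ℤ)

      σα : σ α ≈ β * (1# - ζ⁻¹)
      σα = begin
        σ α                                        ≈⟨ σ^-product 1 {suc h} (factor ∘ toℕ) ⟩
        product {suc h} (σ ∘ factor ∘ toℕ)         ≈⟨ product-cong {suc h} (σ-factor ∘ toℕ) ⟩
        product {suc h} (factor ∘ suc ∘ toℕ)       ≈⟨ *Sum.sum-snoc h (factor ∘ suc) ⟩
        β * factor (suc h)                         ≈⟨ *-congˡ (+-congˡ (-‿cong (ζ^-cong (r^h≡-1 h q≡2h)))) ⟩
        β * (1# - ζ⁻¹)                             ∎

      open Solver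
      rearrange : ∀ a b c d → a * (b * (c * d - d)) ≈ - (a * d * ((1# - c) * b))
      rearrange = solve 4 (λ a b c d → a :* (b :* (c :* d :- d)) := :- (a :* d :* ((con 1ℤ :- c) :* b))) refl

      shift : ∀ l r → l ℤ.* (r ℤ.- 1ℤ) ℤ.- 1ℤ ≡ (l ℤ.* r ℤ.+ ℤ.- 1ℤ) ℤ.- l
      shift = ℤ-solve-∀

      -- This is where `l` comes from: σ sends ζˡ to ζˡʳ, and the factor ζ⁻¹ that α releases must
      -- bring it back to ζˡ.
      lr-1≡l : l ℤ.* r ℤ.+ ℤ.- 1ℤ ≡ l [mod p ]
      lr-1≡l = ≡.subst (+ p ∣ℤ_) (shift l r) l[r-1]≡1

    Fixed : Carrier → Set
    Fixed y = σ^ n y ≈ y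

    fixed-σ^* : ∀ {a} → Fixed a → ∀ k → σ^ (k ℕ.* n) a ≈ a
    fixed-σ^* a∈ zero    = refl
    fixed-σ^* {a} a∈ (suc k) = trans (reflexive (σ^-+ n (k ℕ.* n) a)) (trans (σ^.⟦⟧-cong n (fixed-σ^* a∈ k)) a∈)

    Tr-cong : ∀ {y y′} → y ≈ y′ → Tr y ≈ Tr y′
    Tr-cong y≈y′ = sum-cong-≋ {m} λ j → σ^.⟦⟧-cong (suc (toℕ j) ℕ.* n) y≈y′

    Tr-*-fixed : ∀ {a} y → Fixed a → Tr (y * a) ≈ Tr y * a
    Tr-*-fixed {a} y a∈ = trans
      (sum-cong-≋ {m} λ j → trans (σ^.*-homo (suc (toℕ j) ℕ.* n) y a) (*-congˡ (fixed-σ^* a∈ (suc (toℕ j)))))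
      (sym (*-distribʳ-sum {m} a (λ j → σ^ (suc (toℕ j) ℕ.* n) y)))

    fixed-ι : ∀ a → Fixed (ι a)
    fixed-ι = fixes-ι (σ^-homo n)

    Tr-sum : ∀ {k} (f : Vector Carrier k) → Tr (sum f) ≈ sum (Tr ∘ f)
    Tr-sum f = trans (sum-cong-≋ {m} λ j → σ^-sum (suc (toℕ j) ℕ.* n) f)
      (∑-comm {m} (λ j i → σ^ (suc (toℕ j) ℕ.* n) (f i)))

    Tr-- : ∀ y y′ → Tr (y - y′) ≈ Tr y - Tr y′
    Tr-- y y′ = trans
      (sum-cong-≋ {m} λ j → trans (σ^.+-homo (suc (toℕ j) ℕ.* n) y (- y′)) (+-congˡ (σ^.-‿homo (suc (toℕ j) ℕ.* n) y′)))
      (sum-- {m} (λ j → σ^ (suc (toℕ j) ℕ.* n) y) (λ j → σ^ (suc (toℕ j) ℕ.* n) y′))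

    Tr-0 : Tr 0# ≈ 0#
    Tr-0 = trans (Tr-cong (sym (zeroʳ 0#))) (trans (Tr-*-fixed 0# (σ^.0#-homo n)) (zeroʳ _))

    Tr-neg : ∀ y → Tr (- y) ≈ - Tr y
    Tr-neg y = trans (Tr-cong (sym (+-identityˡ (- y)))) (trans (Tr-- 0# y) (trans (+-congʳ Tr-0) (+-identityˡ _)))

    Tr-σ : ∀ y → Tr (σ y) ≈ σ (Tr y)
    Tr-σ y = trans (sum-cong-≋ {m} λ j → reflexive (σ^-σ (suc (toℕ j) ℕ.* n) y))
      (sym (σ^-sum 1 {m} (λ j → σ^ (suc (toℕ j) ℕ.* n) y)))

    Tr-fixed : ∀ y → Fixed (Tr y)
    Tr-fixed y = begin
      σ^ n (Tr y)                                           ≈⟨ σ^-sum n {m} (λ j → σ^ (suc (toℕ j) ℕ.* n) y) ⟩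
      sum {m} (λ j → σ^ n (σ^ (suc (toℕ j) ℕ.* n) y))       ≈⟨ sum-cong-≋ {m} (λ j → reflexive (σ^-+ n (suc (toℕ j) ℕ.* n) y)) ⟨
      sum {m} (λ j → σ^ (suc (suc (toℕ j)) ℕ.* n) y)        ≈⟨ +Sum.sum-cycle m (λ j → σ^ (suc j ℕ.* n) y) wraps ⟩
      Tr y                                                  ∎
      where
      wraps : σ^ (suc m ℕ.* n) y ≈ σ^ (1 ℕ.* n) y
      wraps = begin
        σ^ (n ℕ.+ m ℕ.* n) y     ≡⟨ σ^-+ n (m ℕ.* n) y ⟩
        σ^ n (σ^ (m ℕ.* n) y)    ≡⟨ ≡.cong (λ k → σ^ n (σ^ k y)) mn≡q ⟩
        σ^ n (σ^ q y)            ≈⟨ σ^.⟦⟧-cong n (σ^q≈id y) ⟩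
        σ^ n y                   ≡⟨ ≡.cong (λ k → σ^ k y) (ℕ.+-identityʳ n) ⟨
        σ^ (1 ℕ.* n) y           ∎

    x-fixed : Fixed x
    x-fixed = Tr-fixed z

    -- Scalar is ℤ for the span of the conjugates of x, and all of ℚ for the multiples of x.

    record IsStableSubmodule (Scalar : ℚ → Set) (S : Carrier → Set) : Set where
      field
        resp     : ∀ {y y′} → y ≈ y′ → S y → S y′
        +-closed : ∀ {y y′} → S y → S y′ → S (y + y′)
        ι-closed : ∀ {a y} → Scalar a → S y → S (ι a * y)
        σ-closed : ∀ {y} → S y → S (σ y)
        x-mem    : S x
        0∈       : Scalar 0ℚ
        -1∈      : Scalar ((ℤ.- 1ℤ) / 1)

      0-mem : S 0#
      0-mem = resp (trans (*-congʳ ι.0#-homo) (zeroˡ x)) (ι-closed 0∈ x-mem)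

      neg-closed : ∀ {y} → S y → S (- y)
      neg-closed {y} y∈ = resp (ιℤ-1* y) (ι-closed -1∈ y∈)

      -- If p ∣ k the element is 0. Otherwise k ≡ rᵉ, and induction on e applies: σ(w) = -w gives
      -- Tr(w (1 - ζ^(rᵉ⁺¹))) = -σ(Tr(w (1 - ζ^(rᵉ)))), starting from x at e = 0.
      Tr-w[1-ζ^]-mem : ∀ k → S (Tr (w * (1# - ζ^ k)))
      Tr-w[1-ζ^]-mem k with p ℕ.∣? ∣ k ∣
      ... | yes p∣k = resp (sym (trans (Tr-cong (trans (*-congˡ 1-ζ^k≈0) (zeroʳ w))) Tr-0)) 0-mem
        where
        1-ζ^k≈0 : 1# - ζ^ k ≈ 0#
        1-ζ^k≈0 = trans (+-congˡ (-‿cong (trans (ζ^-cong (≡.subst (+ p ∣ℤ_) (≡.sym (ℤ.+-identityʳ k)) p∣k)) ζ^0)))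
          (-‿inverseʳ 1#)
      ... | no p∤k = let e , k≡rᵉ = proj₂ root k p∤k in
        resp (Tr-cong (*-congˡ (+-congˡ (-‿cong (ζ^-cong {r ℤ.^ e} {k} (mod-sym k (r ℤ.^ e) k≡rᵉ)))))) (powers e)
        where
        powers : ∀ e → S (Tr (w * factor e))
        powers zero    = x-mem
        powers (suc e) = resp (begin
            - σ (Tr (w * factor e))      ≈⟨ -‿cong (Tr-σ (w * factor e)) ⟨
            - Tr (σ (w * factor e))      ≈⟨ -‿cong (Tr-cong (trans (σ.*-homo w (factor e)) (*-cong σw≈-w (σ-factor e)))) ⟩
            - Tr (- w * factor (suc e))  ≈⟨ -‿cong (trans (Tr-cong (sym (-‿distribˡ-* w (factor (suc e))))) (Tr-neg _)) ⟩
            - - Tr (w * factor (suc e))  ≈⟨ -‿involutive _ ⟩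
            Tr (w * factor (suc e))      ∎)
          (neg-closed (σ-closed (powers e)))

      -- The reason is (1 - ζ) ζⁱ = (1 - ζⁱ⁺¹) - (1 - ζⁱ). At the ends i = 0 and i = p - 1 the
      -- exponents 0 and p occur, which is why `Tr-w[1-ζ^]-mem` admits multiples of p.
      Tr-z*combination-mem : ∀ f → (∀ i → Scalar (f i)) → S (Tr (z * combination f))
      Tr-z*combination-mem f f∈ = resp (sym expand) (+Sum.sum-closed S 0-mem +-closed _ λ i →
          ι-closed (f∈ i) (+-closed (Tr-w[1-ζ^]-mem (1ℤ ℤ.+ + toℕ i)) (neg-closed (Tr-w[1-ζ^]-mem (+ toℕ i)))))
        where
        open Solver
        telescope : ∀ w a s b → w * (1# - s) * (a * b) ≈ (w * (1# - s * b) - w * (1# - b)) * a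
        telescope = solve 4 (λ w a s b → w :* (con 1ℤ :- s) :* (a :* b)
          := (w :* (con 1ℤ :- s :* b) :- w :* (con 1ℤ :- b)) :* a) refl

        expand : Tr (z * combination f) ≈
          sum λ i → ι (f i) * (Tr (w * (1# - ζ^ (1ℤ ℤ.+ + toℕ i))) - Tr (w * (1# - ζ^ (+ toℕ i))))
        expand = begin
          Tr (z * combination f)
            ≈⟨ Tr-cong (*-distribˡ-sum z (λ i → ι (f i) * ζ^ (+ toℕ i))) ⟩
          Tr (sum λ i → z * (ι (f i) * ζ^ (+ toℕ i)))
            ≈⟨ Tr-sum (λ i → z * (ι (f i) * ζ^ (+ toℕ i))) ⟩
          (sum λ i → Tr (z * (ι (f i) * ζ^ (+ toℕ i))))
            ≈⟨ sum-cong-≋ {p} (λ i → Tr-cong (trans (telescope w (ι (f i)) ζ (ζ^ (+ toℕ i)))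
                 (*-congʳ (+-congʳ (*-congˡ (+-congˡ (-‿cong (sym (ζ^-+ 1ℤ (+ toℕ i)))))))))) ⟩
          (sum λ i → Tr ((w * (1# - ζ^ (1ℤ ℤ.+ + toℕ i)) - w * (1# - ζ^ (+ toℕ i))) * ι (f i)))
            ≈⟨ sum-cong-≋ {p} (λ i → trans (Tr-*-fixed _ (fixed-ι (f i)))
                 (trans (*-congʳ (Tr-- (w * (1# - ζ^ (1ℤ ℤ.+ + toℕ i))) (w * (1# - ζ^ (+ toℕ i))))) (*-comm _ _))) ⟩
          (sum λ i → ι (f i) * (Tr (w * (1# - ζ^ (1ℤ ℤ.+ + toℕ i))) - Tr (w * (1# - ζ^ (+ toℕ i))))) ∎

    Invertible : Carrier → Set
    Invertible y = ∃ λ y′ → y * y′ ≈ 1#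

    invertible-* : ∀ {y y′} → Invertible y → Invertible y′ → Invertible (y * y′)
    invertible-* {y} {y′} (v , yv≈1) (v′ , y′v′≈1) = v * v′ ,
      trans (interchange y y′ v v′) (trans (*-cong yv≈1 y′v′≈1) (*-identityˡ 1#))
      where
      open Solver
      interchange : ∀ a b c d → a * b * (c * d) ≈ a * c * (b * d)
      interchange = solve 4 (λ a b c d → a :* b :* (c :* d) := a :* c :* (b :* d)) refl

    -- The inverse is -(1/p) · Σ (i + 1) ζⁱ over 0 ≤ i < p: multiplied by 1 - ζ, the weighted sum
    -- telescopes to Σ ζⁱ - p ζᵖ = -p.
    invertible-1-ζ : Invertible (1# - ζ)
    invertible-1-ζ = ι (ℚ.1/ p′) * - weighted p , (begin
        (1# - ζ) * (ι (ℚ.1/ p′) * - weighted p)    ≈⟨ rearrange (1# - ζ) (ι (ℚ.1/ p′)) (weighted p) ⟩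
        ι (ℚ.1/ p′) * - ((1# - ζ) * weighted p)    ≈⟨ *-congˡ (-‿cong (trans (telescope p) (+-cong ∑ζ (-‿cong (*-congˡ ζ^p≈1))))) ⟩
        ι (ℚ.1/ p′) * - (0# - ι p′ * 1#)           ≈⟨ cleanup (ι (ℚ.1/ p′)) (ι p′) ⟩
        ι (ℚ.1/ p′) * ι p′                         ≈⟨ ι.*-homo (ℚ.1/ p′) p′ ⟨
        ι (ℚ.1/ p′ ℚ.* p′)                         ≈⟨ ι.⟦⟧-cong (ℚ.*-inverseˡ p′) ⟩
        ι 1ℚ                                       ≈⟨ ι.1#-homo ⟩
        1#                                         ∎)
      where
      p′ = + p / 1
      instance _ = ℚ.≢-nonZero {p′} λ p′≡0 → contradiction (/1-injective (+ p) 0ℤ p′≡0) λ ()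

      weighted : ℕ → Carrier
      weighted k = sum {k} λ i → ιℤ (+ suc (toℕ i)) * ζ^ (+ toℕ i)

      ζ^p≈1 : ζ^ (+ p) ≈ 1#
      ζ^p≈1 = trans (ζ^-cong (≡.subst (p ℕ.∣_) (≡.sym (ℕ.+-identityʳ p)) ℕ.∣-refl)) ζ^0

      open Solver
      rearrange : ∀ a b c → a * (b * - c) ≈ b * - (a * c)
      rearrange = solve 3 (λ a b c → a :* (b :* (:- c)) := b :* (:- (a :* c))) refl

      cleanup : ∀ a b → a * - (0# - b * 1#) ≈ a * b
      cleanup = solve 2 (λ a b → a :* (:- (con 0ℤ :- b :* con 1ℤ)) := a :* b) refl

      step : ∀ s t c ζ → s - c * t + (1# - ζ) * ((1# + c) * t) ≈ (s + t) - (1# + c) * (ζ * t)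
      step = solve 4 (λ s t c ζ → s :- c :* t :+ (con 1ℤ :- ζ) :* ((con 1ℤ :+ c) :* t)
        := (s :+ t) :- (con 1ℤ :+ c) :* (ζ :* t)) refl

      telescope : ∀ k → (1# - ζ) * weighted k ≈ sum {k} (λ i → ζ^ (+ toℕ i)) - ιℤ (+ k) * ζ^ (+ k)
      telescope zero    = trans (zeroʳ _) (sym (trans (+-congˡ (-‿cong (trans (*-congʳ ι.0#-homo) (zeroˡ _)))) (-‿inverseʳ 0#)))
      telescope (suc k) = begin
        (1# - ζ) * weighted (suc k)
          ≈⟨ *-congˡ (+Sum.sum-snoc k (λ i → ιℤ (+ suc i) * ζ^ (+ i))) ⟩
        (1# - ζ) * (weighted k + ιℤ (+ suc k) * ζ^ (+ k))
          ≈⟨ distribˡ _ _ _ ⟩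
        (1# - ζ) * weighted k + (1# - ζ) * (ιℤ (+ suc k) * ζ^ (+ k))
          ≈⟨ +-cong (telescope k) (*-congˡ (*-congʳ 1+k)) ⟩
        sum {k} (λ i → ζ^ (+ toℕ i)) - ιℤ (+ k) * ζ^ (+ k) + (1# - ζ) * ((1# + ιℤ (+ k)) * ζ^ (+ k))
          ≈⟨ step (sum {k} λ i → ζ^ (+ toℕ i)) (ζ^ (+ k)) (ιℤ (+ k)) ζ ⟩
        (sum {k} (λ i → ζ^ (+ toℕ i)) + ζ^ (+ k)) - (1# + ιℤ (+ k)) * (ζ * ζ^ (+ k))
          ≈⟨ +-cong (+Sum.sum-snoc k (λ i → ζ^ (+ i))) (-‿cong (*-cong 1+k (ζ^-+ 1ℤ (+ k)))) ⟨
        sum {suc k} (λ i → ζ^ (+ toℕ i)) - ιℤ (+ suc k) * ζ^ (+ suc k) ∎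
        where
        1+k : ιℤ (+ suc k) ≈ 1# + ιℤ (+ k)
        1+k = trans (ιℤ-+ 1ℤ (+ k)) (+-congʳ ι.1#-homo)

    invertible-σ : ∀ {y} → Invertible y → Invertible (σ y)
    invertible-σ {y} (v , yv≈1) = σ v , trans (sym (σ.*-homo y v)) (trans (σ.⟦⟧-cong yv≈1) σ.1#-homo)

    invertible-factor : ∀ j → Invertible (factor j)
    invertible-factor zero    = invertible-1-ζ
    invertible-factor (suc j) = let v , eq = invertible-σ (invertible-factor j) in
      v , trans (*-congʳ (sym (σ-factor j))) eq

    invertible-z : Invertible z
    invertible-z = invertible-* (invertible-* invertible-ζ^l
        (*Sum.sum-closed Invertible (1# , *-identityˡ 1#) invertible-* {suc h} _ (invertible-factor ∘ toℕ)))
      invertible-1-ζ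
      where
      invertible-ζ^l : Invertible (ζ^ l)
      invertible-ζ^l = ζ^ (ℤ.- l) , trans (sym (ζ^-+ l (ℤ.- l))) (trans (reflexive (≡.cong ζ^_ (ℤ.+-inverseʳ l))) ζ^0)

    module _ {u} (u∈ : ℤζ u) (ux≈σx : u * x ≈ σ x) where

      multiples-stable : IsStableSubmodule (λ _ → ⊤) (λ y → ∃ λ c → y ≈ x * c)
      multiples-stable = record
        { resp     = λ y≈y′ (c , y≈xc) → c , trans (sym y≈y′) y≈xc
        ; +-closed = λ (c , y≈xc) (d , y′≈xd) → c + d , trans (+-cong y≈xc y′≈xd) (sym (distribˡ x c d))
        ; ι-closed = λ {a} _ (c , y≈xc) → ι a * c , trans (*-congˡ y≈xc) (swap (ι a) x c)
        -- Here the hypothesis enters: σ(x c) = σ(x) σ(c) = x (u σ(c)).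
        ; σ-closed = λ (c , y≈xc) → u * σ c , trans (σ.⟦⟧-cong y≈xc) (trans (σ.*-homo x c)
            (trans (*-congʳ (sym ux≈σx)) (assoc u x (σ c))))
        ; x-mem    = 1# , sym (*-identityʳ x)
        ; 0∈       = tt
        ; -1∈      = tt
        }
        where
        open Solver
        swap : ∀ a b c → a * (b * c) ≈ b * (a * c)
        swap = solve 3 (λ a b c → a :* (b :* c) := b :* (a :* c)) refl
        assoc : ∀ a b c → a * b * c ≈ b * (a * c)
        assoc = solve 3 (λ a b c → a :* b :* c := b :* (a :* c)) refl

      -- Every trace Tr(z b) is a multiple of x; taking b = z⁻¹, so is Tr(1) = m.

      x∣m : ∃ λ c → ιℤ (+ m) ≈ x * c
      x∣m =
        let z′ , zz′≈1 = invertible-z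
            f , z′≈f = coordinates z′
            c , eq = IsStableSubmodule.Tr-z*combination-mem multiples-stable f (λ _ → tt)
        in c , (begin
          ιℤ (+ m)                    ≈⟨ *-identityʳ _ ⟨
          ιℤ (+ m) * 1#               ≈⟨ sum-const m 1# ⟨
          sum {m} (λ _ → 1#)          ≈⟨ sum-cong-≋ {m} (λ j → σ^.1#-homo (suc (toℕ j) ℕ.* n)) ⟨
          Tr 1#                       ≈⟨ Tr-cong zz′≈1 ⟨
          Tr (z * z′)                 ≈⟨ Tr-cong (*-congˡ z′≈f) ⟩
          Tr (z * combination f)      ≈⟨ eq ⟩
          x * c                       ∎)

      x-cancel : ∀ {a b} → a * x ≈ b * x → a ≈ b
      x-cancel {a} {b} ax≈bx = let c , m≈xc = x∣m in ιℤ-cancel (+ m) m≢0 (begin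
        ιℤ (+ m) * a    ≈⟨ *-congʳ m≈xc ⟩
        x * c * a       ≈⟨ rearrange x c a ⟩
        a * x * c       ≈⟨ *-congʳ ax≈bx ⟩
        b * x * c       ≈⟨ rearrange x c b ⟨
        x * c * b       ≈⟨ *-congʳ m≈xc ⟨
        ιℤ (+ m) * b    ∎)
        where
        m≢0 : + m ≢ 0ℤ
        m≢0 m≡0 = q≢0 (≡.trans (≡.sym mn≡q) (≡.cong (ℕ._* n) (ℤ.+-injective m≡0)))

        open Solver
        rearrange : ∀ a b c → a * b * c ≈ c * a * b
        rearrange = solve 3 (λ a b c → a :* b :* c := c :* a :* b) refl

      -- Both x and σ(x) are fixed by σⁿ, so applying σⁿ to u x = σ(x) and cancelling x leaves u.
      u-fixed : Fixed u
      u-fixed = x-cancel (begin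
        σ^ n u * x             ≈⟨ *-congˡ x-fixed ⟨
        σ^ n u * σ^ n x        ≈⟨ σ^.*-homo n u x ⟨
        σ^ n (u * x)           ≈⟨ σ^.⟦⟧-cong n ux≈σx ⟩
        σ^ n (σ x)             ≡⟨ σ^-σ n x ⟩
        σ (σ^ n x)             ≈⟨ σ.⟦⟧-cong x-fixed ⟩
        σ x                    ≈⟨ ux≈σx ⟨
        u * x                  ∎)

      conjugate-multiple : ∀ k → ∃ λ a → ℤζ a × Fixed a × σ^ k x ≈ x * a
      conjugate-multiple zero    = 1# , ℤζ-1 , σ^.1#-homo n , sym (*-identityʳ x)
      conjugate-multiple (suc k) = let a , a∈ , a-fixed , eq = conjugate-multiple k in
        u * σ a , ℤζ-* u∈ (ℤζ-σ^ 1 a∈) ,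
        trans (σ^.*-homo n u (σ a)) (*-cong u-fixed (trans (reflexive (σ^-σ n a)) (σ.⟦⟧-cong a-fixed))) ,
        -- The cofactor produced by σ-stability is u σ(a), the witness given above, so only the
        -- equation is taken over.
        proj₂ (IsStableSubmodule.σ-closed multiples-stable (a , eq))

    Span : Carrier → Set
    Span y = ∃ λ (c : Vector ℤ n) → y ≈ sum λ i → ιℤ (c i) * σ^ (toℕ i) x

    PrincipalIdeal : Carrier → Set
    PrincipalIdeal y = ∃ λ a → (Fixed a × IntegralElement a) × y ≈ x * a

    -- The cofactor of x is an integer combination of the cofactors of its conjugates, hence fixed
    -- by σⁿ and in ℤ[ζ]; `ℤζ⇒integral` then places it in the ring of integers.
    span⊆principal : ∀ {u} → ℤζ u → u * x ≈ σ x → ∀ {y} → Span y → PrincipalIdeal y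
    span⊆principal u∈ ux≈σx {y} (c , y≈c) = a , (a-fixed , ℤζ⇒integral a∈) , (begin
        y                                            ≈⟨ y≈c ⟩
        sum (λ i → ιℤ (c i) * σ^ (toℕ i) x)          ≈⟨ sum-cong-≋ {n} (λ i → trans (*-congˡ (proj₂ (proj₂ (proj₂ (multiple i)))))
                                                          (swap (ιℤ (c i)) x (b i))) ⟩
        sum (λ i → x * (ιℤ (c i) * b i))             ≈⟨ *-distribˡ-sum {n} x (λ i → ιℤ (c i) * b i) ⟨
        x * a                                        ∎)
      where
      open Solver
      swap : ∀ a b c → a * (b * c) ≈ b * (a * c)
      swap = solve 3 (λ a b c → a :* (b :* c) := b :* (a :* c)) refl

      multiple : ∀ (i : Fin n) → _
      multiple i = conjugate-multiple u∈ ux≈σx (toℕ i)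

      b : Fin n → Carrier
      b i = proj₁ (multiple i)

      a : Carrier
      a = sum λ i → ιℤ (c i) * b i

      a∈ : ℤζ a
      a∈ = ℤζ-sum {n} _ λ i → ℤζ-ιℤ* (c i) (proj₁ (proj₂ (multiple i)))

      a-fixed : Fixed a
      a-fixed = trans (σ^-sum n {n} (λ i → ιℤ (c i) * b i)) (sum-cong-≋ {n} λ i →
        trans (σ^.*-homo n (ιℤ (c i)) (b i)) (*-cong (fixed-ι (c i / 1)) (proj₁ (proj₂ (proj₂ (multiple i))))))

    span-stable : IsStableSubmodule IsInteger Span
    span-stable = record
      { resp     = span-resp
      ; +-closed = span-+
      ; ι-closed = span-ι
      ; σ-closed = λ {y} (c , y≈c) → span-resp
          (sym (trans (σ.⟦⟧-cong y≈c) (trans (σ^-sum 1 {n} (λ i → ιℤ (c i) * σ^ (toℕ i) x))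
            (sum-cong-≋ {n} λ i → trans (σ.*-homo (ιℤ (c i)) (σ^ (toℕ i) x)) (*-congʳ (fixes-ι σ-homo (c i / 1)))))))
          (+Sum.sum-closed Span span-0 span-+ {n} _ λ i → span-ι (c i , ≡.refl) (span-conjugate (suc (toℕ i)) (Fin.toℕ<n i)))
      ; x-mem    = span-conjugate 0 z≤n
      ; 0∈       = 0ℤ , ≡.refl
      ; -1∈      = ℤ.- 1ℤ , ≡.refl
      }
      where
      span-resp : ∀ {y y′} → y ≈ y′ → Span y → Span y′
      span-resp y≈y′ (c , y≈c) = c , trans (sym y≈y′) y≈c

      span-0 : Span 0#
      span-0 = (λ _ → 0ℤ) , sym (+Sum.sum-ε {n} _ λ i → trans (*-congʳ ι.0#-homo) (zeroˡ _))

      span-+ : ∀ {y y′} → Span y → Span y′ → Span (y + y′)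
      span-+ (c , y≈c) (d , y′≈d) = (λ i → c i ℤ.+ d i) , trans (+-cong y≈c y′≈d) (sym (trans
        (sum-cong-≋ {n} λ i → trans (*-congʳ (ιℤ-+ (c i) (d i))) (distribʳ (σ^ (toℕ i) x) (ιℤ (c i)) (ιℤ (d i))))
        (∑-distrib-+ {n} (λ i → ιℤ (c i) * σ^ (toℕ i) x) (λ i → ιℤ (d i) * σ^ (toℕ i) x))))

      span-ι : ∀ {a y} → IsInteger a → Span y → Span (ι a * y)
      span-ι (k , ≡.refl) (c , y≈c) = (λ i → k ℤ.* c i) , trans (*-congˡ y≈c) (trans
        (*-distribˡ-sum {n} (ιℤ k) (λ i → ιℤ (c i) * σ^ (toℕ i) x))
        (sum-cong-≋ {n} λ i → trans (sym (*-assoc (ιℤ k) (ιℤ (c i)) (σ^ (toℕ i) x))) (*-congʳ (sym (ιℤ-* k (c i))))))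

      span-basis : ∀ k → k ℕ.< n → Span (σ^ k x)
      span-basis k k<n = δ (Fin.fromℕ< k<n) , sym (trans (sum-δ (Fin.fromℕ< k<n) (λ i → σ^ (toℕ i) x))
        (reflexive (≡.cong (λ j → σ^ j x) (Fin.toℕ-fromℕ< k<n))))

      n≢0 : n ≢ 0
      n≢0 n≡0 = q≢0 (≡.trans (≡.sym mn≡q) (≡.trans (≡.cong (m ℕ.*_) n≡0) (ℕ.*-zeroʳ m)))

      -- The bound includes k = n because σ carries the last generator σⁿ⁻¹(x) to σⁿ(x), which is x
      -- again.
      span-conjugate : ∀ k → k ℕ.≤ n → Span (σ^ k x)
      span-conjugate k k≤n with ℕ.m≤n⇒m<n∨m≡n k≤n
      ... | inj₁ k<n    = span-basis k k<n
      ... | inj₂ ≡.refl = span-resp (sym x-fixed) (span-basis 0 (ℕ.n≢0⇒n>0 n≢0))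

    -- Since a is fixed by σⁿ, it moves inside the trace: x a = Tr(z) a = Tr(z a). Integral
    -- closedness supplies the integer coordinates of a.
    principal⊆span : ∀ {y} → PrincipalIdeal y → Span y
    principal⊆span {y} (a , (a-fixed , a-integral) , y≈xa) =
      let g , a≈g = integral⇒ℤζ a-integral in
      IsStableSubmodule.resp span-stable (begin
          Tr (z * combination (λ i → g i / 1))     ≈⟨ Tr-cong (*-congˡ a≈g) ⟨
          Tr (z * a)                               ≈⟨ Tr-*-fixed z a-fixed ⟩
          x * a                                    ≈⟨ y≈xa ⟨
          y                                        ∎)
        (IsStableSubmodule.Tr-z*combination-mem span-stable (λ i → g i / 1) (λ i → g i , ≡.refl))

-- Transfer to the definitions of the statement.

even⊎suc-even : ∀ n → (2 ℕ.∣ n) ⊎ (2 ℕ.∣ suc n)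
even⊎suc-even zero    = inj₁ (2 ℕ.∣0)
even⊎suc-even (suc n) = Sum.swap (Sum.map₁ (ℕ.∣m∣n⇒∣m+n ℕ.∣-refl) (even⊎suc-even n))

-- An even prime would be 2, and then n ∣ 1, against 1 < n. For odd p the number of factors of α is
-- (p - 3)/2 + 1 = (p - 1)/2, which is the exponent at which r becomes -1.
odd-prime : ∀ {n k} → 1 < n → n ℕ.∣ suc k → Prime (suc (suc k)) → suc k ≡ suc ((suc (suc k) ∸ 3) ℕ./ 2) ℕ.* 2
odd-prime {n} {k} 1<n n∣p-1 p-prime with even⊎suc-even (suc k)
... | inj₁ (ℕ.divides (suc e) ≡.refl) = ≡.cong (λ h → suc h ℕ.* 2) (≡.sym (ℕ.m*n/n≡m e 2))
... | inj₂ 2∣p with prime⇒irreducible p-prime 2∣p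
...   | inj₂ ≡.refl = contradiction (ℕ.∣1⇒≡1 n∣p-1) (ℕ.>⇒≢ 1<n)

module Instance (n k : ℕ) .{{_ : NonZero n}} (1<n : 1 < n) (p-prime : Prime (suc (suc k))) (n∣p-1 : n ∣ suc k)
  (r : ℤ) (root : IsPrimitiveRoot (suc (suc k)) r)
  (σ : Cyclotomic.ℚ⟨ζ⟩ (suc (suc k)) → Cyclotomic.ℚ⟨ζ⟩ (suc (suc k)))
  (σ-iso : Cyclotomic.IsAutomorphism (suc (suc k)) σ)
  (σζ : Cyclotomic._≈_ (suc (suc k)) (σ (Cyclotomic.ζ (suc (suc k)))) (Cyclotomic.ζ^_ (suc (suc k)) r))
  (l : ℤ) (l[r-1]≡1 : l *ℤ (r -ℤ 1ℤ) ≡ 1ℤ [mod suc (suc k) ]) where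

  p = suc (suc k)

  module C = Cyclotomic p
  open Model k using (cyclotomicField; scale-1#; ≗⇒≈; ≈-refl; ≈-sym; ≈-trans; +-cong-≈)
  open Galois (suc k) p-prime cyclotomicField r root σ
    (RingMorphisms.IsRingIsomorphism.isRingHomomorphism σ-iso) σζ hiding (p)
  open ConjugateSpan n (suc k ℕ./ n) (ℕ.m/n*n≡m n∣p-1) ((p ∸ 3) ℕ./ 2) (odd-prime 1<n n∣p-1 p-prime) l l[r-1]≡1
  open C using (ℚ⟨ζ⟩; _•_; Integral; ℤ[ζ]; _/_∈_)
  open C.FixedField n σ using (conjugateSpan; principalIdeal)

  conjugate : Fin n → ℚ⟨ζ⟩
  conjugate i = σ^ (toℕ i) x

  ∑• ∑ιℤ : ∀ {d} → Vector ℤ d → (Fin d → ℚ⟨ζ⟩) → ℚ⟨ζ⟩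
  ∑•  c f = sum λ i → c i • f i
  ∑ιℤ c f = sum λ i → ιℤ (c i) * f i

  -- The statement scales coordinates by an integer, the interface multiplies by its image under
  -- `ι`; `scale-1#` identifies the two coordinate by coordinate.
  ∑•≈∑ιℤ : ∀ {d} (c : Vector ℤ d) f → ∑• c f ≈ ∑ιℤ c f
  ∑•≈∑ιℤ {d} c f = sum-cong-≋ {d} {λ i → c i • f i} {λ i → ιℤ (c i) * f i} λ i →
    ≗⇒≈ (c i • f i) (ιℤ (c i) * f i) λ j → ≡.sym (scale-1# (c i / 1) (f i) j)

  powers : ∀ {d} → ℚ⟨ζ⟩ → Fin d → ℚ⟨ζ⟩
  powers y i = y ^ toℕ i

  toIntegral : ∀ y → Integral y → IntegralElement y
  toIntegral y (d , a , y-root) = d , a ,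
    ≈-trans (y ^ d + ∑ιℤ a (powers y)) (y ^ d + ∑• a (powers y)) 0#
      (+-cong-≈ (y ^ d) (y ^ d) (∑ιℤ a (powers y)) (∑• a (powers y)) (≈-refl (y ^ d))
        (≈-sym (∑• a (powers y)) (∑ιℤ a (powers y)) (∑•≈∑ιℤ a (powers y))))
      y-root

  fromIntegral : ∀ y → IntegralElement y → Integral y
  fromIntegral y (d , a , y-root) = d , a ,
    ≈-trans (y ^ d + ∑• a (powers y)) (y ^ d + ∑ιℤ a (powers y)) 0#
      (+-cong-≈ (y ^ d) (y ^ d) (∑• a (powers y)) (∑ιℤ a (powers y)) (≈-refl (y ^ d)) (∑•≈∑ιℤ a (powers y)))
      y-root

  toSpan : ∀ y → conjugateSpan x y → Span y
  toSpan y (c , y≈c) = c , ≈-trans y (∑• c conjugate) (∑ιℤ c conjugate) y≈c (∑•≈∑ιℤ c conjugate)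

  fromSpan : ∀ y → Span y → conjugateSpan x y
  fromSpan y (c , y≈c) = c , ≈-trans y (∑ιℤ c conjugate) (∑• c conjugate) y≈c
    (≈-sym (∑• c conjugate) (∑ιℤ c conjugate) (∑•≈∑ιℤ c conjugate))

  toPrincipal : ∀ y → principalIdeal x y → PrincipalIdeal y
  toPrincipal y (b , (b-fixed , b-integral) , y≈xb) = b , (b-fixed , toIntegral b b-integral) , y≈xb

  fromPrincipal : ∀ y → PrincipalIdeal y → principalIdeal x y
  fromPrincipal y (b , (b-fixed , b-integral) , y≈xb) = b , (b-fixed , fromIntegral b b-integral) , y≈xb

  span≐principal : σ x / x ∈ ℤ[ζ] → conjugateSpan x ≐ principalIdeal x
  span≐principal (u , (d , a , u≈a) , ux≈σx) =
    (λ {y} y∈ → fromPrincipal y (span⊆principal {u} u∈ ux≈σx {y} (toSpan y y∈))) ,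
    (λ {y} y∈ → fromSpan y (principal⊆span {y} (toPrincipal y y∈)))
    where
    u∈ : ℤζ u
    u∈ = ℤζ-resp {∑ιℤ a (powers ζ)} {u}
      (≈-sym u (∑ιℤ a (powers ζ)) (≈-trans u (∑• a (powers ζ)) (∑ιℤ a (powers ζ)) u≈a (∑•≈∑ιℤ a (powers ζ))))
      (ℤζ-sum (λ i → ιℤ (a i) * powers ζ i) λ i →
        ℤζ-ιℤ* (a i) {powers ζ i} (ℤζ-^ {ζ} (toℕ i) (ℤζ-ζ^ 1ℤ)))

  x≡Tr-z : x ≡ C.FixedField.Tr n σ ((C.ζ^ l) C.* C.α r C.* (C.1# C.- C.ζ))
  x≡Tr-z = ≡.refl

theorem4 : (n p : ℕ) .{{_ : NonZero n}} →
    1 < n → ¬ (2 ∣ n) → Prime p → n ∣ p ∸ 1 →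
    let open Cyclotomic p in
    (r : ℤ) → IsPrimitiveRoot p r →
    (σ : ℚ⟨ζ⟩ → ℚ⟨ζ⟩) → IsAutomorphism σ → σ ζ ≈ (ζ^ r) →
    (l : ℤ) → l *ℤ (r -ℤ 1ℤ) ≡ 1ℤ [mod p ] →
    let open FixedField n σ
        z = (ζ^ l) * α r * (1# - ζ)
        x = Tr z
    in
    σ x / x ∈ ℤ[ζ] → conjugateSpan x ≐ principalIdeal x
theorem4 n 0 _ _ ()
theorem4 n 1 _ _ ()
theorem4 n p@(suc (suc k)) 1<n _ p-prime n∣p-1 r root σ σ-iso σζ l l[r-1]≡1 =
  ≡.subst (λ x → σ x / x ∈ ℤ[ζ] → conjugateSpan x ≐ principalIdeal x) x≡Tr-z span≐principal
  where
  open Cyclotomic p using (ℤ[ζ]; _/_∈_)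
  open Cyclotomic.FixedField p n σ using (conjugateSpan; principalIdeal)
  open Instance n k 1<n p-prime n∣p-1 r root σ σ-iso σζ l l[r-1]≡1 using (x≡Tr-z; span≐principal)
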